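{- Let $l,m,n$ be positive integers with $\frac1l+\frac1m+\frac1n\le 1$, and let $\mathcal H$ be a finite orientably regular hypermap of type $(l,m,n)$. Then $\mathcal H$ is covered by infinitely many (pairwise non-isomorphic) finite orientably regular chiral hypermaps of the same type $(l,m,n)$.
   Context: For positive integers $l,m,n$, let $\Delta^*=\Delta^*(l,m,n)=\langle r_0,r_1,r_2\mid r_0^2=r_1^2=r_2^2=(r_1r_2)^l=(r_2r_0)^m=(r_0r_1)^n=1\rangle$ be the extended triangle group of type $(l,m,n)$, and let $\Delta=\Delta(l,m,n)=\langle x,y,z\mid x^l=y^m=z^n=xyz=1\rangle$ be the triangle group of that type, identified with the index-$2$ subgroup of $\Delta^*$ of words of even length via $x=r_1r_2$, $y=r_2r_0$, $z=r_0r_1$. The type $(l,m,n)$ is non-spherical if $\frac1l+\frac1m+\frac1n\le 1$. Orientably regular hypermaps $\mathcal H$ of non-spherical type $(l,m,n)$, up to isomorphism of oriented hypermaps (orientation-preserving isomorphism), correspond bijectively to torsion-free normal subgroups $N$ of $\Delta$, with orientation-preserving automorphism group $\mathrm{Aut}^+\mathcal H\cong\Delta/N$. (For normal $N$ of finite index, torsion-freeness means that the images of $x,y,z$ in $\Delta/N$ have orders exactly $l,m,n$.) The hypermap $\mathcal H$ is finite if and only if $N$ has finite index in $\Delta$. The hypermap corresponding to $N_1$ covers the hypermap corresponding to $N$ if $N_1\le N$. The hypermap corresponding to $N$ is reflexible (regular) if $N$ is normal in $\Delta^*$, and chiral if $N$ is not normal in $\Delta^*$. -}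

module Defs where

open import Algebra.Bundles using (Group; RawMonoid)
open import Algebra.Definitions.RawMonoid as RawMonoidDefs using ()
open import Data.Fin.Base using (Fin)
open import Data.List.Base using (List; []; _∷_)
open import Data.List.Membership.Propositional using (_∈_)
open import Data.Nat.Base using (ℕ; _<_)
open import Data.Product.Base using (Σ; ∃; _×_; _,_)
open import Function.Bundles using (_⇔_)
open import Function.Definitions using (StrictlySurjective)
open import Level using (Level; 0ℓ; _⊔_) renaming (suc to lsuc)
open import Relation.Binary.PropositionalEquality using (_≡_)
open import Relation.Nullary using (¬_)
open import Relation.Unary using (Pred; _⊆_; _≐_)

------------------------------------------------------------------------
-- Subgroups, as predicates respecting the group's equality

module _ {c ℓ p : Level} (G : Group c ℓ) (N : Pred (Group.Carrier G) p) where
  open Group G using (Carrier; _≈_; _∙_; ε; _⁻¹)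

  record IsSubgroup : Set (c ⊔ ℓ ⊔ p) where
    field
      resp-≈    : ∀ {g h} → g ≈ h → N g → N h
      ε-closed  : N ε
      ∙-closed  : ∀ {g h} → N g → N h → N (g ∙ h)
      ⁻¹-closed : ∀ {g} → N g → N (g ⁻¹)

  Normal : Set (c ⊔ p)
  Normal = ∀ g {h} → N h → N ((g ∙ h) ∙ (g ⁻¹))

  -- For a subgroup N: `coset` induces a bijection from the set of left cosets
  -- of N onto Fin k.
  FiniteIndex : Set (c ⊔ p)
  FiniteIndex = ∃ λ (k : ℕ) → Σ (Carrier → Fin k) λ coset →
    (∀ g h → coset g ≡ coset h ⇔ N (g ⁻¹ ∙ h)) × StrictlySurjective _≡_ coset

------------------------------------------------------------------------
-- Groups given by generators and relators

infixl 7 _∙_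
infixl 9 _⁻¹

data Word (A : Set) : Set where
  gen : A → Word A
  ε   : Word A
  _∙_ : Word A → Word A → Word A
  _⁻¹ : Word A → Word A

infixl 8 _^_

_^_ : {A : Set} → Word A → ℕ → Word A
_^_ {A} w n = n · w
  where
  wordMonoid : RawMonoid 0ℓ 0ℓ
  wordMonoid = record { Carrier = Word A ; _≈_ = _≡_ ; _∙_ = _∙_ ; ε = ε }
  open RawMonoidDefs wordMonoid renaming (_×_ to _·_)

-- The least congruence on words satisfying the group axioms and killing the
-- given relators.
data Equal {A : Set} (relators : List (Word A)) : Word A → Word A → Set where
  refl      : ∀ {u} → Equal relators u u
  sym       : ∀ {u v} → Equal relators u v → Equal relators v u
  trans     : ∀ {u v w} → Equal relators u v → Equal relators v w → Equal relators u w
  ∙-cong    : ∀ {u u′ v v′} → Equal relators u u′ → Equal relators v v′ →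
              Equal relators (u ∙ v) (u′ ∙ v′)
  ⁻¹-cong   : ∀ {u v} → Equal relators u v → Equal relators (u ⁻¹) (v ⁻¹)
  assoc     : ∀ u v w → Equal relators ((u ∙ v) ∙ w) (u ∙ (v ∙ w))
  identityˡ : ∀ u → Equal relators (ε ∙ u) u
  identityʳ : ∀ u → Equal relators (u ∙ ε) u
  inverseˡ  : ∀ u → Equal relators ((u ⁻¹) ∙ u) ε
  inverseʳ  : ∀ u → Equal relators (u ∙ (u ⁻¹)) ε
  relator   : ∀ {r} → r ∈ relators → Equal relators r ε

⟨_∣_⟩ : (A : Set) → List (Word A) → Group 0ℓ 0ℓ
⟨ A ∣ relators ⟩ = record
  { Carrier = Word A
  ; _≈_     = Equal relators
  ; _∙_     = _∙_
  ; ε       = ε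
  ; _⁻¹     = _⁻¹
  ; isGroup = record
    { isMonoid = record
      { isSemigroup = record
        { isMagma = record
          { isEquivalence = record { refl = refl ; sym = sym ; trans = trans }
          ; ∙-cong        = ∙-cong
          }
        ; assoc = assoc
        }
      ; identity = identityˡ , identityʳ
      }
    ; inverse = inverseˡ , inverseʳ
    ; ⁻¹-cong = ⁻¹-cong
    }
  }

substitute : {A B : Set} → (A → Word B) → Word A → Word B
substitute f (gen a) = f a
substitute f ε       = ε
substitute f (u ∙ v) = substitute f u ∙ substitute f v
substitute f (u ⁻¹)  = substitute f u ⁻¹

------------------------------------------------------------------------
-- Triangle groups

data Reflection : Set where
  ρ₀ ρ₁ ρ₂ : Reflection

data Rotation : Set where
  ξ η ζ : Rotation

r₀ r₁ r₂ : Word Reflection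
r₀ = gen ρ₀
r₁ = gen ρ₁
r₂ = gen ρ₂

x y z : Word Rotation
x = gen ξ
y = gen η
z = gen ζ

Δ* : ℕ → ℕ → ℕ → Group 0ℓ 0ℓ
Δ* l m n = ⟨ Reflection ∣
  r₀ ^ 2 ∷ r₁ ^ 2 ∷ r₂ ^ 2 ∷ (r₁ ∙ r₂) ^ l ∷ (r₂ ∙ r₀) ^ m ∷ (r₀ ∙ r₁) ^ n ∷ [] ⟩

Δ : ℕ → ℕ → ℕ → Group 0ℓ 0ℓ
Δ l m n = ⟨ Rotation ∣ x ^ l ∷ y ^ m ∷ z ^ n ∷ x ∙ y ∙ z ∷ [] ⟩

-- On words, the monomorphism identifying Δ with the even-length subgroup of Δ*.
embed : Word Rotation → Word Reflection
embed = substitute λ where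
  ξ → r₁ ∙ r₂
  η → r₂ ∙ r₀
  ζ → r₀ ∙ r₁

-- The subset of Δ* with which a subset of Δ is identified.
image : ∀ l m n → Pred (Word Rotation) 0ℓ → Pred (Word Reflection) 0ℓ
image l m n N w = ∃ λ v → N v × embed v ≈ w
  where open Group (Δ* l m n) using (_≈_)

------------------------------------------------------------------------
-- Orientably regular hypermaps

-- For a normal subgroup N of Δ: the image of w in Δ/N has order exactly k.
record HasOrderModulo (N : Pred (Word Rotation) 0ℓ) (w : Word Rotation) (k : ℕ) : Set where
  field
    positive : 0 < k
    power    : N (w ^ k)
    least    : ∀ j → 0 < j → j < k → ¬ N (w ^ j)

-- A hypermap is represented by the normal subgroup N of Δ corresponding to it.
-- That x, y and z have orders exactly l, m and n modulo N, not proper divisors,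
-- amounts to N being torsion-free: in the non-spherical case the torsion
-- elements of Δ are the conjugates of powers of x, y and z.
record OrientablyRegularHypermap (l m n : ℕ) : Set (lsuc 0ℓ) where
  field
    N          : Pred (Word Rotation) 0ℓ
    isSubgroup : IsSubgroup (Δ l m n) N
    normal     : Normal (Δ l m n) N
    order-x    : HasOrderModulo N x l
    order-y    : HasOrderModulo N y m
    order-z    : HasOrderModulo N z n

module _ {l m n : ℕ} where
  open OrientablyRegularHypermap

  infix 4 _Covers_ _≅_

  Finite : OrientablyRegularHypermap l m n → Set
  Finite H = FiniteIndex (Δ l m n) (N H)

  _Covers_ : (K H : OrientablyRegularHypermap l m n) → Set
  K Covers H = N K ⊆ N H

  Chiral : OrientablyRegularHypermap l m n → Set
  Chiral H = ¬ Normal (Δ* l m n) (image l m n (N H))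

  -- Isomorphism of oriented hypermaps: the correspondence with normal
  -- subgroups of Δ is a bijection on isomorphism classes.
  _≅_ : (H K : OrientablyRegularHypermap l m n) → Set
  H ≅ K = N H ≐ N K

-- The reflection r₀ acts on Δ by an automorphism, mirror, and a normal subgroup
-- K of Δ is chiral as soon as mirror K ≠ K. Replace N by N ∩ mirror N. If the
-- type is hyperbolic, negativity of the Euler characteristic says that certain
-- linear systems modulo q, whose solutions are cocycles of Δ with values in
-- functions on Δ/N, have more unknowns than equations; by the pigeonhole
-- principle they have nonzero solutions. This is used twice.
--
-- First, every odd element of Δ* acts nontrivially on Hom(N, ℤ/p): some power of
-- it has order two modulo N, and the count for antisymmetric cocycles gives a
-- homomorphism that this power negates. For a large prime p a combination of
-- such homomorphisms is a χ : N → ℤ/p fixed by no odd element.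
--
-- Second, the count for cocycles twisted by the character 2^χ modulo 2ᵖ - 1 gives
-- a crossed homomorphism f on N that is not inner. On commutators it is additive,
-- and an eigenvector of N with character 2^χ. Let K be the kernel of the affine
-- action of Δ induced from (χ, f). If mirror K = K, then f ∘ mirror would be a
-- combination of eigenvectors whose characters are the conjugates of 2^χ under
-- Δ, but its own character is none of these.
--
-- If the type is Euclidean, the rotation character of Δ itself, which mirror
-- inverts, takes the place of χ. In both cases K is properly contained in N, so
-- iteration yields infinitely many covers.
module Submission where

module PresentedGroups where

  open import Algebra.Bundles using (Group)
  open import Data.Bool.Base using (Bool; true; false)
  open import Data.Fin.Base using (Fin)
  open import Data.Fin.Properties using (_≟_)
  open import Data.List.Base using (List; []; _∷_)
  open import Data.List.Membership.Propositional using (_∈_)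
  open import Data.Nat.Base using (ℕ; zero; suc; _+_)
  open import Data.Product.Base using (_×_; _,_)
  open import Level using (Level)
  open import Relation.Binary.PropositionalEquality as ≡ using (_≡_)
  open import Relation.Nullary using (yes; no)
  import Algebra.Properties.Group as GroupProperties
  import Relation.Binary.Reasoning.Setoid as SetoidReasoning

  open import Defs

  module _ {A : Set} {c ℓ : Level} (G : Group c ℓ) (f : A → Group.Carrier G) where
    private module G = Group G

    eval : Word A → G.Carrier
    eval (gen a) = f a
    eval ε       = G.ε
    eval (u ∙ v) = eval u G.∙ eval v
    eval (u ⁻¹)  = eval u G.⁻¹

    eval-resp : ∀ {relators} → (∀ {r} → r ∈ relators → eval r G.≈ G.ε) →
                ∀ {u v} → Equal relators u v → eval u G.≈ eval v
    eval-resp kill refl          = G.refl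
    eval-resp kill (sym e)       = G.sym (eval-resp kill e)
    eval-resp kill (trans e f)   = G.trans (eval-resp kill e) (eval-resp kill f)
    eval-resp kill (∙-cong e f)  = G.∙-cong (eval-resp kill e) (eval-resp kill f)
    eval-resp kill (⁻¹-cong e)   = G.⁻¹-cong (eval-resp kill e)
    eval-resp kill (assoc u v w) = G.assoc (eval u) (eval v) (eval w)
    eval-resp kill (identityˡ u) = G.identityˡ (eval u)
    eval-resp kill (identityʳ u) = G.identityʳ (eval u)
    eval-resp kill (inverseˡ u)  = G.inverseˡ (eval u)
    eval-resp kill (inverseʳ u)  = G.inverseʳ (eval u)
    eval-resp kill (relator r∈)  = kill r∈

  Equal-mono : ∀ {A : Set} {R S : List (Word A)} → (∀ {r} → r ∈ R → Equal S r ε) →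
               ∀ {u v} → Equal R u v → Equal S u v
  Equal-mono kill refl          = refl
  Equal-mono kill (sym e)       = sym (Equal-mono kill e)
  Equal-mono kill (trans e f)   = trans (Equal-mono kill e) (Equal-mono kill f)
  Equal-mono kill (∙-cong e f)  = ∙-cong (Equal-mono kill e) (Equal-mono kill f)
  Equal-mono kill (⁻¹-cong e)   = ⁻¹-cong (Equal-mono kill e)
  Equal-mono kill (assoc u v w) = assoc u v w
  Equal-mono kill (identityˡ u) = identityˡ u
  Equal-mono kill (identityʳ u) = identityʳ u
  Equal-mono kill (inverseˡ u)  = inverseˡ u
  Equal-mono kill (inverseʳ u)  = inverseʳ u
  Equal-mono kill (relator r∈)  = kill r∈

  substitute-resp : ∀ {A B : Set} {R : List (Word A)} {S : List (Word B)} (f : A → Word B) →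
                    (∀ {r} → r ∈ R → Equal S (substitute f r) ε) →
                    ∀ {u v} → Equal R u v → Equal S (substitute f u) (substitute f v)
  substitute-resp f kill refl          = refl
  substitute-resp f kill (sym e)       = sym (substitute-resp f kill e)
  substitute-resp f kill (trans e g)   = trans (substitute-resp f kill e) (substitute-resp f kill g)
  substitute-resp f kill (∙-cong e g)  = ∙-cong (substitute-resp f kill e) (substitute-resp f kill g)
  substitute-resp f kill (⁻¹-cong e)   = ⁻¹-cong (substitute-resp f kill e)
  substitute-resp f kill (assoc u v w) = assoc _ _ _
  substitute-resp f kill (identityˡ u) = identityˡ _
  substitute-resp f kill (identityʳ u) = identityʳ _
  substitute-resp f kill (inverseˡ u)  = inverseˡ _
  substitute-resp f kill (inverseʳ u)  = inverseʳ _
  substitute-resp f kill (relator r∈)  = kill r∈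

  substitute-^ : ∀ {A B : Set} (f : A → Word B) w k → substitute f (w ^ k) ≡ substitute f w ^ k
  substitute-^ f w zero    = ≡.refl
  substitute-^ f w (suc k) = ≡.cong (substitute f w ∙_) (substitute-^ f w k)

  module FreeReduction where

    Letters : ℕ → Set
    Letters n = List (Bool × Fin n)

    push : ∀ {n} → Bool → Fin n → Letters n → Letters n
    push s i [] = (s , i) ∷ []
    push s i ((t , j) ∷ l) with i ≟ j
    push true  i ((false , j) ∷ l) | yes _ = l
    push false i ((true  , j) ∷ l) | yes _ = l
    push s     i ((t     , j) ∷ l) | _     = (s , i) ∷ (t , j) ∷ l

    mutual
      reduce : ∀ {n} → Word (Fin n) → Letters n → Letters n
      reduce (gen i) l = push true i l
      reduce ε       l = l
      reduce (u ∙ v) l = reduce u (reduce v l)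
      reduce (u ⁻¹)  l = reduce⁻¹ u l

      reduce⁻¹ : ∀ {n} → Word (Fin n) → Letters n → Letters n
      reduce⁻¹ (gen i) l = push false i l
      reduce⁻¹ ε       l = l
      reduce⁻¹ (u ∙ v) l = reduce⁻¹ v (reduce⁻¹ u l)
      reduce⁻¹ (u ⁻¹)  l = reduce u l

    module _ {A : Set} {R : List (Word A)} {n : ℕ} (env : Fin n → Word A) where
      private
        module G = Group ⟨ A ∣ R ⟩
        open GroupProperties ⟨ A ∣ R ⟩ using (⁻¹-anti-homo-∙; ⁻¹-involutive; ε⁻¹≈ε)
        open SetoidReasoning G.setoid

      letter : Bool → Fin n → Word A
      letter true  i = env i
      letter false i = env i ⁻¹

      ⟦_⟧ : Letters n → Word A
      ⟦ [] ⟧          = ε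
      ⟦ (s , i) ∷ l ⟧ = letter s i ∙ ⟦ l ⟧

      push-sound : ∀ s i l → ⟦ push s i l ⟧ G.≈ letter s i ∙ ⟦ l ⟧
      push-sound s i [] = refl
      push-sound s i ((t , j) ∷ l) with i ≟ j
      push-sound true  i ((false , j) ∷ l) | yes ≡.refl = begin
        ⟦ l ⟧                       ≈⟨ identityˡ _ ⟨
        ε ∙ ⟦ l ⟧                   ≈⟨ ∙-cong (inverseʳ (env i)) refl ⟨
        env i ∙ env i ⁻¹ ∙ ⟦ l ⟧    ≈⟨ assoc _ _ _ ⟩
        env i ∙ (env i ⁻¹ ∙ ⟦ l ⟧)  ∎
      push-sound false i ((true  , j) ∷ l) | yes ≡.refl = begin
        ⟦ l ⟧                       ≈⟨ identityˡ _ ⟨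
        ε ∙ ⟦ l ⟧                   ≈⟨ ∙-cong (inverseˡ (env i)) refl ⟨
        env i ⁻¹ ∙ env i ∙ ⟦ l ⟧    ≈⟨ assoc _ _ _ ⟩
        env i ⁻¹ ∙ (env i ∙ ⟦ l ⟧)  ∎
      push-sound true  i ((true  , j) ∷ l) | yes _ = refl
      push-sound false i ((false , j) ∷ l) | yes _ = refl
      push-sound true  i ((t     , j) ∷ l) | no _  = refl
      push-sound false i ((t     , j) ∷ l) | no _  = refl

      mutual
        reduce-sound : ∀ u l → ⟦ reduce u l ⟧ G.≈ substitute env u ∙ ⟦ l ⟧
        reduce-sound (gen i) l = push-sound true i l
        reduce-sound ε       l = sym (identityˡ _)
        reduce-sound (u ∙ v) l = begin
          ⟦ reduce u (reduce v l) ⟧                       ≈⟨ reduce-sound u _ ⟩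
          substitute env u ∙ ⟦ reduce v l ⟧               ≈⟨ ∙-cong refl (reduce-sound v l) ⟩
          substitute env u ∙ (substitute env v ∙ ⟦ l ⟧)   ≈⟨ assoc _ _ _ ⟨
          substitute env u ∙ substitute env v ∙ ⟦ l ⟧     ∎
        reduce-sound (u ⁻¹)  l = reduce⁻¹-sound u l

        reduce⁻¹-sound : ∀ u l → ⟦ reduce⁻¹ u l ⟧ G.≈ substitute env u ⁻¹ ∙ ⟦ l ⟧
        reduce⁻¹-sound (gen i) l = push-sound false i l
        reduce⁻¹-sound ε       l = sym (trans (∙-cong ε⁻¹≈ε refl) (identityˡ _))
        reduce⁻¹-sound (u ∙ v) l = begin
          ⟦ reduce⁻¹ v (reduce⁻¹ u l) ⟧                         ≈⟨ reduce⁻¹-sound v _ ⟩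
          substitute env v ⁻¹ ∙ ⟦ reduce⁻¹ u l ⟧                ≈⟨ ∙-cong refl (reduce⁻¹-sound u l) ⟩
          substitute env v ⁻¹ ∙ (substitute env u ⁻¹ ∙ ⟦ l ⟧)   ≈⟨ assoc _ _ _ ⟨
          substitute env v ⁻¹ ∙ substitute env u ⁻¹ ∙ ⟦ l ⟧     ≈⟨ ∙-cong (⁻¹-anti-homo-∙ _ _) refl ⟨
          (substitute env u ∙ substitute env v) ⁻¹ ∙ ⟦ l ⟧      ∎
        reduce⁻¹-sound (u ⁻¹)  l =
          trans (reduce-sound u l) (∙-cong (sym (⁻¹-involutive _)) refl)

      solve : ∀ u v → reduce u [] ≡ reduce v [] → Equal R (substitute env u) (substitute env v)
      solve u v eq = begin
        substitute env u      ≈⟨ identityʳ _ ⟨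
        substitute env u ∙ ε  ≈⟨ reduce-sound u [] ⟨
        ⟦ reduce u [] ⟧       ≡⟨ ≡.cong ⟦_⟧ eq ⟩
        ⟦ reduce v [] ⟧       ≈⟨ reduce-sound v [] ⟩
        substitute env v ∙ ε  ≈⟨ identityʳ _ ⟩
        substitute env v      ∎

  open FreeReduction public using (solve)

  module _ {A : Set} {R : List (Word A)} where

    ^-cong : ∀ {u v : Word A} k → Equal R u v → Equal R (u ^ k) (v ^ k)
    ^-cong zero    e = refl
    ^-cong (suc k) e = ∙-cong e (^-cong k e)

    ^-+ : ∀ (w : Word A) i j → Equal R (w ^ (i + j)) (w ^ i ∙ w ^ j)
    ^-+ w zero    j = sym (identityˡ _)
    ^-+ w (suc i) j = trans (∙-cong refl (^-+ w i j)) (sym (assoc _ _ _))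

    ^-comm : ∀ (w : Word A) i j → Equal R (w ^ i ∙ w ^ j) (w ^ j ∙ w ^ i)
    ^-comm w i j = trans (sym (^-+ w i j)) (trans (≡⇒≈ (≡.cong (w ^_) (+-comm i j))) (^-+ w j i))
      where
      open import Data.Nat.Properties using (+-comm)
      ≡⇒≈ : ∀ {u v} → u ≡ v → Equal R u v
      ≡⇒≈ ≡.refl = refl

    ^-sucʳ : ∀ (w : Word A) k → Equal R (w ^ suc k) (w ^ k ∙ w)
    ^-sucʳ w zero    = trans (identityʳ w) (sym (identityˡ w))
    ^-sucʳ w (suc k) = trans (∙-cong refl (^-sucʳ w k)) (sym (assoc _ _ _))

    ^-⁻¹ : ∀ (w : Word A) k → Equal R ((w ⁻¹) ^ k) ((w ^ k) ⁻¹)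
    ^-⁻¹ w zero    = sym (GroupProperties.ε⁻¹≈ε ⟨ A ∣ R ⟩)
    ^-⁻¹ w (suc k) = trans (^-sucʳ (w ⁻¹) k)
      (trans (∙-cong (^-⁻¹ w k) refl) (sym (GroupProperties.⁻¹-anti-homo-∙ ⟨ A ∣ R ⟩ _ _)))

module TriangleGroups where

  open import Algebra.Bundles using (Group)
  open import Data.Bool.Base using (Bool; true; false; _xor_)
  open import Data.Fin.Base using (Fin; zero; suc)
  open import Data.Fin.Patterns using (0F; 1F; 2F)
  open import Data.List.Base using (List; []; _∷_)
  open import Data.List.Membership.Propositional using (_∈_)
  open import Data.List.Relation.Unary.Any using (here; there)
  open import Data.Nat.Base using (ℕ; zero; suc)
  open import Data.Product.Base using (_×_; _,_; proj₁)
  open import Data.Vec.Base using (lookup; []; _∷_)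
  open import Level using (0ℓ)
  open import Relation.Binary.PropositionalEquality as ≡ using (_≡_)
  open import Relation.Nullary using (¬_)
  import Relation.Binary.Reasoning.Setoid as SetoidReasoning

  open import Defs
  open PresentedGroups

  -- Conjugation by r₀ maps y and z to their inverses, and x = r₁ r₂ to
  -- r₀ r₁ r₂ r₀ = y⁻¹ x⁻¹ y.
  twist : Rotation → Word Rotation
  twist ξ = y
  twist η = ε
  twist ζ = ε

  mirror : Word Rotation → Word Rotation
  mirror = substitute λ a → twist a ⁻¹ ∙ gen a ⁻¹ ∙ twist a

  mirror-involutive : ∀ {R} w → Equal R (mirror (mirror w)) w
  mirror-involutive (gen ξ) =
    solve (lookup (x ∷ y ∷ []))
      (Y ⁻¹ ∙ (gen 1F ⁻¹ ∙ gen 0F ⁻¹ ∙ gen 1F) ⁻¹ ∙ Y) (gen 0F) ≡.refl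
    where
    Y : Word (Fin 2)
    Y = ε ⁻¹ ∙ gen 1F ⁻¹ ∙ ε
  mirror-involutive (gen η) =
    solve (lookup (y ∷ [])) (ε ⁻¹ ∙ (ε ⁻¹ ∙ gen 0F ⁻¹ ∙ ε) ⁻¹ ∙ ε) (gen 0F) ≡.refl
  mirror-involutive (gen ζ) =
    solve (lookup (z ∷ [])) (ε ⁻¹ ∙ (ε ⁻¹ ∙ gen 0F ⁻¹ ∙ ε) ⁻¹ ∙ ε) (gen 0F) ≡.refl
  mirror-involutive ε       = refl
  mirror-involutive (u ∙ v) = ∙-cong (mirror-involutive u) (mirror-involutive v)
  mirror-involutive (u ⁻¹)  = ⁻¹-cong (mirror-involutive u)

  conj-^ : ∀ {A : Set} {R : List (Word A)} (h w : Word A) k →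
           Equal R ((h ⁻¹ ∙ w ∙ h) ^ k) (h ⁻¹ ∙ w ^ k ∙ h)
  conj-^ h w zero    = solve (lookup (h ∷ [])) ε (gen 0F ⁻¹ ∙ ε ∙ gen 0F) ≡.refl
  conj-^ h w (suc k) = trans (∙-cong refl (conj-^ h w k))
    (solve (lookup (h ∷ w ∷ w ^ k ∷ []))
      (H ⁻¹ ∙ gen 1F ∙ H ∙ (H ⁻¹ ∙ gen 2F ∙ H)) (H ⁻¹ ∙ (gen 1F ∙ gen 2F) ∙ H) ≡.refl)
    where
    H : Word (Fin 3)
    H = gen 0F

  mirror-^ : ∀ {R} a k → Equal R (mirror (gen a ^ k)) (twist a ⁻¹ ∙ (gen a ^ k) ⁻¹ ∙ twist a)
  mirror-^ a k rewrite substitute-^ (λ b → twist b ⁻¹ ∙ gen b ⁻¹ ∙ twist b) (gen a) k =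
    trans (conj-^ (twist a) (gen a ⁻¹) k) (∙-cong (∙-cong refl (^-⁻¹ (gen a) k)) refl)

  module _ (l m n : ℕ) where

    relators : List (Word Rotation)
    relators = x ^ l ∷ y ^ m ∷ z ^ n ∷ x ∙ y ∙ z ∷ []

    order : Rotation → ℕ
    order ξ = l
    order η = m
    order ζ = n

    power-relator : ∀ a → Equal relators (gen a ^ order a) ε
    power-relator ξ = relator (here ≡.refl)
    power-relator η = relator (there (here ≡.refl))
    power-relator ζ = relator (there (there (here ≡.refl)))

    xyz∈relators : x ∙ y ∙ z ∈ relators
    xyz∈relators = there (there (there (here ≡.refl)))

    data Relator : Word Rotation → Set where
      power   : ∀ a → Relator (gen a ^ order a)
      product : Relator (x ∙ y ∙ z)

    relators-view : ∀ {r} → r ∈ relators → Relator r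
    relators-view (here ≡.refl)                         = power ξ
    relators-view (there (here ≡.refl))                 = power η
    relators-view (there (there (here ≡.refl)))         = power ζ
    relators-view (there (there (there (here ≡.refl)))) = product

  mirror-product : ∀ {R} → Equal R (x ∙ y ∙ z) ε → Equal R (mirror (x ∙ y ∙ z)) ε
  mirror-product {R} xyz≈ε = begin
    mirror (x ∙ y ∙ z)
      ≈⟨ solve (lookup (x ∷ y ∷ z ∷ []))
           (Y ⁻¹ ∙ X ⁻¹ ∙ Y ∙ (ε ⁻¹ ∙ Y ⁻¹ ∙ ε) ∙ (ε ⁻¹ ∙ Z ⁻¹ ∙ ε))
           ((Z ∙ (X ∙ Y ∙ Z) ∙ Z ⁻¹) ⁻¹) ≡.refl ⟩
    (z ∙ (x ∙ y ∙ z) ∙ z ⁻¹) ⁻¹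
      ≈⟨ ⁻¹-cong (∙-cong (∙-cong refl xyz≈ε) refl) ⟩
    (z ∙ ε ∙ z ⁻¹) ⁻¹
      ≈⟨ solve (lookup (z ∷ [])) ((gen 0F ∙ ε ∙ gen 0F ⁻¹) ⁻¹) ε ≡.refl ⟩
    ε ∎
    where
    open SetoidReasoning (Group.setoid ⟨ Rotation ∣ R ⟩)
    X Y Z : Word (Fin 3)
    X = gen 0F
    Y = gen 1F
    Z = gen 2F

  module _ {l m n : ℕ} where

    private
      infix 4 _≈_
      _≈_ : Word Rotation → Word Rotation → Set
      _≈_ = Equal (relators l m n)

    mirror-resp : ∀ {u v} → u ≈ v → mirror u ≈ mirror v
    mirror-resp = substitute-resp _ λ r∈ → kill (relators-view l m n r∈)
      where
      kill : ∀ {r} → Relator l m n r → mirror r ≈ ε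
      kill (power a) =
        trans (mirror-^ a (order l m n a))
        (trans (∙-cong (∙-cong refl (⁻¹-cong (power-relator l m n a))) refl)
        (solve (lookup (twist a ∷ [])) (gen 0F ⁻¹ ∙ ε ⁻¹ ∙ gen 0F) ε ≡.refl))
      kill product = mirror-product (relator (xyz∈relators l m n))

    x≈z⁻¹y⁻¹ : x ≈ z ⁻¹ ∙ y ⁻¹
    x≈z⁻¹y⁻¹ = trans
      (solve (lookup (x ∷ y ∷ z ∷ []))
        (gen 0F) (gen 0F ∙ gen 1F ∙ gen 2F ∙ (gen 2F ⁻¹ ∙ gen 1F ⁻¹)) ≡.refl)
      (trans (∙-cong (relator (xyz∈relators l m n)) refl) (identityˡ _))

    mirrorIf : Bool → Word Rotation → Word Rotation
    mirrorIf true  = mirror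
    mirrorIf false w = w

    mirrorIf-resp : ∀ b {u v} → u ≈ v → mirrorIf b u ≈ mirrorIf b v
    mirrorIf-resp true  = mirror-resp
    mirrorIf-resp false e = e

    mirrorIf-∙ : ∀ b u v → mirrorIf b (u ∙ v) ≡ mirrorIf b u ∙ mirrorIf b v
    mirrorIf-∙ true  u v = ≡.refl
    mirrorIf-∙ false u v = ≡.refl

    mirrorIf-xor : ∀ b c w → mirrorIf b (mirrorIf c w) ≈ mirrorIf (b xor c) w
    mirrorIf-xor true  true  w = mirror-involutive w
    mirrorIf-xor true  false w = refl
    mirrorIf-xor false c     w = refl

    mirrorIf-ε : ∀ b → mirrorIf b ε ≡ ε
    mirrorIf-ε true  = ≡.refl
    mirrorIf-ε false = ≡.refl

    mirrorIf-⁻¹ : ∀ b w → mirrorIf b (w ⁻¹) ≡ mirrorIf b w ⁻¹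
    mirrorIf-⁻¹ true  w = ≡.refl
    mirrorIf-⁻¹ false w = ≡.refl

    mirrorIf-involutive : ∀ b {R} w → Equal R (mirrorIf b (mirrorIf b w)) w
    mirrorIf-involutive true  w = mirror-involutive w
    mirrorIf-involutive false w = refl

    mirrorIf-product : ∀ b {R} → Equal R (x ∙ y ∙ z) ε → Equal R (mirrorIf b (x ∙ y ∙ z)) ε
    mirrorIf-product true  = mirror-product
    mirrorIf-product false e = e

    -- Isomorphic to Δ*, with r₀ acting on Δ through mirror.
    semidirect : Group 0ℓ 0ℓ
    semidirect = record
      { Carrier = Word Rotation × Bool
      ; _≈_ = λ (u , b) (v , c) → u ≈ v × b ≡ c
      ; _∙_ = λ (u , b) (v , c) → u ∙ mirrorIf b v , b xor c
      ; ε   = ε , false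
      ; _⁻¹ = λ (u , b) → mirrorIf b (u ⁻¹) , b
      ; isGroup = record
        { isMonoid = record
          { isSemigroup = record
            { isMagma = record
              { isEquivalence = record
                { refl  = refl , ≡.refl
                ; sym   = λ (p , q) → sym p , ≡.sym q
                ; trans = λ (p , q) (p′ , q′) → trans p p′ , ≡.trans q q′
                }
              ; ∙-cong = λ { {_ , b} (p , ≡.refl) (q , ≡.refl) → ∙-cong p (mirrorIf-resp b q) , ≡.refl }
              }
            ; assoc = assoc′
            }
          ; identity = (λ _ → identityˡ _ , ≡.refl)
                     , λ { (u , true) → identityʳ u , ≡.refl ; (u , false) → identityʳ u , ≡.refl }
          }
        ; inverse = (λ { (u , true)  → inverseˡ (mirror u) , ≡.refl ; (u , false) → inverseˡ u , ≡.refl })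
                  , (λ { (u , true)  → trans (∙-cong refl (mirror-involutive (u ⁻¹))) (inverseʳ u) , ≡.refl
                       ; (u , false) → inverseʳ u , ≡.refl })
        ; ⁻¹-cong = λ { {_ , b} (p , ≡.refl) → mirrorIf-resp b (⁻¹-cong p) , ≡.refl }
        }
      }
      where
      assoc′ : ∀ ((u , b) (v , c) (w , d) : Word Rotation × Bool) →
               (u ∙ mirrorIf b v ∙ mirrorIf (b xor c) w ≈ u ∙ mirrorIf b (v ∙ mirrorIf c w)) ×
               ((b xor c) xor d ≡ b xor (c xor d))
      assoc′ (u , b) (v , c) (w , d) rewrite mirrorIf-∙ b v (mirrorIf c w) =
        trans (assoc _ _ _) (∙-cong refl (∙-cong refl (sym (mirrorIf-xor b c w)))) , xor-assoc b c d
        where open import Data.Bool.Properties using (xor-assoc)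

    private
      module S = Group semidirect

      reflect : Reflection → Word Rotation × Bool
      reflect ρ₀ = ε , true
      reflect ρ₁ = z ⁻¹ , true
      reflect ρ₂ = y , true

      rotations : Word Reflection → Word Rotation × Bool
      rotations = eval semidirect reflect

      eval-power : ∀ {w u} k → rotations w S.≈ (u , false) → rotations (w ^ k) S.≈ (u ^ k , false)
      eval-power zero    e = S.refl
      eval-power (suc k) e = S.∙-cong e (eval-power k e)

      rotations-x : rotations (r₁ ∙ r₂) S.≈ (x , false)
      rotations-x = trans (solve (lookup (y ∷ z ∷ [])) (gen 1F ⁻¹ ∙ (ε ⁻¹ ∙ gen 0F ⁻¹ ∙ ε))
                            (gen 1F ⁻¹ ∙ gen 0F ⁻¹) ≡.refl) (sym x≈z⁻¹y⁻¹) , ≡.refl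

      rotations-y : rotations (r₂ ∙ r₀) S.≈ (y , false)
      rotations-y = identityʳ y , ≡.refl

      rotations-z : rotations (r₀ ∙ r₁) S.≈ (z , false)
      rotations-z = solve (lookup (z ∷ [])) (ε ∙ (ε ⁻¹ ∙ gen 0F ⁻¹ ∙ ε) ⁻¹) (gen 0F) ≡.refl , ≡.refl

      rotations-embed : ∀ w → rotations (embed w) S.≈ (w , false)
      rotations-embed (gen ξ) = rotations-x
      rotations-embed (gen η) = rotations-y
      rotations-embed (gen ζ) = rotations-z
      rotations-embed ε       = S.refl
      rotations-embed (u ∙ v) = S.∙-cong (rotations-embed u) (rotations-embed v)
      rotations-embed (u ⁻¹)  = S.⁻¹-cong (rotations-embed u)

      infix 4 _≈*_
      _≈*_ : Word Reflection → Word Reflection → Set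
      _≈*_ = Group._≈_ (Δ* l m n)

      rotations-resp : ∀ {u v} → u ≈* v → rotations u S.≈ rotations v
      rotations-resp = eval-resp semidirect reflect kill
        where
        rotation-relator : ∀ {w} a → rotations w S.≈ (gen a , false) →
                           rotations (w ^ order l m n a) S.≈ S.ε
        rotation-relator a e =
          S.trans (eval-power (order l m n a) e) (power-relator l m n a , ≡.refl)

        kill : ∀ {r} → r ∈ _ → rotations r S.≈ S.ε
        kill (here ≡.refl) = solve (lookup []) (ε ∙ (ε ∙ ε)) ε ≡.refl , ≡.refl
        kill (there (here ≡.refl)) =
          solve (lookup (z ∷ [])) (gen 0F ⁻¹ ∙ ((ε ⁻¹ ∙ gen 0F ⁻¹ ∙ ε) ⁻¹ ∙ ε)) ε ≡.refl , ≡.refl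
        kill (there (there (here ≡.refl))) =
          solve (lookup (y ∷ [])) (gen 0F ∙ ((ε ⁻¹ ∙ gen 0F ⁻¹ ∙ ε) ∙ ε)) ε ≡.refl , ≡.refl
        kill (there (there (there (here ≡.refl))))                 = rotation-relator ξ rotations-x
        kill (there (there (there (there (here ≡.refl)))))         = rotation-relator η rotations-y
        kill (there (there (there (there (there (here ≡.refl)))))) = rotation-relator ζ rotations-z

    embed-injective : ∀ {u v} → embed u ≈* embed v → u ≈ v
    embed-injective {u} {v} e = proj₁
      (S.trans (S.sym (rotations-embed u)) (S.trans (rotations-resp e) (rotations-embed v)))

    private
      involution : ∀ {A : Set} {R : List (Word A)} (w : Word A) → Equal R (w ^ 2) ε → Equal R w (w ⁻¹)
      involution w w²≈ε = trans
        (solve (lookup (w ∷ [])) (gen 0F) (gen 0F ∙ (gen 0F ∙ ε) ∙ gen 0F ⁻¹) ≡.refl)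
        (trans (∙-cong w²≈ε refl) (identityˡ _))

      r₀≈r₀⁻¹ : r₀ ≈* r₀ ⁻¹
      r₀≈r₀⁻¹ = involution r₀ (relator (here ≡.refl))

      r₁≈r₁⁻¹ : r₁ ≈* r₁ ⁻¹
      r₁≈r₁⁻¹ = involution r₁ (relator (there (here ≡.refl)))

      r₂≈r₂⁻¹ : r₂ ≈* r₂ ⁻¹
      r₂≈r₂⁻¹ = involution r₂ (relator (there (there (here ≡.refl))))

    embed-mirror : ∀ w → embed (mirror w) ≈* r₀ ∙ embed w ∙ r₀ ⁻¹
    embed-mirror (gen ξ) =
      trans (solve (lookup (r₀ ∷ r₁ ∷ r₂ ∷ []))
              ((gen 2F ∙ gen 0F) ⁻¹ ∙ (gen 1F ∙ gen 2F) ⁻¹ ∙ (gen 2F ∙ gen 0F))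
              (gen 0F ⁻¹ ∙ gen 2F ⁻¹ ∙ gen 2F ⁻¹ ∙ gen 1F ⁻¹ ∙ gen 2F ∙ gen 0F) ≡.refl)
      (trans (∙-cong (∙-cong (∙-cong (∙-cong (∙-cong (sym r₀≈r₀⁻¹) (sym r₂≈r₂⁻¹)) refl) (sym r₁≈r₁⁻¹)) refl) r₀≈r₀⁻¹)
             (solve (lookup (r₀ ∷ r₁ ∷ r₂ ∷ []))
               (gen 0F ∙ gen 2F ∙ gen 2F ⁻¹ ∙ gen 1F ∙ gen 2F ∙ gen 0F ⁻¹)
               (gen 0F ∙ (gen 1F ∙ gen 2F) ∙ gen 0F ⁻¹) ≡.refl))
    embed-mirror (gen η) =
      trans (solve (lookup (r₀ ∷ r₂ ∷ [])) (ε ⁻¹ ∙ (gen 1F ∙ gen 0F) ⁻¹ ∙ ε) (gen 0F ⁻¹ ∙ gen 1F ⁻¹) ≡.refl)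
      (trans (∙-cong (sym r₀≈r₀⁻¹) (sym r₂≈r₂⁻¹))
             (solve (lookup (r₀ ∷ r₂ ∷ [])) (gen 0F ∙ gen 1F) (gen 0F ∙ (gen 1F ∙ gen 0F) ∙ gen 0F ⁻¹) ≡.refl))
    embed-mirror (gen ζ) =
      trans (solve (lookup (r₀ ∷ r₁ ∷ [])) (ε ⁻¹ ∙ (gen 0F ∙ gen 1F) ⁻¹ ∙ ε)
              (gen 0F ⁻¹ ∙ gen 0F ∙ gen 1F ⁻¹ ∙ gen 0F ⁻¹) ≡.refl)
      (trans (∙-cong (∙-cong (∙-cong (sym r₀≈r₀⁻¹) refl) (sym r₁≈r₁⁻¹)) refl)
             (solve (lookup (r₀ ∷ r₁ ∷ []))
               (gen 0F ∙ gen 0F ∙ gen 1F ∙ gen 0F ⁻¹) (gen 0F ∙ (gen 0F ∙ gen 1F) ∙ gen 0F ⁻¹) ≡.refl))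
    embed-mirror ε = solve (lookup (r₀ ∷ [])) ε (gen 0F ∙ ε ∙ gen 0F ⁻¹) ≡.refl
    embed-mirror (u ∙ v) = trans (∙-cong (embed-mirror u) (embed-mirror v))
      (solve (lookup (r₀ ∷ embed u ∷ embed v ∷ []))
        (gen 0F ∙ gen 1F ∙ gen 0F ⁻¹ ∙ (gen 0F ∙ gen 2F ∙ gen 0F ⁻¹))
        (gen 0F ∙ (gen 1F ∙ gen 2F) ∙ gen 0F ⁻¹) ≡.refl)
    embed-mirror (u ⁻¹) = trans (⁻¹-cong (embed-mirror u))
      (solve (lookup (r₀ ∷ embed u ∷ []))
        ((gen 0F ∙ gen 1F ∙ gen 0F ⁻¹) ⁻¹) (gen 0F ∙ gen 1F ⁻¹ ∙ gen 0F ⁻¹) ≡.refl)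

    module _ (H : OrientablyRegularHypermap l m n) where
      open OrientablyRegularHypermap H
      open IsSubgroup isSubgroup

      mirror-witness⇒Chiral : ∀ v → N v → ¬ N (mirror v) → Chiral H
      mirror-witness⇒Chiral v v∈N mv∉N normal*
        with v′ , v′∈N , e ← normal* r₀ (v , v∈N , refl) =
        mv∉N (resp-≈ (embed-injective (trans e (sym (embed-mirror v)))) v′∈N)

module FiniteQuotients where

  open import Data.Empty using (⊥-elim)
  open import Data.Fin.Base using (Fin; zero; suc; combine)
  open import Data.Fin.Patterns using (0F; 1F; 2F; 3F; 4F; 5F)
  open import Data.Fin.Properties using (_≟_; any?; injective⇒≤; combine-injective)
  open import Data.Nat.Base using (ℕ; zero; suc; _+_; _<_; _*_)
  open import Data.Nat.Properties using (<⇒≱; +-suc; m≤m+n)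
  open import Data.Product.Base using (∃; _×_; _,_; proj₁; proj₂)
  open import Data.Vec.Base using (lookup; []; _∷_)
  open import Function.Bundles using (_⇔_; mk⇔; Equivalence)
  open import Function.Definitions using (Injective)
  open import Level using (0ℓ)
  open import Relation.Binary.PropositionalEquality as ≡ using (_≡_; cong; cong₂; subst)
  open import Relation.Nullary using (¬_; yes; no; ¬?)
  open import Relation.Unary using (Pred; _⊆_)

  open import Defs
  open PresentedGroups
  open TriangleGroups

  module _ (l m n : ℕ) where

    private
      infix 4 _≈_
      _≈_ : Word Rotation → Word Rotation → Set
      _≈_ = Equal (relators l m n)

    -- A homomorphism from Δ to a finite group, recorded only through a labelling
    -- of its values; labels outside the image are allowed.
    record FiniteQuotient : Set where
      field
        size   : ℕ
        coset  : Word Rotation → Fin size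
        resp   : ∀ {u v} → u ≈ v → coset u ≡ coset v
        ∙-resp : ∀ {u u′ v v′} → coset u ≡ coset u′ → coset v ≡ coset v′ →
                 coset (u ∙ v) ≡ coset (u′ ∙ v′)

      Ker : Pred (Word Rotation) 0ℓ
      Ker w = coset w ≡ coset ε

      ∙-cancelˡ : ∀ w {u v} → coset (w ∙ u) ≡ coset (w ∙ v) → coset u ≡ coset v
      ∙-cancelˡ w {u} {v} e = begin
        coset u                  ≡⟨ resp (cancel u) ⟨
        coset (w ⁻¹ ∙ (w ∙ u))   ≡⟨ ∙-resp ≡.refl e ⟩
        coset (w ⁻¹ ∙ (w ∙ v))   ≡⟨ resp (cancel v) ⟩
        coset v                  ∎
        where
        open ≡.≡-Reasoning
        cancel : ∀ u → w ⁻¹ ∙ (w ∙ u) ≈ u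
        cancel u = solve (lookup (w ∷ u ∷ [])) (gen 0F ⁻¹ ∙ (gen 0F ∙ gen 1F)) (gen 1F) ≡.refl

      ∙-cancelʳ : ∀ w {u v} → coset (u ∙ w) ≡ coset (v ∙ w) → coset u ≡ coset v
      ∙-cancelʳ w {u} {v} e = begin
        coset u                  ≡⟨ resp (cancel u) ⟨
        coset (u ∙ w ∙ w ⁻¹)     ≡⟨ ∙-resp e ≡.refl ⟩
        coset (v ∙ w ∙ w ⁻¹)     ≡⟨ resp (cancel v) ⟩
        coset v                  ∎
        where
        open ≡.≡-Reasoning
        cancel : ∀ u → u ∙ w ∙ w ⁻¹ ≈ u
        cancel u = solve (lookup (w ∷ u ∷ [])) (gen 1F ∙ gen 0F ∙ gen 0F ⁻¹) (gen 1F) ≡.refl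

      Ker⇔ : ∀ u v → coset u ≡ coset v ⇔ Ker (u ⁻¹ ∙ v)
      Ker⇔ u v = mk⇔
        (λ e → ≡.trans (∙-resp ≡.refl (≡.sym e)) (resp (inverseˡ u)))
        (λ e → ∙-cancelˡ (u ⁻¹) (≡.trans (resp (inverseˡ u)) (≡.sym e)))

      Ker-ε : Ker ε
      Ker-ε = ≡.refl

      Ker-resp : ∀ {u v} → u ≈ v → Ker u → Ker v
      Ker-resp e k = ≡.trans (≡.sym (resp e)) k

      Ker-∙ : ∀ {u v} → Ker u → Ker v → Ker (u ∙ v)
      Ker-∙ p q = ≡.trans (∙-resp p q) (resp (identityˡ ε))

      Ker-⁻¹ : ∀ {u} → Ker u → Ker (u ⁻¹)
      Ker-⁻¹ {u} p = ∙-cancelˡ u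
        (≡.trans (resp (inverseʳ u)) (≡.trans (≡.sym p) (resp (sym (identityʳ u)))))

      Ker-conj : ∀ w {u} → Ker u → Ker (w ∙ u ∙ w ⁻¹)
      Ker-conj w p = ≡.trans (∙-resp (≡.trans (∙-resp ≡.refl p) (resp (identityʳ w))) ≡.refl)
                             (resp (inverseʳ w))

      Ker-isSubgroup : IsSubgroup (Δ l m n) Ker
      Ker-isSubgroup = record
        { resp-≈ = Ker-resp ; ε-closed = Ker-ε ; ∙-closed = Ker-∙ ; ⁻¹-closed = Ker-⁻¹ }

    record Section (Q : FiniteQuotient) : Set where
      open FiniteQuotient Q
      field
        rep       : Fin size → Word Rotation
        coset-rep : ∀ g → coset (rep g) ≡ g

    module _ (Q : FiniteQuotient) where
      open FiniteQuotient Q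

      private
        letter : Fin 6 → Word Rotation
        letter 0F = x
        letter 1F = y
        letter 2F = z
        letter 3F = x ⁻¹
        letter 4F = y ⁻¹
        letter 5F = z ⁻¹

        Represented : ∀ {k} → (Fin k → Word Rotation) → Word Rotation → Set
        Represented reps w = ∃ λ i → coset (reps i) ≡ coset w

        Closed : ∀ {k} → (Fin k → Word Rotation) → Set
        Closed reps = ∀ i j → Represented reps (reps i ∙ letter j)

        module _ {k} (reps : Fin k → Word Rotation) (closed : Closed reps) where

          Represented-resp : ∀ {u v} → u ≈ v → Represented reps u → Represented reps v
          Represented-resp e (i , p) = i , ≡.trans p (resp e)

          absorb-letter : ∀ j u → Represented reps u → Represented reps (u ∙ letter j)
          absorb-letter j u (i , p) with i′ , p′ ← closed i j = i′ , ≡.trans p′ (∙-resp p ≡.refl)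

          absorb   : ∀ w u → Represented reps u → Represented reps (u ∙ w)
          absorb⁻¹ : ∀ w u → Represented reps u → Represented reps (u ∙ w ⁻¹)

          absorb (gen ξ) u p = absorb-letter 0F u p
          absorb (gen η) u p = absorb-letter 1F u p
          absorb (gen ζ) u p = absorb-letter 2F u p
          absorb ε       u p = Represented-resp (sym (identityʳ u)) p
          absorb (v ∙ w) u p = Represented-resp (assoc u v w) (absorb w (u ∙ v) (absorb v u p))
          absorb (w ⁻¹)  u p = absorb⁻¹ w u p

          absorb⁻¹ (gen ξ) u p = absorb-letter 3F u p
          absorb⁻¹ (gen η) u p = absorb-letter 4F u p
          absorb⁻¹ (gen ζ) u p = absorb-letter 5F u p
          absorb⁻¹ ε       u p = Represented-resp
            (solve (lookup (u ∷ [])) (gen 0F) (gen 0F ∙ ε ⁻¹) ≡.refl) p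
          absorb⁻¹ (v ∙ w) u p = Represented-resp
            (solve (lookup (u ∷ v ∷ w ∷ []))
              (gen 0F ∙ gen 2F ⁻¹ ∙ gen 1F ⁻¹) (gen 0F ∙ (gen 1F ∙ gen 2F) ⁻¹) ≡.refl)
            (absorb⁻¹ v (u ∙ w ⁻¹) (absorb⁻¹ w u p))
          absorb⁻¹ (w ⁻¹)  u p = Represented-resp
            (solve (lookup (u ∷ w ∷ [])) (gen 0F ∙ gen 1F) (gen 0F ∙ gen 1F ⁻¹ ⁻¹) ≡.refl)
            (absorb w u p)

        record Transversal : Set where
          field
            {count}  : ℕ
            reps     : Fin count → Word Rotation
            distinct : Injective _≡_ _≡_ (λ i → coset (reps i))
            complete : ∀ w → Represented reps w

        extend : ∀ {k} → (Fin k → Word Rotation) → Word Rotation → Fin (suc k) → Word Rotation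
        extend reps w zero    = w
        extend reps w (suc i) = reps i

        extend-distinct : ∀ {k} (reps : Fin k → Word Rotation) w →
          Injective _≡_ _≡_ (λ i → coset (reps i)) → ¬ Represented reps w →
          Injective _≡_ _≡_ (λ i → coset (extend reps w i))
        extend-distinct reps w inj new {zero}  {zero}  e = ≡.refl
        extend-distinct reps w inj new {zero}  {suc j} e = ⊥-elim (new (j , ≡.sym e))
        extend-distinct reps w inj new {suc i} {zero}  e = ⊥-elim (new (i , e))
        extend-distinct reps w inj new {suc i} {suc j} e = cong suc (inj e)

        saturate : ∀ fuel {k} (reps : Fin k → Word Rotation) →
          Injective _≡_ _≡_ (λ i → coset (reps i)) → Represented reps ε →
          size < fuel + k → Transversal
        saturate zero    reps inj start enough = ⊥-elim (<⇒≱ enough (injective⇒≤ inj))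
        saturate (suc fuel) {k} reps inj start enough
          with any? (λ i → any? (λ j → ¬? (any? (λ i′ → coset (reps i′) ≟ coset (reps i ∙ letter j)))))
        ... | yes (i , j , new) =
          saturate fuel (extend reps (reps i ∙ letter j)) (extend-distinct reps _ inj new)
            (suc (proj₁ start) , proj₂ start) (subst (size <_) (≡.sym (+-suc fuel k)) enough)
        ... | no allOld = record
          { reps     = reps
          ; distinct = inj
          ; complete = λ w → Represented-resp reps closed (identityˡ w) (absorb reps closed w ε start)
          }
          where
          closed : Closed reps
          closed i j with any? (λ i′ → coset (reps i′) ≟ coset (reps i ∙ letter j))
          ... | yes old = old
          ... | no  new = ⊥-elim (allOld (i , j , new))

        abstract
          transversal : Transversal
          transversal = saturate (suc size) {1} (extend {0} (λ ()) ε)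
            (λ { {0F} {0F} _ → ≡.refl }) (zero , ≡.refl)
            (m≤m+n (suc size) 1)

        open Transversal transversal

        index : Word Rotation → Fin count
        index w = proj₁ (complete w)

        index-coset : ∀ w → coset (reps (index w)) ≡ coset w
        index-coset w = proj₂ (complete w)

        coset⇒index : ∀ {u v} → coset u ≡ coset v → index u ≡ index v
        coset⇒index {u} {v} e =
          distinct (≡.trans (index-coset u) (≡.trans e (≡.sym (index-coset v))))

        index⇒coset : ∀ {u v} → index u ≡ index v → coset u ≡ coset v
        index⇒coset {u} {v} e = ≡.trans (≡.sym (index-coset u))
          (≡.trans (cong (λ i → coset (reps i)) e) (index-coset v))

      reindexed : FiniteQuotient
      reindexed = record
        { size   = count
        ; coset  = index
        ; resp   = λ e → coset⇒index (resp e)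
        ; ∙-resp = λ p q → coset⇒index (∙-resp (index⇒coset p) (index⇒coset q))
        }

      reindexed-section : Section reindexed
      reindexed-section = record
        { rep       = reps
        ; coset-rep = λ g → distinct (index-coset (reps g))
        }

      reindexed-coset⇔ : ∀ {u v} →
        FiniteQuotient.coset reindexed u ≡ FiniteQuotient.coset reindexed v ⇔ coset u ≡ coset v
      reindexed-coset⇔ = mk⇔ index⇒coset coset⇒index

      Ker-finiteIndex : FiniteIndex (Δ l m n) Ker
      Ker-finiteIndex = count , index
        , (λ u v → mk⇔ (λ e → Equivalence.to (Ker⇔ u v) (index⇒coset e))
                       (λ e → coset⇒index (Equivalence.from (Ker⇔ u v) e)))
        , λ g → reps g , Section.coset-rep reindexed-section g

    meet : FiniteQuotient → FiniteQuotient → FiniteQuotient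
    meet Q Q′ = record
      { size   = Q.size * Q′.size
      ; coset  = λ w → combine (Q.coset w) (Q′.coset w)
      ; resp   = λ e → cong₂ combine (Q.resp e) (Q′.resp e)
      ; ∙-resp = λ {u} {u′} {v} {v′} p q →
          let p₁ , p₂ = combine-injective (Q.coset u) _ (Q.coset u′) _ p
              q₁ , q₂ = combine-injective (Q.coset v) _ (Q.coset v′) _ q
          in cong₂ combine (Q.∙-resp p₁ q₁) (Q′.∙-resp p₂ q₂)
      }
      where
      module Q = FiniteQuotient Q
      module Q′ = FiniteQuotient Q′

    meet-injective : ∀ Q Q′ {u v} → FiniteQuotient.coset (meet Q Q′) u ≡ FiniteQuotient.coset (meet Q Q′) v →
      FiniteQuotient.coset Q u ≡ FiniteQuotient.coset Q v × FiniteQuotient.coset Q′ u ≡ FiniteQuotient.coset Q′ v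
    meet-injective Q Q′ = combine-injective _ _ _ _

    mirrorQuotient : FiniteQuotient → FiniteQuotient
    mirrorQuotient Q = record
      { size   = size
      ; coset  = λ w → coset (mirror w)
      ; resp   = λ e → resp (mirror-resp {l} {m} {n} e)
      ; ∙-resp = ∙-resp
      }
      where open FiniteQuotient Q

    module _ (H : OrientablyRegularHypermap l m n) where
      open OrientablyRegularHypermap H
      open IsSubgroup isSubgroup
      open Equivalence

      finiteQuotient : Finite H → FiniteQuotient
      finiteQuotient (k , coset , coset⇔ , _) = record
        { size   = k
        ; coset  = coset
        ; resp   = λ {u} {v} e → from (coset⇔ u v)
            (resp-≈ (trans (sym (inverseˡ u)) (∙-cong refl e)) ε-closed)
        ; ∙-resp = λ {u} {u′} {v} {v′} p q → from (coset⇔ (u ∙ v) (u′ ∙ v′))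
            (resp-≈ (regroup u u′ v v′)
              (∙-closed (normal (v ⁻¹) (to (coset⇔ u u′) p)) (to (coset⇔ v v′) q)))
        }
        where
        regroup : ∀ u u′ v v′ →
          v ⁻¹ ∙ (u ⁻¹ ∙ u′) ∙ v ⁻¹ ⁻¹ ∙ (v ⁻¹ ∙ v′) ≈ (u ∙ v) ⁻¹ ∙ (u′ ∙ v′)
        regroup u u′ v v′ = solve (lookup (u ∷ u′ ∷ v ∷ v′ ∷ []))
          (gen 2F ⁻¹ ∙ (gen 0F ⁻¹ ∙ gen 1F) ∙ gen 2F ⁻¹ ⁻¹ ∙ (gen 2F ⁻¹ ∙ gen 3F))
          ((gen 0F ∙ gen 2F) ⁻¹ ∙ (gen 1F ∙ gen 3F)) ≡.refl

      finiteQuotient-Ker : ∀ fin {w} → FiniteQuotient.Ker (finiteQuotient fin) w ⇔ N w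
      finiteQuotient-Ker (k , coset , coset⇔ , _) {w} = mk⇔
        (λ e → resp-≈ (trans (∙-cong (solve (lookup []) (ε ⁻¹) ε ≡.refl) refl) (identityˡ w))
                 (to (coset⇔ ε w) (≡.sym e)))
        (λ w∈N → ≡.sym (from (coset⇔ ε w)
          (resp-≈ (solve (lookup (w ∷ [])) (gen 0F) (ε ⁻¹ ∙ gen 0F) ≡.refl) w∈N)))

      order-modulo : ∀ a → HasOrderModulo N (gen a) (order l m n a)
      order-modulo ξ = order-x
      order-modulo η = order-y
      order-modulo ζ = order-z

      module _ (Q : FiniteQuotient) (Ker⊆N : FiniteQuotient.Ker Q ⊆ N) where
        open FiniteQuotient Q

        Ker-order : ∀ a → HasOrderModulo Ker (gen a) (order l m n a)
        Ker-order a = record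
          { positive = positive
          ; power    = resp (power-relator l m n a)
          ; least    = λ j 0<j j<k k → least j 0<j j<k (Ker⊆N k)
          }
          where open HasOrderModulo (order-modulo a)

        cover : OrientablyRegularHypermap l m n
        cover = record
          { N = Ker ; isSubgroup = Ker-isSubgroup ; normal = λ g → Ker-conj g
          ; order-x = Ker-order ξ ; order-y = Ker-order η ; order-z = Ker-order ζ }

module Residues where

  open import Data.Empty using (⊥-elim)
  open import Data.Fin.Base using (Fin; toℕ; fromℕ<; funToFin; finToFun)
  open import Data.Fin.Properties using (toℕ<n; toℕ-fromℕ<; toℕ-injective; funToFin-finToFin; finToFun-funToFin; pigeonhole; <⇒≢; _≟_; ¬∀⟶∃¬)
  open import Data.Integer.Base using (ℤ; +_; -[1+_])
  open import Data.Integer.DivMod using (_/ℕ_; n%ℕd<d; a≡a%ℕn+[a/ℕn]*n)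
  import Data.Integer.Base as ℤ
  import Data.Integer.Properties as ℤₚ
  import Algebra.Solver.Ring
  import Data.Fin.Base as Fin
  open import Data.Integer.Tactic.RingSolver using (solve-∀)
  open import Data.Nat.Base as ℕ using (ℕ; zero; suc; NonZero; _<_)
  open import Data.Product.Base using (∃; _×_; _,_)
  open import Function.Base using (_∘_)
  open import Function.Bundles using (_↔_; Inverse)
  open import Level using (0ℓ)
  open import Algebra.Bundles using (CommutativeRing)
  open import Algebra.Structures using (IsCommutativeRing)
  open import Algebra.Solver.Ring.AlmostCommutativeRing using (AlmostCommutativeRing; fromCommutativeRing; _-Raw-AlmostCommutative⟶_)
  open import Data.Maybe.Base as Maybe using (Maybe)
  open import Relation.Binary.PropositionalEquality as ≡ using (_≡_; refl; cong; cong₂; subst)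
  open import Relation.Nullary using (¬_; Dec)
  open import Relation.Nullary.Decidable using (map′; dec⇒maybe)
  import Data.Nat.Properties as ℕₚ

  module Congruence {q : ℕ} where

    open import Data.Integer.Base using (_+_; _-_; _*_; -_)
    open import Data.Integer.Properties using (+-injective; *-zeroˡ; +-identityʳ)

    infix 4 _≋_ _≋̸_

    record _≋_ (a b : ℤ) : Set where
      constructor multiple
      field
        factor   : ℤ
        equation : a ≡ b + factor * + q

    _≋̸_ : ℤ → ℤ → Set
    a ≋̸ b = ¬ (a ≋ b)

    ≋-reflexive : ∀ {a b} → a ≡ b → a ≋ b
    ≋-reflexive {a} refl = multiple (+ 0) (≡.sym (+-identityʳ a))

    ≋-refl : ∀ {a} → a ≋ a
    ≋-refl = ≋-reflexive refl

    ≋-sym : ∀ {a b} → a ≋ b → b ≋ a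
    ≋-sym {a} {b} (multiple k refl) = multiple (- k) (lemma b k (+ q))
      where
      lemma : ∀ b k q → b ≡ b + k * q + (- k) * q
      lemma = solve-∀

    ≋-trans : ∀ {a b c} → a ≋ b → b ≋ c → a ≋ c
    ≋-trans {c = c} (multiple k refl) (multiple j refl) = multiple (j + k) (lemma c j k (+ q))
      where
      lemma : ∀ c j k q → c + j * q + k * q ≡ c + (j + k) * q
      lemma = solve-∀

    +-resp : ∀ {a a′ b b′} → a ≋ a′ → b ≋ b′ → a + b ≋ a′ + b′
    +-resp {a′ = a} {b′ = b} (multiple k refl) (multiple j refl) = multiple (k + j) (lemma a b k j (+ q))
      where
      lemma : ∀ a b k j q → a + k * q + (b + j * q) ≡ a + b + (k + j) * q
      lemma = solve-∀

    *-resp : ∀ {a a′ b b′} → a ≋ a′ → b ≋ b′ → a * b ≋ a′ * b′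
    *-resp {a′ = a} {b′ = b} (multiple k refl) (multiple j refl) =
      multiple (a * j + k * b + k * (j * + q)) (lemma a b k j (+ q))
      where
      lemma : ∀ a b k j q → (a + k * q) * (b + j * q) ≡ a * b + (a * j + k * b + k * (j * q)) * q
      lemma = solve-∀

    neg-resp : ∀ {a b} → a ≋ b → - a ≋ - b
    neg-resp {b = b} (multiple k refl) = multiple (- k) (lemma b k (+ q))
      where
      lemma : ∀ b k q → - (b + k * q) ≡ - b + (- k) * q
      lemma = solve-∀

    q≋0 : + q ≋ + 0
    q≋0 = multiple (+ 1) (lemma (+ q))
      where
      lemma : ∀ q → q ≡ + 0 + + 1 * q
      lemma = solve-∀

    residues-unique : ∀ {i j} → i < q → j < q → + i ≋ + j → i ≡ j
    residues-unique {i} {j} i<q j<q (multiple (+ zero) e) =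
      +-injective (≡.trans e (≡.trans (cong (λ t → + j + t) (*-zeroˡ (+ q))) (+-identityʳ (+ j))))
    residues-unique {i} {j} i<q j<q (multiple (+ suc k) e) = ⊥-elim (ℕₚ.<⇒≱ i<q
      (ℕₚ.≤-trans (ℕₚ.≤-trans (ℕₚ.m≤m+n q (k ℕ.* q)) (ℕₚ.m≤n+m (suc k ℕ.* q) j))
                  (ℕₚ.≤-reflexive (≡.sym (+-injective (≡.trans e (cong (λ t → + j + t) (≡.sym (pos-* (suc k) q)))))))))
      where open import Data.Integer.Properties using (pos-*)
    residues-unique {i} {j} i<q j<q (multiple -[1+ k ] e) = ⊥-elim (ℕₚ.<⇒≱ j<q
      (ℕₚ.≤-trans (ℕₚ.≤-trans (ℕₚ.m≤m+n q (k ℕ.* q)) (ℕₚ.m≤n+m (suc k ℕ.* q) i))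
                  (ℕₚ.≤-reflexive (≡.sym (+-injective j≡)))))
      where
      open import Data.Integer.Properties using (pos-*)
      lemma : ∀ j k q → j ≡ (j + (- k) * q) + k * q
      lemma = solve-∀
      j≡ : + j ≡ + (i ℕ.+ suc k ℕ.* q)
      j≡ = ≡.trans (lemma (+ j) (+ suc k) (+ q))
           (≡.trans (cong (λ t → t + + suc k * + q) (≡.sym e)) (cong (λ t → + i + t) (≡.sym (pos-* (suc k) q))))

    module _ .{{_ : NonZero q}} where

      residue : ℤ → Fin q
      residue a = fromℕ< (n%ℕd<d a q)

      ≋-residue : ∀ a → a ≋ + toℕ (residue a)
      ≋-residue a = multiple (a /ℕ q) (≡.trans (a≡a%ℕn+[a/ℕn]*n a q)
        (cong (λ r → + r + (a /ℕ q) * + q) (≡.sym (toℕ-fromℕ< (n%ℕd<d a q)))))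

      residue-injective : ∀ {a b} → residue a ≡ residue b → a ≋ b
      residue-injective {a} {b} e =
        ≋-trans (≋-residue a) (≋-trans (≋-reflexive (cong (λ i → + toℕ i) e)) (≋-sym (≋-residue b)))

      residue-cong : ∀ {a b} → a ≋ b → residue a ≡ residue b
      residue-cong {a} {b} e = toℕ-injective (residues-unique (toℕ<n (residue a)) (toℕ<n (residue b))
        (≋-trans (≋-sym (≋-residue a)) (≋-trans e (≋-residue b))))

  funToFin-cong : ∀ {U q} {f g : Fin U → Fin q} → (∀ i → f i ≡ g i) → funToFin f ≡ funToFin g
  funToFin-cong {zero}  e = refl
  funToFin-cong {suc U} e = cong₂ combine (e zero) (funToFin-cong (e ∘ suc))
    where open import Data.Fin.Base using (combine; zero; suc)

  funToFin-injective : ∀ {U q} {f g : Fin U → Fin q} → funToFin f ≡ funToFin g → ∀ i → f i ≡ g i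
  funToFin-injective {f = f} {g} e i = ≡.trans (≡.sym (finToFun-funToFin f i))
    (≡.trans (cong (λ t → finToFun t i) e) (finToFun-funToFin g i))


  -- ℤ/q up to isomorphism: every element is the image under ι of exactly one of
  -- 0, …, q - 1.
  record ModularRing (q : ℕ) : Set₁ where
    infix  4 _≋_ _≋̸_
    infixl 6 _+_ _-_
    infixl 7 _*_
    infix  8 -_
    field
      1<q     : 1 < q
      Carrier : Set
      _≋_     : Carrier → Carrier → Set
      _+_ _*_ : Carrier → Carrier → Carrier
      -_      : Carrier → Carrier
      ι       : ℤ → Carrier
      isCommutativeRing : IsCommutativeRing _≋_ _+_ _*_ -_ (ι (+ 0)) (ι (+ 1))
      ι-+       : ∀ i j → ι (i ℤ.+ j) ≋ ι i + ι j
      ι-*       : ∀ i j → ι (i ℤ.* j) ≋ ι i * ι j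
      ι-neg     : ∀ i → ι (ℤ.- i) ≋ - ι i
      ι-q       : ι (+ q) ≋ ι (+ 0)
      residue   : Carrier → Fin q
      ι-residue : ∀ a → a ≋ ι (+ toℕ (residue a))
      ι-injective : ∀ {i j} → i < q → j < q → ι (+ i) ≋ ι (+ j) → i ≡ j

    open IsCommutativeRing isCommutativeRing public
      using (+-cong; *-cong; -‿cong; +-assoc; +-comm; *-assoc; *-comm; +-identityˡ; +-identityʳ; *-identityˡ; *-identityʳ; zeroˡ; zeroʳ; -‿inverseˡ; -‿inverseʳ)
      renaming (refl to ≋-refl; sym to ≋-sym; trans to ≋-trans; reflexive to ≋-reflexive)

    commutativeRing : CommutativeRing 0ℓ 0ℓ
    commutativeRing = record { isCommutativeRing = isCommutativeRing }

    open CommutativeRing commutativeRing public using (setoid)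

    0# 1# : Carrier
    0# = ι (+ 0)
    1# = ι (+ 1)

    _-_ : Carrier → Carrier → Carrier
    a - b = a + - b

    _≋̸_ : Carrier → Carrier → Set
    a ≋̸ b = ¬ (a ≋ b)

    residue-injective : ∀ {a b} → residue a ≡ residue b → a ≋ b
    residue-injective {a} {b} e =
      ≋-trans (ι-residue a) (≋-trans (≋-reflexive (cong (λ i → ι (+ toℕ i)) e)) (≋-sym (ι-residue b)))

    residue-cong : ∀ {a b} → a ≋ b → residue a ≡ residue b
    residue-cong {a} {b} e = toℕ-injective (ι-injective (toℕ<n (residue a)) (toℕ<n (residue b))
      (≋-trans (≋-sym (ι-residue a)) (≋-trans e (ι-residue b))))

    infix 4 _≋?_
    _≋?_ : ∀ a b → Dec (a ≋ b)
    a ≋? b = map′ residue-injective residue-cong (residue a ≟ residue b)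

    private
      almostCommutativeRing : AlmostCommutativeRing 0ℓ 0ℓ
      almostCommutativeRing = fromCommutativeRing commutativeRing

      ι-morphism : ℤ.+-*-rawRing -Raw-AlmostCommutative⟶ almostCommutativeRing
      ι-morphism = record { ⟦_⟧ = ι ; +-homo = ι-+ ; *-homo = ι-* ; -‿homo = ι-neg
                          ; 0-homo = ≋-refl ; 1-homo = ≋-refl }

      _coefficient≟_ : ∀ i j → Maybe (ι i ≋ ι j)
      i coefficient≟ j = Maybe.map (λ e → ≋-reflexive (cong ι e)) (dec⇒maybe (i ℤₚ.≟ j))

    module RingSolver = Algebra.Solver.Ring ℤ.+-*-rawRing almostCommutativeRing ι-morphism _coefficient≟_

    open RingSolver using (_:=_; _:+_; _:*_; _:-_; :-_; con)

    minus≋0 : ∀ {a b} → a ≋ b → a - b ≋ 0#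
    minus≋0 {a} {b} e = ≋-trans (+-cong e ≋-refl) (-‿inverseʳ b)

    minus≋0⁻¹ : ∀ {a b} → a - b ≋ 0# → a ≋ b
    minus≋0⁻¹ {a} {b} e = ≋-trans (RingSolver.solve 2 (λ a b → a := b :+ (a :- b)) ≋-refl a b)
      (≋-trans (+-cong ≋-refl e) (+-identityʳ b))

    +-cancelˡ : ∀ {a b} c → c + a ≋ c + b → a ≋ b
    +-cancelˡ {a} {b} c e = ≋-trans (undo a) (≋-trans (+-cong (≋-refl {x = - c}) e) (≋-sym (undo b)))
      where
      undo : ∀ a → a ≋ - c + (c + a)
      undo a = RingSolver.solve 2 (λ a c → a := :- c :+ (c :+ a)) ≋-refl a c

  module _ (q : ℕ) (1<q : 1 < q) where
    private
      open module C = Congruence {q}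
      instance
        q≢0 : NonZero q
        q≢0 = ℕ.>-nonZero (ℕₚ.<-trans ℕₚ.0<1+n 1<q)

    ℤ/_ : ModularRing q
    ℤ/_ = record
      { 1<q = 1<q
      ; Carrier = ℤ ; _≋_ = C._≋_ ; _+_ = ℤ._+_ ; _*_ = ℤ._*_ ; -_ = ℤ.-_ ; ι = λ i → i
      ; isCommutativeRing = record
        { isRing = record
          { +-isAbelianGroup = record
            { isGroup = record
              { isMonoid = record
                { isSemigroup = record
                  { isMagma = record
                    { isEquivalence = record { refl = ≋-refl ; sym = ≋-sym ; trans = ≋-trans }
                    ; ∙-cong = +-resp }
                  ; assoc = λ a b c → ≋-reflexive (ℤₚ.+-assoc a b c) }
                ; identity = (λ a → ≋-reflexive (ℤₚ.+-identityˡ a)) , (λ a → ≋-reflexive (ℤₚ.+-identityʳ a)) }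
              ; inverse = (λ a → ≋-reflexive (ℤₚ.+-inverseˡ a)) , (λ a → ≋-reflexive (ℤₚ.+-inverseʳ a))
              ; ⁻¹-cong = neg-resp }
            ; comm = λ a b → ≋-reflexive (ℤₚ.+-comm a b) }
          ; *-cong = *-resp
          ; *-assoc = λ a b c → ≋-reflexive (ℤₚ.*-assoc a b c)
          ; *-identity = (λ a → ≋-reflexive (ℤₚ.*-identityˡ a)) , (λ a → ≋-reflexive (ℤₚ.*-identityʳ a))
          ; distrib = (λ a b c → ≋-reflexive (ℤₚ.*-distribˡ-+ a b c)) , (λ a b c → ≋-reflexive (ℤₚ.*-distribʳ-+ a b c)) }
        ; *-comm = λ a b → ≋-reflexive (ℤₚ.*-comm a b) }
      ; ι-+ = λ _ _ → ≋-refl ; ι-* = λ _ _ → ≋-refl ; ι-neg = λ _ → ≋-refl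
      ; ι-q = q≋0
      ; residue = residue
      ; ι-residue = ≋-residue
      ; ι-injective = residues-unique
      }

  -- More unknowns than equations: by the pigeonhole principle two assignments of
  -- residues have the same image, and their difference is a solution.
  module _ {q : ℕ} (R : ModularRing q) where
    open ModularRing R

    nontrivial-solution : ∀ {U E} → E < U → (L : (Fin U → Carrier) → Fin E → Carrier) →
      (∀ v w j → L (λ i → v i - w i) j ≋ L v j - L w j) →
      ∃ λ v → (∃ λ i → v i ≋̸ 0#) × (∀ j → L v j ≋ 0#)
    nontrivial-solution {U} {E} E<U L L-minus = solution (pigeonhole (ℕₚ.^-monoʳ-< q 1<q E<U) code)
      where
      digits : Fin (q ℕ.^ U) → Fin U → Carrier
      digits k i = ι (+ toℕ (finToFun k i))

      digits-injective : ∀ {k k′ i} → digits k i ≋ digits k′ i → finToFun {n = U} k i ≡ finToFun k′ i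
      digits-injective e = toℕ-injective (ι-injective (toℕ<n _) (toℕ<n _) e)

      code : Fin (q ℕ.^ U) → Fin (q ℕ.^ E)
      code k = funToFin (λ j → residue (L (digits k) j))

      solution : (∃ λ k → ∃ λ k′ → k Fin.< k′ × code k ≡ code k′) → _
      solution (k , k′ , k<k′ , e) = (λ i → digits k i - digits k′ i) , different , solves
        where
        solves : ∀ j → L (λ i → digits k i - digits k′ i) j ≋ 0#
        solves j = ≋-trans (L-minus (digits k) (digits k′) j)
          (minus≋0 (residue-injective (funToFin-injective e j)))

        different : ∃ λ i → digits k i - digits k′ i ≋̸ 0#
        different = ¬∀⟶∃¬ U _ (λ i → digits k i - digits k′ i ≋? 0#) (λ all → <⇒≢ k<k′
          (≡.trans (≡.sym (funToFin-finToFin {U} k))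
          (≡.trans (funToFin-cong (λ i → digits-injective {k} {k′} {i} (minus≋0⁻¹ (all i))))
                   (funToFin-finToFin {U} k′))))

    abstract
      nontrivial-solution′ : ∀ {A B : Set} {U E} → A ↔ Fin U → B ↔ Fin E → E < U →
        (L : (A → Carrier) → B → Carrier) → (∀ v w b → L (λ a → v a - w a) b ≋ L v b - L w b) →
        ∃ λ v → (∃ λ a → v a ≋̸ 0#) × (∀ b → L v b ≋ 0#)
      nontrivial-solution′ A↔ B↔ E<U L L-minus =
        let v , (i , vᵢ≢0) , solves = nontrivial-solution E<U (λ v j → L (v ∘ A.to) (B.from j))
                                        (λ v w j → L-minus (v ∘ A.to) (w ∘ A.to) (B.from j))
        in v ∘ A.to
         , (A.from i , subst (λ i → v i ≋̸ 0#) (≡.sym (A.strictlyInverseˡ i)) vᵢ≢0)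
         , λ b → subst (λ b → L (v ∘ A.to) b ≋ 0#) (B.strictlyInverseʳ b) (solves (B.to b))
        where
        module A = Inverse A↔
        module B = Inverse B↔

module Orbits where

  open import Data.Bool.Base using (Bool; true; false)
  open import Data.Empty using (⊥; ⊥-elim)
  open import Data.Fin.Base using (Fin; zero; suc; toℕ; fromℕ<)
  open import Data.Fin.Properties using (_≟_; any?; injective⇒≤; +↔⊎; *↔×; toℕ<n; toℕ-fromℕ<; toℕ-injective)
  open import Data.Nat.Base using (ℕ; zero; suc; _+_; _*_; _≤_; _<_; _∸_; NonZero)
  open import Data.Nat.DivMod using (_%_; _/_; m%n<n; m≡m%n+[m/n]*n)
  open import Data.Product.Base using (∃; _×_; _,_; proj₁; proj₂)
  open import Data.Product.Function.NonDependent.Propositional using (_×-↔_)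
  open import Data.Sum.Base using (_⊎_; inj₁; inj₂)
  open import Data.Sum.Function.Propositional using (_⊎-↔_)
  open import Data.Unit.Base using (⊤; tt)
  open import Function.Base using (_∘_; id; case_of_)
  open import Function.Bundles using (_↔_; Inverse; mk↔ₛ′)
  open import Function.Construct.Composition using (_↔-∘_)
  open import Function.Construct.Identity using (↔-id)
  open import Function.Construct.Symmetry using (↔-sym)
  open import Function.Definitions using (Injective)
  open import Relation.Binary.PropositionalEquality as ≡ using (_≡_; _≢_; refl; cong; cong₂; subst)
  open import Relation.Nullary using (¬_; Dec; yes; no; ¬?; _⊎-dec_)
  import Data.Nat.Properties as ℕₚ

  injection⇒≤ : ∀ {A B : Set} {a b} → A ↔ Fin a → B ↔ Fin b →
                (f : A → B) → Injective _≡_ _≡_ f → a ≤ b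
  injection⇒≤ A↔ B↔ f f-inj = injective⇒≤ {f = λ i → B.to (f (A.from i))} λ {i} {j} e →
    ≡.trans (≡.sym (A.strictlyInverseˡ i)) (≡.trans (cong A.to (f-inj
      (≡.trans (≡.sym (B.strictlyInverseʳ _)) (≡.trans (cong B.from e) (B.strictlyInverseʳ _)))))
      (A.strictlyInverseˡ j))
    where
    module A = Inverse A↔
    module B = Inverse B↔

  infixr 5 _⊎-count_
  infixr 6 _×-count_

  _⊎-count_ : ∀ {A B : Set} {a b} → A ↔ Fin a → B ↔ Fin b → (A ⊎ B) ↔ Fin (a + b)
  A↔ ⊎-count B↔ = ↔-sym +↔⊎ ↔-∘ (A↔ ⊎-↔ B↔)

  _×-count_ : ∀ {A B : Set} {a b} → A ↔ Fin a → B ↔ Fin b → (A × B) ↔ Fin (a * b)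
  A↔ ×-count B↔ = ↔-sym *↔× ↔-∘ (A↔ ×-↔ B↔)

  Bool↔Fin2 : Bool ↔ Fin 2
  Bool↔Fin2 = mk↔ₛ′ (λ { true → zero ; false → suc zero }) (λ { zero → true ; (suc zero) → false })
    (λ { zero → refl ; (suc zero) → refl }) (λ { true → refl ; false → refl })

  Fin↔ : ∀ {k} → Fin k ↔ Fin k
  Fin↔ = ↔-id _

  record Transversal {d} (Q : Fin d → Set) (R : Fin d → Fin d → Set) : Set where
    field
      {count}   : ℕ
      rep       : Fin count → Fin d
      rep∈      : ∀ i → Q (rep i)
      separated : ∀ {i j} → R (rep i) (rep j) → R (rep j) (rep i) → i ≡ j
      covers    : ∀ g → Q g → ∃ λ i → R (rep i) g

  module _ {d} {Q : Fin d → Set} {R : Fin d → Fin d → Set}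
           (Q? : ∀ g → Dec (Q g)) (R? : ∀ g h → Dec (R g h)) (R-refl : ∀ {g} → R g g) where

    private
      record Partial {k} (element : Fin k → Fin d) : Set where
        field
          {count}   : ℕ
          rep       : Fin count → Fin d
          rep∈      : ∀ i → Q (rep i)
          separated : ∀ {i j} → R (rep i) (rep j) → R (rep j) (rep i) → i ≡ j
          covers    : ∀ k → Q (element k) → ∃ λ i → R (rep i) (element k)

      greedy : ∀ {k} (element : Fin k → Fin d) → Partial element
      greedy {zero} element = record
        { count = 0 ; rep = λ () ; rep∈ = λ () ; separated = λ { {()} } ; covers = λ () }
      greedy {suc k} element with Q? (element zero) | greedy (element ∘ suc)
      ... | no ∉Q | P = record
        { rep = P.rep ; rep∈ = P.rep∈ ; separated = P.separated
        ; covers = λ { zero q → ⊥-elim (∉Q q) ; (suc i) q → P.covers i q } }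
        where module P = Partial P
      ... | yes ∈Q | P with any? (λ i → R? (Partial.rep P i) (element zero))
      ... | yes covered = record
        { rep = P.rep ; rep∈ = P.rep∈ ; separated = P.separated
        ; covers = λ { zero q → covered ; (suc i) q → P.covers i q } }
        where module P = Partial P
      ... | no new = record
        { rep       = rep′
        ; rep∈      = λ { zero → ∈Q ; (suc i) → P.rep∈ i }
        ; separated = λ {i} {j} → separated′ i j
        ; covers    = λ { zero q → zero , R-refl
                        ; (suc i) q → suc (proj₁ (P.covers i q)) , proj₂ (P.covers i q) }
        }
        where
        module P = Partial P
        rep′ : Fin (suc P.count) → Fin d
        rep′ zero    = element zero
        rep′ (suc i) = P.rep i
        separated′ : ∀ i j → R (rep′ i) (rep′ j) → R (rep′ j) (rep′ i) → i ≡ j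
        separated′ zero    zero    r s = refl
        separated′ zero    (suc j) r s = ⊥-elim (new (j , s))
        separated′ (suc i) zero    r s = ⊥-elim (new (i , r))
        separated′ (suc i) (suc j) r s = cong suc (P.separated r s)

    abstract
      transversal : Transversal Q R
      transversal = record
        { rep = P.rep ; rep∈ = P.rep∈ ; separated = P.separated ; covers = P.covers }
        where module P = Partial (greedy id)

  halve : ∀ c → ∃ λ i → c ≡ i + i ⊎ c ≡ suc (i + i)
  halve zero = 0 , inj₁ refl
  halve (suc c) with halve c
  ... | i , inj₁ e = i , inj₂ (cong suc e)
  ... | i , inj₂ e = suc i , inj₁ (cong suc (≡.trans e (≡.sym (ℕₚ.+-suc i i))))

  iterate : {A : Set} → (A → A) → ℕ → A → A
  iterate f zero    a = a
  iterate f (suc k) a = iterate f k (f a)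

  module _ {A : Set} (f : A → A) where

    iterate-sucʳ : ∀ k a → iterate f (suc k) a ≡ f (iterate f k a)
    iterate-sucʳ zero    a = refl
    iterate-sucʳ (suc k) a = iterate-sucʳ k (f a)

    iterate-+ : ∀ i j a → iterate f (i + j) a ≡ iterate f j (iterate f i a)
    iterate-+ zero    j a = refl
    iterate-+ (suc i) j a = iterate-+ i j (f a)

  Fixed : ∀ {d} → (Fin d → Fin d) → Fin d → Set
  Fixed τ g = τ g ≡ g

  fixedPoints : ∀ {d} (τ : Fin d → Fin d) → Transversal (Fixed τ) _≡_
  fixedPoints τ = transversal (λ g → τ g ≟ g) _≟_ refl

  module Involution {d} (τ : Fin d → Fin d) (τ² : ∀ g → τ (τ g) ≡ g) where

    _~_ : Fin d → Fin d → Set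
    g ~ h = g ≡ h ⊎ τ g ≡ h

    _~?_ : ∀ g h → Dec (g ~ h)
    g ~? h = (g ≟ h) ⊎-dec (τ g ≟ h)

    ~-sym : ∀ {g h} → g ~ h → h ~ g
    ~-sym (inj₁ refl) = inj₁ refl
    ~-sym (inj₂ refl) = inj₂ (τ² _)

    ~-trans : ∀ {g h k} → g ~ h → h ~ k → g ~ k
    ~-trans (inj₁ refl) s           = s
    ~-trans (inj₂ refl) (inj₁ refl) = inj₂ refl
    ~-trans (inj₂ refl) (inj₂ refl) = inj₁ (≡.sym (τ² _))

    module F = Transversal (fixedPoints τ)

    orbits : Transversal (λ _ → ⊤) _~_
    orbits = transversal (λ _ → yes tt) _~?_ (inj₁ refl)

    properOrbits : Transversal (λ g → ¬ Fixed τ g) _~_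
    properOrbits = transversal (λ g → ¬? (τ g ≟ g)) _~?_ (inj₁ refl)

    private
      module O = Transversal orbits
      module P = Transversal properOrbits

    orbits-bound : d + F.count ≤ O.count * 2
    orbits-bound = injection⇒≤ (Fin↔ ⊎-count Fin↔) (Fin↔ ×-count Bool↔Fin2) label
      λ {a} {b} → label-inj a b
      where
      index : Fin d → Fin O.count
      index g = proj₁ (O.covers g tt)
      index~ : ∀ g → O.rep (index g) ~ g
      index~ g = proj₂ (O.covers g tt)
      isRep : Fin d → Bool
      isRep g with O.rep (index g) ≟ g
      ... | yes _ = true
      ... | no  _ = false
      label : Fin d ⊎ Fin F.count → Fin O.count × Bool
      label (inj₁ g) = index g , isRep g
      label (inj₂ i) = index (F.rep i) , false

      fixed-rep : ∀ i → O.rep (index (F.rep i)) ≡ F.rep i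
      fixed-rep i with index~ (F.rep i)
      ... | inj₁ e = e
      ... | inj₂ e = ≡.trans (≡.sym (τ² _)) (≡.trans (cong τ e) (F.rep∈ i))

      label-inj : ∀ a b → label a ≡ label b → a ≡ b
      label-inj (inj₁ g) (inj₁ h) e with O.rep (index g) ≟ g | O.rep (index h) ≟ h
      ... | yes p | yes r = cong inj₁ (≡.trans (≡.sym p) (≡.trans (cong (O.rep ∘ proj₁) e) r))
      ... | yes p | no  r = case cong proj₂ e of λ ()
      ... | no  p | yes r = case cong proj₂ e of λ ()
      ... | no  p | no  r with index~ g | index~ h
      ... | inj₁ s | _      = ⊥-elim (p s)
      ... | _      | inj₁ t = ⊥-elim (r t)
      ... | inj₂ s | inj₂ t = cong inj₁ (≡.trans (≡.sym s) (≡.trans (cong (τ ∘ O.rep ∘ proj₁) e) t))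
      label-inj (inj₂ i) (inj₂ j) e = cong inj₂ (F.separated r (≡.sym r))
        where
        r : F.rep i ≡ F.rep j
        r = ≡.trans (≡.sym (fixed-rep i)) (≡.trans (cong (O.rep ∘ proj₁) e) (fixed-rep j))
      label-inj (inj₁ g) (inj₂ j) e = ⊥-elim (clash g j e)
        where
        clash : ∀ g j → label (inj₁ g) ≡ label (inj₂ j) → ⊥
        clash g j e with O.rep (index g) ≟ g
        ... | yes p = case cong proj₂ e of λ ()
        ... | no  p with index~ g
        ... | inj₁ s = p s
        ... | inj₂ s = p (≡.trans (cong (O.rep ∘ proj₁) e) (≡.trans (fixed-rep j) (≡.trans (≡.sym (F.rep∈ j))
                (≡.trans (≡.sym (cong τ (≡.trans (cong (O.rep ∘ proj₁) e) (fixed-rep j)))) s))))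
      label-inj (inj₂ j) (inj₁ g) e = ≡.sym (label-inj (inj₁ g) (inj₂ j) (≡.sym e))

    properOrbits-bound : P.count * 2 + F.count ≤ d
    properOrbits-bound = injection⇒≤ ((Fin↔ ×-count Bool↔Fin2) ⊎-count Fin↔) Fin↔ point
      λ {a} {b} → point-inj a b
      where
      branch : Bool → Fin d → Fin d
      branch true  g = g
      branch false g = τ g

      branch~ : ∀ s g → g ~ branch s g
      branch~ true  g = inj₁ refl
      branch~ false g = inj₂ refl

      branch-injective : ∀ s t g → ¬ Fixed τ g → branch s g ≡ branch t g → s ≡ t
      branch-injective true  true  g p e = refl
      branch-injective false false g p e = refl
      branch-injective true  false g p e = ⊥-elim (p (≡.sym e))
      branch-injective false true  g p e = ⊥-elim (p e)

      branch-fixed : ∀ s g → Fixed τ (branch s g) → Fixed τ g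
      branch-fixed true  g e = e
      branch-fixed false g e = ≡.trans (≡.sym e) (τ² g)

      point : (Fin P.count × Bool) ⊎ Fin F.count → Fin d
      point (inj₁ (i , s)) = branch s (P.rep i)
      point (inj₂ j)       = F.rep j

      related : ∀ {i j} s t → branch s (P.rep i) ≡ branch t (P.rep j) → P.rep i ~ P.rep j
      related s t e = ~-trans (branch~ s _) (~-trans (inj₁ e) (~-sym (branch~ t _)))

      point-inj : ∀ a b → point a ≡ point b → a ≡ b
      point-inj (inj₁ (i , s)) (inj₁ (j , t)) e
        with refl ← P.separated {i} {j} (related s t e) (~-sym (related s t e)) =
        cong (λ r → inj₁ (i , r)) (branch-injective s t _ (P.rep∈ i) e)
      point-inj (inj₂ i) (inj₂ j) e = cong inj₂ (F.separated e (≡.sym e))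
      point-inj (inj₁ (i , s)) (inj₂ j) e =
        ⊥-elim (P.rep∈ i (branch-fixed s _ (subst (Fixed τ) (≡.sym e) (F.rep∈ j))))
      point-inj (inj₂ j) (inj₁ (i , s)) e =
        ⊥-elim (P.rep∈ i (branch-fixed s _ (subst (Fixed τ) e (F.rep∈ j))))

  module Cycles {d} (π : Fin d → Fin d) (m : ℕ) .{{_ : NonZero m}}
                (π^m : ∀ g → iterate π m g ≡ g)
                (free : ∀ j g → 0 < j → j < m → iterate π j g ≢ g) where

    infix 8 _^_
    _^_ : Fin d → ℕ → Fin d
    g ^ k = iterate π k g

    ^-multiple : ∀ k g → g ^ (k * m) ≡ g
    ^-multiple zero    g = refl
    ^-multiple (suc k) g = ≡.trans (iterate-+ π m (k * m) g)
      (≡.trans (cong (_^ (k * m)) (π^m g)) (^-multiple k g))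

    ^-% : ∀ k g → g ^ k ≡ g ^ (k % m)
    ^-% k g = ≡.trans (cong (g ^_) (m≡m%n+[m/n]*n k m))
      (≡.trans (iterate-+ π (k % m) _ g) (^-multiple (k / m) _))

    infix 4 _∼_
    _∼_ : Fin d → Fin d → Set
    g ∼ h = ∃ λ (j : Fin m) → g ^ toℕ j ≡ h

    _∼?_ : ∀ g h → Dec (g ∼ h)
    g ∼? h = any? λ j → g ^ toℕ j ≟ h

    ^⇒∼ : ∀ k {g h} → g ^ k ≡ h → g ∼ h
    ^⇒∼ k {g} e = fromℕ< (m%n<n k m) ,
      ≡.trans (cong (g ^_) (toℕ-fromℕ< (m%n<n k m))) (≡.trans (≡.sym (^-% k g)) e)

    ∼-refl : ∀ {g} → g ∼ g
    ∼-refl = ^⇒∼ 0 refl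

    ∼-reflexive : ∀ {g h} → g ≡ h → g ∼ h
    ∼-reflexive refl = ∼-refl

    ∼-trans : ∀ {g h k} → g ∼ h → h ∼ k → g ∼ k
    ∼-trans {g} (i , refl) (j , refl) = ^⇒∼ (toℕ i + toℕ j) (iterate-+ π (toℕ i) (toℕ j) g)

    complement : ∀ (j : Fin m) g → (g ^ toℕ j) ^ (m ∸ toℕ j) ≡ g
    complement j g = ≡.trans (≡.sym (iterate-+ π (toℕ j) _ g))
      (≡.trans (cong (g ^_) (ℕₚ.m+[n∸m]≡n (ℕₚ.<⇒≤ (toℕ<n j)))) (π^m g))

    ∼-sym : ∀ {g h} → g ∼ h → h ∼ g
    ∼-sym {g} (j , refl) = ^⇒∼ (m ∸ toℕ j) (complement j g)

    π-injective : ∀ {g h} → π g ≡ π h → g ≡ h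
    π-injective {g} {h} e = ≡.trans (≡.sym (undo g)) (≡.trans (cong (_^ (m ∸ 1)) e) (undo h))
      where
      undo : ∀ g → π g ^ (m ∸ 1) ≡ g
      undo g = ≡.trans (cong (g ^_) (ℕₚ.suc-pred m)) (π^m g)

    ^-injectiveˡ : ∀ k {g h} → g ^ k ≡ h ^ k → g ≡ h
    ^-injectiveˡ zero    e = e
    ^-injectiveˡ (suc k) e = π-injective (^-injectiveˡ k e)

    private
      ^-injectiveʳ-≤ : ∀ {i j} g → i ≤ j → j < m → g ^ i ≡ g ^ j → i ≡ j
      ^-injectiveʳ-≤ {i} {j} g i≤j j<m e with j ∸ i in eq
      ... | zero  = ℕₚ.≤-antisym i≤j (ℕₚ.m∸n≡0⇒m≤n eq)
      ... | suc k = ⊥-elim (free (suc k) g ℕₚ.0<1+n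
          (ℕₚ.≤-<-trans (subst (_≤ j) eq (ℕₚ.m∸n≤m j i)) j<m)
          (≡.sym (^-injectiveˡ i (≡.trans e (≡.trans (cong (g ^_) (≡.sym j≡))
            (iterate-+ π (suc k) i g))))))
        where
        j≡ : suc k + i ≡ j
        j≡ = ≡.trans (cong (_+ i) (≡.sym eq)) (ℕₚ.m∸n+n≡m i≤j)

    ^-injectiveʳ : ∀ {i j} g → i < m → j < m → g ^ i ≡ g ^ j → i ≡ j
    ^-injectiveʳ {i} {j} g i<m j<m e with ℕₚ.≤-total i j
    ... | inj₁ i≤j = ^-injectiveʳ-≤ g i≤j j<m e
    ... | inj₂ j≤i = ≡.sym (^-injectiveʳ-≤ g j≤i i<m (≡.sym e))

    ^-injectiveᶠ : ∀ {i j : Fin m} g → g ^ toℕ i ≡ g ^ toℕ j → i ≡ j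
    ^-injectiveᶠ {i} {j} g e = toℕ-injective (^-injectiveʳ g (toℕ<n i) (toℕ<n j) e)

    cycles : Transversal (λ _ → ⊤) _∼_
    cycles = transversal (λ _ → yes tt) _∼?_ ∼-refl

    private module C = Transversal cycles

    cycles-bound : C.count * m ≤ d
    cycles-bound = injection⇒≤ (Fin↔ ×-count Fin↔) Fin↔ (λ (i , j) → C.rep i ^ toℕ j)
      λ {a} {b} → point-inj a b
      where
      point-inj : ∀ ((i , j) (i′ , j′) : Fin C.count × Fin m) →
                  C.rep i ^ toℕ j ≡ C.rep i′ ^ toℕ j′ → (i , j) ≡ (i′ , j′)
      point-inj (i , j) (i′ , j′) e
        with refl ← C.separated {i} {i′} (∼-trans (j , e) (∼-sym (j′ , refl)))
                                         (∼-trans (j′ , ≡.sym e) (∼-sym (j , refl))) =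
        cong (i ,_) (^-injectiveᶠ (C.rep i) e)

    module Dihedral (τ : Fin d → Fin d) (τ² : ∀ g → τ (τ g) ≡ g)
                    (τ-π : ∀ g → τ g ∼ τ (π g)) where

      τ-∼ : ∀ {g h} → g ∼ h → τ g ∼ τ h
      τ-∼ {g} (j , refl) = go (toℕ j) g
        where
        go : ∀ k g → τ g ∼ τ (g ^ k)
        go zero    g = ∼-refl
        go (suc k) g = ∼-trans (τ-π g) (go k (π g))

      branch : Bool → Fin d → Fin d
      branch true  g = g
      branch false g = τ g

      infix 4 _≈_
      _≈_ : Fin d → Fin d → Set
      g ≈ h = g ∼ h ⊎ τ g ∼ h

      _≈?_ : ∀ g h → Dec (g ≈ h)
      g ≈? h = (g ∼? h) ⊎-dec (τ g ∼? h)

      ≈-branch : ∀ s {g h} → branch s g ∼ h → g ≈ h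
      ≈-branch true  = inj₁
      ≈-branch false = inj₂

      ≈-sym : ∀ {g h} → g ≈ h → h ≈ g
      ≈-sym (inj₁ p) = inj₁ (∼-sym p)
      ≈-sym {g} (inj₂ p) = inj₂ (∼-trans (∼-sym (τ-∼ p)) (∼-reflexive (τ² g)))

      ≈-trans : ∀ {g h k} → g ≈ h → h ≈ k → g ≈ k
      ≈-trans (inj₁ p) (inj₁ r) = inj₁ (∼-trans p r)
      ≈-trans (inj₁ p) (inj₂ r) = inj₂ (∼-trans (τ-∼ p) r)
      ≈-trans (inj₂ p) (inj₁ r) = inj₂ (∼-trans p r)
      ≈-trans {g} (inj₂ p) (inj₂ r) =
        inj₁ (∼-trans (∼-reflexive (≡.sym (τ² g))) (∼-trans (τ-∼ p) r))

      Folded : Fin d → Set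
      Folded g = g ∼ τ g

      folded? : ∀ g → Dec (Folded g)
      folded? g = g ∼? τ g

      Folded-resp : ∀ {g h} → g ≈ h → Folded g → Folded h
      Folded-resp (inj₁ p) f = ∼-trans (∼-sym p) (∼-trans f (τ-∼ p))
      Folded-resp {g} (inj₂ p) f =
        ∼-trans (∼-sym p) (∼-trans (∼-sym f) (∼-trans (∼-reflexive (≡.sym (τ² g))) (τ-∼ p)))

      unfoldedOrbits : Transversal (λ g → ¬ Folded g) _≈_
      unfoldedOrbits = transversal (λ g → ¬? (folded? g)) _≈?_ (inj₁ ∼-refl)

      foldedOrbits : Transversal Folded _≈_
      foldedOrbits = transversal folded? _≈?_ (inj₁ ∼-refl)

      private
        module U = Transversal unfoldedOrbits
        module F = Transversal foldedOrbits

      branch-injective : ∀ s t g → ¬ Folded g → branch s g ∼ branch t g → s ≡ t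
      branch-injective true  true  g p e = refl
      branch-injective false false g p e = refl
      branch-injective true  false g p e = ⊥-elim (p e)
      branch-injective false true  g p e = ⊥-elim (p (∼-sym e))

      orbits-bound : U.count * (2 * m) + F.count * m ≤ d
      orbits-bound =
        injection⇒≤ ((Fin↔ ×-count Bool↔Fin2 ×-count Fin↔) ⊎-count (Fin↔ ×-count Fin↔)) Fin↔ point
        λ {a} {b} → point-inj a b
        where
        point : (Fin U.count × Bool × Fin m) ⊎ (Fin F.count × Fin m) → Fin d
        point (inj₁ (i , s , j)) = branch s (U.rep i) ^ toℕ j
        point (inj₂ (i , j))     = F.rep i ^ toℕ j

        base : (Fin U.count × Bool × Fin m) ⊎ (Fin F.count × Fin m) → Fin d
        base (inj₁ (i , _)) = U.rep i
        base (inj₂ (i , _)) = F.rep i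

        base≈ : ∀ a → base a ≈ point a
        base≈ (inj₁ (i , s , j)) = ≈-branch s (j , refl)
        base≈ (inj₂ (i , j))     = inj₁ (j , refl)

        related : ∀ a b → point a ≡ point b → base a ≈ base b
        related a b e = ≈-trans (base≈ a) (≈-trans (inj₁ (∼-reflexive e)) (≈-sym (base≈ b)))

        point-inj : ∀ a b → point a ≡ point b → a ≡ b
        point-inj a@(inj₁ (i , s , j)) b@(inj₁ (i′ , s′ , j′)) e
          with refl ← U.separated {i} {i′} (related a b e) (related b a (≡.sym e))
          with refl ← branch-injective s s′ (U.rep i) (U.rep∈ i) (∼-trans (j , e) (∼-sym (j′ , refl))) =
          cong (λ t → inj₁ (i , s , t)) (^-injectiveᶠ (branch s (U.rep i)) e)
        point-inj a@(inj₂ (i , j)) b@(inj₂ (i′ , j′)) e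
          with refl ← F.separated {i} {i′} (related a b e) (related b a (≡.sym e)) =
          cong (λ t → inj₂ (i , t)) (^-injectiveᶠ (F.rep i) e)
        point-inj a@(inj₁ (i , _)) b@(inj₂ (i′ , _)) e =
          ⊥-elim (U.rep∈ i (Folded-resp (related b a (≡.sym e)) (F.rep∈ i′)))
        point-inj a@(inj₂ (i′ , _)) b@(inj₁ (i , _)) e =
          ⊥-elim (U.rep∈ i (Folded-resp (related a b e) (F.rep∈ i′)))

    module Reversing (τ : Fin d → Fin d) (τ² : ∀ g → τ (τ g) ≡ g)
                     (reverse : ∀ g → π (τ (π g)) ≡ τ g) where

      open Dihedral τ τ² (λ g → ∼-sym (^⇒∼ 1 (reverse g))) public

      private
        module O = Transversal foldedOrbits
        module F = Transversal (fixedPoints τ)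
        module F′ = Transversal (fixedPoints (τ ∘ π))

        reverse-^ : ∀ k g → τ (g ^ k) ^ k ≡ τ g
        reverse-^ zero    g = refl
        reverse-^ (suc k) g = ≡.trans (iterate-sucʳ π k _)
          (≡.trans (cong π (reverse-^ k (π g))) (reverse g))

        fixed-even : ∀ i {c} g → g ^ c ≡ τ g → c ≡ i + i → Fixed τ (g ^ i)
        fixed-even i g e refl =
          ^-injectiveˡ i (≡.trans (reverse-^ i g) (≡.trans (≡.sym e) (iterate-+ π i i g)))

        fixed-odd : ∀ i {c} g → g ^ c ≡ τ g → c ≡ suc (i + i) → Fixed (τ ∘ π) (g ^ i)
        fixed-odd i g e refl = ^-injectiveˡ (suc i)
          (≡.trans (cong (λ h → τ h ^ suc i) (≡.sym (iterate-sucʳ π i g)))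
          (≡.trans (reverse-^ (suc i) g) (≡.trans (≡.sym e)
          (≡.trans (cong (g ^_) (≡.sym (ℕₚ.+-suc i i))) (iterate-+ π i (suc i) g)))))

      -- On a folded orbit τ g = g ^ c has two solutions c below 2m; according to
      -- the parity of c, the point half way between g and g ^ c is fixed by τ or
      -- by τ ∘ π.
      foldedOrbits-bound : O.count * 2 ≤ F.count + F′.count
      foldedOrbits-bound = injection⇒≤ (Fin↔ ×-count Bool↔Fin2) (Fin↔ ⊎-count Fin↔)
        middle λ {a} {b} → middle-inj a b
        where
        exponent : Fin O.count × Bool → ℕ
        exponent (i , true)  = toℕ (proj₁ (O.rep∈ i))
        exponent (i , false) = toℕ (proj₁ (O.rep∈ i)) + m

        exponent-folds : ∀ p → O.rep (proj₁ p) ^ exponent p ≡ τ (O.rep (proj₁ p))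
        exponent-folds (i , true)  = proj₂ (O.rep∈ i)
        exponent-folds (i , false) =
          ≡.trans (iterate-+ π (toℕ (proj₁ (O.rep∈ i))) m _) (≡.trans (π^m _) (proj₂ (O.rep∈ i)))

        exponent< : ∀ p → exponent p < m + m
        exponent< (i , true)  = ℕₚ.<-≤-trans (toℕ<n (proj₁ (O.rep∈ i))) (ℕₚ.m≤m+n m m)
        exponent< (i , false) = ℕₚ.+-monoˡ-< m (toℕ<n (proj₁ (O.rep∈ i)))

        exponent-injective : ∀ i s t → exponent (i , s) ≡ exponent (i , t) → s ≡ t
        exponent-injective i true  true  e = refl
        exponent-injective i false false e = refl
        exponent-injective i true  false e =
          ⊥-elim (ℕₚ.<⇒≱ (toℕ<n (proj₁ (O.rep∈ i))) (ℕₚ.≤-trans (ℕₚ.m≤n+m m _) (ℕₚ.≤-reflexive (≡.sym e))))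
        exponent-injective i false true  e =
          ⊥-elim (ℕₚ.<⇒≱ (toℕ<n (proj₁ (O.rep∈ i))) (ℕₚ.≤-trans (ℕₚ.m≤n+m m _) (ℕₚ.≤-reflexive e)))

        half : Fin O.count × Bool → ℕ
        half p = proj₁ (halve (exponent p))

        half< : ∀ p → half p < m
        half< p with halve (exponent p) | exponent< p
        ... | i , inj₁ e | lt = ℕₚ.≰⇒> λ m≤i → ℕₚ.<⇒≱ lt (ℕₚ.≤-trans (ℕₚ.+-mono-≤ m≤i m≤i) (ℕₚ.≤-reflexive (≡.sym e)))
        ... | i , inj₂ e | lt = ℕₚ.≰⇒> λ m≤i → ℕₚ.<⇒≱ lt
          (ℕₚ.≤-trans (ℕₚ.+-mono-≤ m≤i m≤i) (ℕₚ.≤-trans (ℕₚ.n≤1+n _) (ℕₚ.≤-reflexive (≡.sym e))))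

        point : Fin O.count × Bool → Fin d
        point p = O.rep (proj₁ p) ^ half p

        fixedPoint : Fin F.count ⊎ Fin F′.count → Fin d
        fixedPoint (inj₁ i) = F.rep i
        fixedPoint (inj₂ i) = F′.rep i

        odd : ∀ {A B : Set} → A ⊎ B → Bool
        odd (inj₁ _) = false
        odd (inj₂ _) = true

        middle : Fin O.count × Bool → Fin F.count ⊎ Fin F′.count
        middle p with halve (exponent p)
        ... | i , inj₁ e = inj₁ (proj₁ (F.covers (O.rep (proj₁ p) ^ i) (fixed-even i _ (exponent-folds p) e)))
        ... | i , inj₂ e = inj₂ (proj₁ (F′.covers (O.rep (proj₁ p) ^ i) (fixed-odd i _ (exponent-folds p) e)))

        middle-point : ∀ p → fixedPoint (middle p) ≡ point p
        middle-point p with halve (exponent p)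
        ... | i , inj₁ e = proj₂ (F.covers (O.rep (proj₁ p) ^ i) (fixed-even i _ (exponent-folds p) e))
        ... | i , inj₂ e = proj₂ (F′.covers (O.rep (proj₁ p) ^ i) (fixed-odd i _ (exponent-folds p) e))

        double : Bool → ℕ → ℕ
        double false i = i + i
        double true  i = suc (i + i)

        exponent-double : ∀ p → exponent p ≡ double (odd (middle p)) (half p)
        exponent-double p with halve (exponent p)
        ... | i , inj₁ e = e
        ... | i , inj₂ e = e

        same : ∀ p r → middle p ≡ middle r → point p ≡ point r
        same p r e = ≡.trans (≡.sym (middle-point p)) (≡.trans (cong fixedPoint e) (middle-point r))

        related : ∀ p r → middle p ≡ middle r → O.rep (proj₁ p) ≈ O.rep (proj₁ r)
        related p r e = inj₁ (∼-trans (^⇒∼ (half p) (same p r e)) (∼-sym (^⇒∼ (half r) refl)))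

        middle-inj : ∀ p r → middle p ≡ middle r → p ≡ r
        middle-inj p@(i , s) r@(j , t) e
          with refl ← O.separated {i} {j} (related p r e) (≈-sym (related p r e)) =
          cong (i ,_) (exponent-injective i s t (≡.trans (exponent-double p)
            (≡.trans (cong₂ double (cong odd e) (^-injectiveʳ (O.rep i) (half< p) (half< r) (same p r e)))
                     (≡.sym (exponent-double r)))))

  fixedPoints-≤ : ∀ {d} (σ τ f : Fin d → Fin d) → (∀ {g h} → f g ≡ f h → g ≡ h) →
                  (∀ g → Fixed σ g → Fixed τ (f g)) →
                  Transversal.count (fixedPoints σ) ≤ Transversal.count (fixedPoints τ)
  fixedPoints-≤ σ τ f f-inj maps = injection⇒≤ Fin↔ Fin↔ target λ {i} {j} e →
    let r = f-inj (≡.trans (≡.sym (target-point i)) (≡.trans (cong T.rep e) (target-point j)))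
    in S.separated r (≡.sym r)
    where
    module S = Transversal (fixedPoints σ)
    module T = Transversal (fixedPoints τ)
    target : Fin S.count → Fin T.count
    target i = proj₁ (T.covers (f (S.rep i)) (maps _ (S.rep∈ i)))
    target-point : ∀ i → T.rep (target i) ≡ f (S.rep i)
    target-point i = proj₂ (T.covers (f (S.rep i)) (maps _ (S.rep∈ i)))

module Cocycles where

  open import Data.Fin.Base using (Fin)
  open import Data.Integer.Base using (0ℤ; 1ℤ)
  open import Data.List.Base using (List; []; _∷_)
  open import Data.List.Membership.Propositional using (_∈_)
  open import Data.List.Relation.Unary.Any using (here)
  open import Data.Nat.Base using (ℕ; zero; suc)
  open import Data.Vec.Base using ([]; _∷_)
  open import Relation.Binary.PropositionalEquality as ≡ using (_≡_; cong)
  import Relation.Binary.Reasoning.Setoid as SetoidReasoning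

  open import Defs
  open PresentedGroups
  open TriangleGroups
  open FiniteQuotients
  open Residues using (ModularRing)
  open Orbits using (iterate)

  module Action {l m n : ℕ} (Q : FiniteQuotient l m n) (S : Section l m n Q) where
    open FiniteQuotient Q
    open Section S

    infix 4 _≈_
    _≈_ : Word Rotation → Word Rotation → Set
    _≈_ = Equal (relators l m n)

    G : Set
    G = Fin size

    infixl 6 _·_
    _·_ : G → Word Rotation → G
    g · w = coset (rep g ∙ w)

    𝟙 : G
    𝟙 = coset ε

    coset-· : ∀ u w → coset u · w ≡ coset (u ∙ w)
    coset-· u w = ∙-resp (coset-rep (coset u)) ≡.refl

    𝟙· : ∀ w → 𝟙 · w ≡ coset w
    𝟙· w = ≡.trans (coset-· ε w) (resp (identityˡ w))

    ·-∙ : ∀ g u v → g · (u ∙ v) ≡ g · u · v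
    ·-∙ g u v = ≡.trans (resp (sym (assoc (rep g) u v))) (≡.sym (coset-· (rep g ∙ u) v))

    ·-resp : ∀ g {u v} → u ≈ v → g · u ≡ g · v
    ·-resp g e = resp (∙-cong refl e)

    ·-ε : ∀ g → g · ε ≡ g
    ·-ε g = ≡.trans (resp (identityʳ (rep g))) (coset-rep g)

    ·-trivial : ∀ g {w} → w ≈ ε → g · w ≡ g
    ·-trivial g e = ≡.trans (·-resp g e) (·-ε g)

    ·-inverseʳ : ∀ g w → g · w · w ⁻¹ ≡ g
    ·-inverseʳ g w = ≡.trans (≡.sym (·-∙ g w (w ⁻¹))) (·-trivial g (inverseʳ w))

    ·-Ker : ∀ g {w} → Ker w → g · w ≡ g
    ·-Ker g k = ≡.trans (∙-resp ≡.refl k) (≡.trans (resp (identityʳ (rep g))) (coset-rep g))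

    rotate : Rotation → G → G
    rotate a g = g · gen a

    iterate-rotate : ∀ a k g → iterate (rotate a) k g ≡ g · gen a ^ k
    iterate-rotate a zero    g = ≡.sym (·-ε g)
    iterate-rotate a (suc k) g =
      ≡.trans (iterate-rotate a k (g · gen a)) (≡.sym (·-∙ g (gen a) (gen a ^ k)))

    module Modular {q : ℕ} (R : ModularRing q) where
      open ModularRing R
      open RingSolver using (_:=_; _:+_; _:*_; _:-_; :-_; con) renaming (solve to ring)
      open SetoidReasoning setoid

      record Multiplier : Set where
        field
          scale      : G → Word Rotation → Carrier
          scale-resp : ∀ g {u v} → u ≈ v → scale g u ≋ scale g v
          scale-ε    : ∀ g → scale g ε ≋ 1#
          scale-∙    : ∀ g u v → scale g (u ∙ v) ≋ scale g u * scale (g · u) v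

        scale-trivial : ∀ g {w} → w ≈ ε → scale g w ≋ 1#
        scale-trivial g e = ≋-trans (scale-resp g e) (scale-ε g)

        scale-inverse : ∀ g w → scale g w * scale (g · w) (w ⁻¹) ≋ 1#
        scale-inverse g w = ≋-trans (≋-sym (scale-∙ g w (w ⁻¹))) (scale-trivial g (inverseʳ w))

        scale-cancel : ∀ g w {t} → scale g w * t ≋ 0# → t ≋ 0#
        scale-cancel g w {t} e = begin
          t                                      ≈⟨ *-identityˡ t ⟨
          1# * t                                ≈⟨ *-cong (scale-inverse g w) ≋-refl ⟨
          scale g w * scale (g · w) (w ⁻¹) * t   ≈⟨ ring 3 (λ a b t → a :* b :* t := b :* (a :* t)) ≋-refl _ _ t ⟩
          scale (g · w) (w ⁻¹) * (scale g w * t) ≈⟨ *-cong ≋-refl e ⟩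
          scale (g · w) (w ⁻¹) * 0#             ≈⟨ zeroʳ _ ⟩
          0#                                    ∎

      unscaled : Multiplier
      unscaled = record
        { scale      = λ _ _ → 1#
        ; scale-resp = λ _ _ → ≋-refl
        ; scale-ε    = λ _ → ≋-refl
        ; scale-∙    = λ _ _ _ → ≋-sym (*-identityʳ 1#)
        }

      module _ (M : Multiplier) where
        open Multiplier M

        -- The cocycle law, without any compatibility with relators: such a u is
        -- a crossed homomorphism on the free group.
        record Crossed (u : G → Word Rotation → Carrier) : Set where
          field
            law-ε  : ∀ g → u g ε ≋ 0#
            law-∙  : ∀ g v w → u g (v ∙ w) ≋ u g v + scale g v * u (g · v) w
            law-⁻¹ : ∀ g w → u g (w ⁻¹) ≋ - (scale g (w ⁻¹) * u (g · w ⁻¹) w)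

          crossed-resp : ∀ {R} → (∀ {r} → r ∈ R → r ≈ ε) → (∀ g {r} → r ∈ R → u g r ≋ 0#) →
                         ∀ g {v w} → Equal R v w → u g v ≋ u g w
          crossed-resp {R} R⊆ kill = go
            where
            widen : ∀ {v w} → Equal R v w → v ≈ w
            widen = Equal-mono R⊆

            move : ∀ {g h} w → g ≡ h → u g w ≋ u h w
            move w ≡.refl = ≋-refl

            go : ∀ g {v w} → Equal R v w → u g v ≋ u g w
            go g refl = ≋-refl
            go g (sym e) = ≋-sym (go g e)
            go g (trans e f) = ≋-trans (go g e) (go g f)
            go g (∙-cong {v} {v′} {w} {w′} e f) = begin
              u g (v ∙ w)                          ≈⟨ law-∙ g v w ⟩
              u g v + scale g v * u (g · v) w      ≈⟨ +-cong (go g e) (*-cong (scale-resp g (widen e))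
                                                       (≋-trans (move w (·-resp g (widen e))) (go (g · v′) f))) ⟩
              u g v′ + scale g v′ * u (g · v′) w′  ≈⟨ law-∙ g v′ w′ ⟨
              u g (v′ ∙ w′)                        ∎
            go g (⁻¹-cong {v} {w} e) = begin
              u g (v ⁻¹)                               ≈⟨ law-⁻¹ g v ⟩
              - (scale g (v ⁻¹) * u (g · v ⁻¹) v)      ≈⟨ -‿cong (*-cong (scale-resp g (⁻¹-cong (widen e)))
                                                           (≋-trans (move v (·-resp g (⁻¹-cong (widen e)))) (go _ e))) ⟩
              - (scale g (w ⁻¹) * u (g · w ⁻¹) w)      ≈⟨ law-⁻¹ g w ⟨
              u g (w ⁻¹)                               ∎
            go g (assoc a b c) = begin
              u g (a ∙ b ∙ c)
                ≈⟨ law-∙ g (a ∙ b) c ⟩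
              u g (a ∙ b) + scale g (a ∙ b) * u (g · (a ∙ b)) c
                ≈⟨ +-cong (law-∙ g a b) (*-cong (scale-∙ g a b) (move c (·-∙ g a b))) ⟩
              u g a + scale g a * u (g · a) b + scale g a * scale (g · a) b * u (g · a · b) c
                ≈⟨ ring 5 (λ a s b t c → a :+ s :* b :+ s :* t :* c := a :+ s :* (b :+ t :* c)) ≋-refl _ _ _ _ _ ⟩
              u g a + scale g a * (u (g · a) b + scale (g · a) b * u (g · a · b) c)
                ≈⟨ +-cong (≋-refl {x = u g a}) (*-cong (≋-refl {x = scale g a}) (law-∙ (g · a) b c)) ⟨
              u g a + scale g a * u (g · a) (b ∙ c)
                ≈⟨ law-∙ g a (b ∙ c) ⟨
              u g (a ∙ (b ∙ c)) ∎
            go g (identityˡ w) = begin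
              u g (ε ∙ w)                      ≈⟨ law-∙ g ε w ⟩
              u g ε + scale g ε * u (g · ε) w  ≈⟨ +-cong (law-ε g) (*-cong (scale-ε g) (move w (·-ε g))) ⟩
              0# + 1# * u g w                ≈⟨ ring 1 (λ a → con 0ℤ :+ con 1ℤ :* a := a) ≋-refl (u g w) ⟩
              u g w                            ∎
            go g (identityʳ w) = begin
              u g (w ∙ ε)                      ≈⟨ law-∙ g w ε ⟩
              u g w + scale g w * u (g · w) ε  ≈⟨ +-cong (≋-refl {x = u g w}) (*-cong (≋-refl {x = scale g w}) (law-ε (g · w))) ⟩
              u g w + scale g w * 0#          ≈⟨ ring 2 (λ a b → a :+ b :* con 0ℤ := a) ≋-refl _ (scale g w) ⟩
              u g w                            ∎
            go g (inverseˡ w) = begin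
              u g (w ⁻¹ ∙ w)
                ≈⟨ law-∙ g (w ⁻¹) w ⟩
              u g (w ⁻¹) + scale g (w ⁻¹) * u (g · w ⁻¹) w
                ≈⟨ +-cong (law-⁻¹ g w) ≋-refl ⟩
              - (scale g (w ⁻¹) * u (g · w ⁻¹) w) + scale g (w ⁻¹) * u (g · w ⁻¹) w
                ≈⟨ -‿inverseˡ _ ⟩
              0#
                ≈⟨ law-ε g ⟨
              u g ε ∎
            go g (inverseʳ w) = begin
              u g (w ∙ w ⁻¹)
                ≈⟨ law-∙ g w (w ⁻¹) ⟩
              u g w + scale g w * u (g · w) (w ⁻¹)
                ≈⟨ +-cong (≋-refl {x = u g w}) (*-cong (≋-refl {x = scale g w})
                     (≋-trans (law-⁻¹ (g · w) w) (-‿cong (*-cong ≋-refl (move w (·-inverseʳ g w)))))) ⟩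
              u g w + scale g w * - (scale (g · w) (w ⁻¹) * u g w)
                ≈⟨ ring 3 (λ a s t → a :+ s :* :- (t :* a) := a :+ :- (s :* t :* a)) ≋-refl (u g w) _ _ ⟩
              u g w + - (scale g w * scale (g · w) (w ⁻¹) * u g w)
                ≈⟨ +-cong (≋-refl {x = u g w}) (-‿cong (*-cong (scale-inverse g w) ≋-refl)) ⟩
              u g w + - (1# * u g w)
                ≈⟨ ring 1 (λ a → a :+ :- (con 1ℤ :* a) := con 0ℤ) ≋-refl (u g w) ⟩
              0#
                ≈⟨ law-ε g ⟨
              u g ε ∎
            go g (relator r∈) = ≋-trans (kill g r∈) (≋-sym (law-ε g))

        record Cocycle : Set where
          field
            value      : G → Word Rotation → Carrier
            value-resp : ∀ g {v w} → v ≈ w → value g v ≋ value g w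
            crossed    : Crossed value
          open Crossed crossed public

          value-trivial : ∀ g {w} → w ≈ ε → value g w ≋ 0#
          value-trivial g e = ≋-trans (value-resp g e) (law-ε g)

          move : ∀ {g h} w → g ≡ h → value g w ≋ value h w
          move w ≡.refl = ≋-refl

        extend : (Rotation → G → Carrier) → G → Word Rotation → Carrier
        extend e g (gen a) = e a g
        extend e g ε       = 0#
        extend e g (v ∙ w) = extend e g v + scale g v * extend e (g · v) w
        extend e g (w ⁻¹)  = - (scale g (w ⁻¹) * extend e (g · w ⁻¹) w)

        extend-crossed : ∀ e → Crossed (extend e)
        extend-crossed e = record
          { law-ε = λ _ → ≋-refl ; law-∙ = λ _ _ _ → ≋-refl ; law-⁻¹ = λ _ _ → ≋-refl }

        extend-minus : ∀ {e e₁ e₂} → (∀ a g → e a g ≋ e₁ a g - e₂ a g) →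
                       ∀ g w → extend e g w ≋ extend e₁ g w - extend e₂ g w
        extend-minus E g (gen a) = E a g
        extend-minus E g ε       = ≋-sym (-‿inverseʳ 0#)
        extend-minus E g (v ∙ w) = ≋-trans
          (+-cong (extend-minus E g v) (*-cong ≋-refl (extend-minus E (g · v) w)))
          (ring 5 (λ a b s c d → a :- b :+ s :* (c :- d) := a :+ s :* c :- (b :+ s :* d)) ≋-refl _ _ _ _ _)
        extend-minus E g (w ⁻¹)  = ≋-trans
          (-‿cong (*-cong ≋-refl (extend-minus E (g · w ⁻¹) w)))
          (ring 3 (λ s a b → :- (s :* (a :- b)) := :- (s :* a) :- :- (s :* b)) ≋-refl _ _ _)

        -- The values at x are forced by the relator x y z.
        generators : (G → Carrier) → (G → Carrier) → Rotation → G → Carrier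
        generators b c ξ g = - (scale g x * b (g · x) + scale g (x ∙ y) * c (g · (x ∙ y)))
        generators b c η   = b
        generators b c ζ   = c

        extend-product : ∀ b c g → extend (generators b c) g (x ∙ y ∙ z) ≋ 0#
        extend-product b c g = ring 2 (λ s t → :- (s :+ t) :+ s :+ t := con 0ℤ) ≋-refl _ _

        generators-minus : ∀ {b b₁ b₂ c c₁ c₂} → (∀ g → b g ≋ b₁ g - b₂ g) → (∀ g → c g ≋ c₁ g - c₂ g) →
          ∀ a g → generators b c a g ≋ generators b₁ c₁ a g - generators b₂ c₂ a g
        generators-minus B C ξ g = ≋-trans
          (-‿cong (+-cong (*-cong ≋-refl (B (g · x))) (*-cong ≋-refl (C (g · (x ∙ y))))))
          (ring 6 (λ s a b t c d → :- (s :* (a :- b) :+ t :* (c :- d)) :=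
                                   :- (s :* a :+ t :* c) :- :- (s :* b :+ t :* d)) ≋-refl _ _ _ _ _ _)
        generators-minus B C η g = B g
        generators-minus B C ζ g = C g

        productRelator : List (Word Rotation)
        productRelator = x ∙ y ∙ z ∷ []

        product-valid : ∀ {r} → r ∈ productRelator → r ≈ ε
        product-valid (here ≡.refl) = relator (xyz∈relators l m n)

        module _ {u : G → Word Rotation → Carrier} (crossed : Crossed u)
                 (u-product : ∀ g → u g (x ∙ y ∙ z) ≋ 0#) where
          open Crossed crossed

          product-resp : ∀ g {v w} → Equal productRelator v w → u g v ≋ u g w
          product-resp = crossed-resp product-valid λ { g (here ≡.refl) → u-product g }

          cocycle : (∀ a g → u g (gen a ^ order l m n a) ≋ 0#) → Cocycle
          cocycle kill = record { value = u ; value-resp = u-resp ; crossed = crossed }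
            where
            kill-relator : ∀ {r} → Relator l m n r → ∀ g → u g r ≋ 0#
            kill-relator (power a) g = kill a g
            kill-relator product   g = u-product g
            u-resp : ∀ g {v w} → v ≈ w → u g v ≋ u g w
            u-resp = crossed-resp relator λ g r∈ → kill-relator (relators-view l m n r∈) g

          power-shift : ∀ a j g → u g (gen a ^ order l m n a) ≋ 0# →
                        u (g · gen a ^ j) (gen a ^ order l m n a) ≋ 0#
          power-shift a j g e = scale-cancel g aʲ (+-cancelˡ (u g aʲ) (begin
            u g aʲ + scale g aʲ * u (g · aʲ) aᵏ  ≈⟨ law-∙ g aʲ aᵏ ⟨
            u g (aʲ ∙ aᵏ)                        ≈⟨ product-resp g (^-comm (gen a) j k) ⟩
            u g (aᵏ ∙ aʲ)                        ≈⟨ law-∙ g aᵏ aʲ ⟩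
            u g aᵏ + scale g aᵏ * u (g · aᵏ) aʲ  ≈⟨ +-cong e (*-cong (scale-trivial g (power-relator l m n a))
                                                       (≋-reflexive (cong (λ h → u h aʲ) (·-trivial g (power-relator l m n a))))) ⟩
            0# + 1# * u g aʲ                   ≈⟨ ring 1 (λ a → con 0ℤ :+ con 1ℤ :* a := a :+ con 0ℤ) ≋-refl (u g aʲ) ⟩
            u g aʲ + 0#                         ∎))
            where
            k : ℕ
            k = order l m n a
            aʲ aᵏ : Word Rotation
            aʲ = gen a ^ j
            aᵏ = gen a ^ k

module Antisymmetric where

  open import Data.Bool.Base using (Bool; true; false)
  open import Data.Empty using (⊥-elim)
  open import Data.Fin.Base using (Fin)
  open import Data.Fin.Patterns using (0F; 1F)
  open import Data.Fin.Properties using (_≟_; any?; ¬∀⟶∃¬)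
  open import Data.Integer.Base using (1ℤ)
  open import Data.List.Relation.Unary.Any using (here)
  open import Data.Nat.Base as ℕ using (ℕ; _<_)
  open import Data.Product.Base using (∃; _×_; _,_; proj₁; proj₂)
  open import Data.Sum.Base using (_⊎_; inj₁; inj₂)
  open import Data.Vec.Base using (lookup; []; _∷_)
  open import Function.Bundles using (Equivalence)
  open import Relation.Binary.PropositionalEquality as ≡ using (_≡_; _≢_; cong)
  open import Relation.Nullary using (¬_; yes; no)
  import Relation.Binary.Reasoning.Setoid as SetoidReasoning

  open import Defs
  open PresentedGroups
  open TriangleGroups
  open FiniteQuotients
  open Residues
  open Orbits using (Transversal; module Involution; _⊎-count_; Fin↔)
  open Cocycles

  record RegularQuotient (l m n : ℕ) : Set where
    field
      quotient   : FiniteQuotient l m n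
      section    : Section l m n quotient
    open FiniteQuotient quotient public
    open Section section public
    field
      mirror-Ker  : ∀ {w} → Ker w → Ker (mirror w)
      order-exact : ∀ a j → 0 < j → j < order l m n a → ¬ Ker (gen a ^ j)
      order-pos   : ∀ a → 0 < order l m n a
    open Action quotient section public

    mirrorIf-Ker : ∀ b {w} → Ker w → Ker (mirrorIf {l} {m} {n} b w)
    mirrorIf-Ker true  = mirror-Ker
    mirrorIf-Ker false k = k

  module _ {l m n : ℕ} (RQ : RegularQuotient l m n) {q : ℕ} (R : ModularRing q) where
    open RegularQuotient RQ
    open ModularRing R
    open RingSolver using (_:=_; _:+_; _:*_; _:-_; :-_; con) renaming (solve to ring)
    open Modular R

    zero-or-not : ∀ {k} (f : Fin k → Carrier) → (∃ λ i → f i ≋̸ 0#) ⊎ (∀ i → f i ≋ 0#)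
    zero-or-not {k} f with Data.Fin.Properties.all? (λ i → f i ≋? 0#)
    ... | yes all = inj₂ all
    ... | no ¬all = inj₁ (¬∀⟶∃¬ k _ (λ i → f i ≋? 0#) ¬all)

    -- τ is left multiplication by w₀ if b is false, and the action of the odd
    -- element w₀ r₀ of Δ* if b is true.
    module Antisymmetrise (b : Bool) (w₀ : Word Rotation)
                          (w₀-involutive : RegularQuotient.Ker RQ (w₀ ∙ mirrorIf {l} {m} {n} b w₀))
                          (two-regular : ∀ t → t + t ≋ 0# → t ≋ 0#) where

      σ : Word Rotation → Word Rotation
      σ = mirrorIf {l} {m} {n} b

      σ-∙ : ∀ u v → σ (u ∙ v) ≡ σ u ∙ σ v
      σ-∙ = mirrorIf-∙ {l} {m} {n} b

      σ-⁻¹ : ∀ w → σ (w ⁻¹) ≡ σ w ⁻¹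
      σ-⁻¹ = mirrorIf-⁻¹ {l} {m} {n} b

      σ-ε : σ ε ≡ ε
      σ-ε = mirrorIf-ε {l} {m} {n} b

      σ-involutive : ∀ {S} w → Equal S (σ (σ w)) w
      σ-involutive = mirrorIf-involutive {l} {m} {n} b

      coset-σ : ∀ {u v} → coset u ≡ coset v → coset (σ u) ≡ coset (σ v)
      coset-σ {u} {v} e = Equivalence.from (Ker⇔ (σ u) (σ v))
        (Ker-resp (≡⇒≈ (≡.trans (σ-∙ (u ⁻¹) v) (cong (_∙ σ v) (σ-⁻¹ u))))
          (mirrorIf-Ker b (Equivalence.to (Ker⇔ u v) e)))
        where
        ≡⇒≈ : ∀ {u v} → u ≡ v → u ≈ v
        ≡⇒≈ ≡.refl = refl

      τ : G → G
      τ g = coset (w₀ ∙ σ (rep g))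

      τ-coset : ∀ w → τ (coset w) ≡ coset (w₀ ∙ σ w)
      τ-coset w = ∙-resp ≡.refl (coset-σ (coset-rep (coset w)))

      τ-· : ∀ g w → τ (g · w) ≡ τ g · σ w
      τ-· g w = begin
        τ (g · w)                      ≡⟨ τ-coset (rep g ∙ w) ⟩
        coset (w₀ ∙ σ (rep g ∙ w))     ≡⟨ cong (λ u → coset (w₀ ∙ u)) (σ-∙ (rep g) w) ⟩
        coset (w₀ ∙ (σ (rep g) ∙ σ w)) ≡⟨ resp (sym (assoc _ _ _)) ⟩
        coset (w₀ ∙ σ (rep g) ∙ σ w)   ≡⟨ coset-· (w₀ ∙ σ (rep g)) (σ w) ⟨
        τ g · σ w                      ∎
        where open ≡.≡-Reasoning

      τ² : ∀ g → τ (τ g) ≡ g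
      τ² g = begin
        τ (τ g)                            ≡⟨ τ-coset (w₀ ∙ σ (rep g)) ⟩
        coset (w₀ ∙ σ (w₀ ∙ σ (rep g)))    ≡⟨ cong (λ u → coset (w₀ ∙ u)) (σ-∙ w₀ (σ (rep g))) ⟩
        coset (w₀ ∙ (σ w₀ ∙ σ (σ (rep g)))) ≡⟨ resp (trans (sym (assoc _ _ _)) (∙-cong refl (σ-involutive (rep g)))) ⟩
        coset (w₀ ∙ σ w₀ ∙ rep g)          ≡⟨ ∙-resp w₀-involutive ≡.refl ⟩
        coset (ε ∙ rep g)                  ≡⟨ resp (identityˡ _) ⟩
        coset (rep g)                      ≡⟨ coset-rep g ⟩
        g                                  ∎
        where open ≡.≡-Reasoning

      open SetoidReasoning setoid

      module Inv = Involution τ τ²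
      module Γ = Transversal Inv.properOrbits

      move : ∀ (u : G → Word Rotation → Carrier) {g h} w → g ≡ h → u g w ≋ u h w
      move u w ≡.refl = ≋-refl

      module _ {u : G → Word Rotation → Carrier} where

        unscaled-∙ : Crossed unscaled u → ∀ g v w → u g (v ∙ w) ≋ u g v + u (g · v) w
        unscaled-∙ C g v w = ≋-trans (Crossed.law-∙ C g v w) (+-cong ≋-refl (*-identityˡ _))

        unscaled-⁻¹ : Crossed unscaled u → ∀ g w → u g (w ⁻¹) ≋ - u (g · w ⁻¹) w
        unscaled-⁻¹ C g w = ≋-trans (Crossed.law-⁻¹ C g w) (-‿cong (*-identityˡ _))

      Antisymmetric : (G → Word Rotation → Carrier) → Set
      Antisymmetric u = ∀ g w → u (τ g) (σ w) ≋ - u g w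

      module _ (u : G → Word Rotation → Carrier) where

        antisymmetrised : G → Word Rotation → Carrier
        antisymmetrised g w = u g w - u (τ g) (σ w)

        module _ (C : Crossed unscaled u) (u-product : ∀ g → u g (x ∙ y ∙ z) ≋ 0#) where
          open Crossed C

          antisymmetrised-crossed : Crossed unscaled antisymmetrised
          antisymmetrised-crossed = record
            { law-ε = λ g → begin
                u g ε - u (τ g) (σ ε)  ≈⟨ +-cong (law-ε g) (-‿cong (≋-reflexive (cong (u (τ g)) σ-ε))) ⟩
                0# - u (τ g) ε         ≈⟨ +-cong ≋-refl (-‿cong (law-ε (τ g))) ⟩
                0# - 0#                ≈⟨ -‿inverseʳ 0# ⟩
                0#                     ∎
            ; law-∙ = λ g v w → begin
                u g (v ∙ w) - u (τ g) (σ (v ∙ w))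
                  ≈⟨ +-cong (law-∙ g v w) (-‿cong (≋-trans (≋-reflexive (cong (u (τ g)) (σ-∙ v w)))
                       (≋-trans (law-∙ (τ g) (σ v) (σ w)) (+-cong ≋-refl (*-cong ≋-refl (move u (σ w) (≡.sym (τ-· g v)))))))) ⟩
                u g v + 1# * u (g · v) w - (u (τ g) (σ v) + 1# * u (τ (g · v)) (σ w))
                  ≈⟨ ring 4 (λ a b c d → a :+ con 1ℤ :* b :- (c :+ con 1ℤ :* d) := a :- c :+ con 1ℤ :* (b :- d)) ≋-refl _ _ _ _ ⟩
                antisymmetrised g v + 1# * antisymmetrised (g · v) w ∎
            ; law-⁻¹ = λ g w → begin
                u g (w ⁻¹) - u (τ g) (σ (w ⁻¹))
                  ≈⟨ +-cong (law-⁻¹ g w) (-‿cong (≋-trans (≋-reflexive (cong (u (τ g)) (σ-⁻¹ w)))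
                       (≋-trans (law-⁻¹ (τ g) (σ w)) (-‿cong (*-cong ≋-refl (move u (σ w)
                         (≡.trans (cong (τ g ·_) (≡.sym (σ-⁻¹ w))) (≡.sym (τ-· g (w ⁻¹)))))))))) ⟩
                - (1# * u (g · w ⁻¹) w) - - (1# * u (τ (g · w ⁻¹)) (σ w))
                  ≈⟨ ring 2 (λ a b → :- (con 1ℤ :* a) :- :- (con 1ℤ :* b) := :- (con 1ℤ :* (a :- b))) ≋-refl _ _ ⟩
                - (1# * antisymmetrised (g · w ⁻¹) w) ∎
            }

          antisymmetrised-antisymmetric : Antisymmetric antisymmetrised
          antisymmetrised-antisymmetric g w = begin
            u (τ g) (σ w) - u (τ (τ g)) (σ (σ w))
              ≈⟨ +-cong ≋-refl (-‿cong (≋-trans (move u _ (τ² g)) (product-resp unscaled C u-product g (σ-involutive w)))) ⟩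
            u (τ g) (σ w) - u g w
              ≈⟨ ring 2 (λ a b → a :- b := :- (b :- a)) ≋-refl _ _ ⟩
            - (u g w - u (τ g) (σ w)) ∎

          antisymmetrised-product : ∀ g → antisymmetrised g (x ∙ y ∙ z) ≋ 0#
          antisymmetrised-product g = begin
            u g (x ∙ y ∙ z) - u (τ g) (σ (x ∙ y ∙ z))
              ≈⟨ +-cong (u-product g) (-‿cong (≋-trans (product-resp unscaled C u-product (τ g) σ-product) (law-ε (τ g)))) ⟩
            0# - 0#
              ≈⟨ -‿inverseʳ 0# ⟩
            0# ∎
            where
            σ-product : Equal (productRelator unscaled) (σ (x ∙ y ∙ z)) ε
            σ-product = mirrorIf-product {l} {m} {n} b (relator (here ≡.refl))

      minus-antisymmetrised : ∀ {u u₁ u₂} → (∀ g w → u g w ≋ u₁ g w - u₂ g w) →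
        ∀ g w → antisymmetrised u g w ≋ antisymmetrised u₁ g w - antisymmetrised u₂ g w
      minus-antisymmetrised E g w = ≋-trans (+-cong (E g w) (-‿cong (E (τ g) (σ w))))
        (ring 4 (λ a b c d → a :- b :- (c :- d) := a :- c :- (b :- d)) ≋-refl _ _ _ _)

      module _ {k} (point : Fin k → G) where

        supported : (Fin k → Carrier) → G → Carrier
        supported v g with any? (λ i → point i ≟ g)
        ... | yes (i , _) = v i
        ... | no  _       = 0#

        supported-minus : ∀ v w g → supported (λ i → v i - w i) g ≋ supported v g - supported w g
        supported-minus v w g with any? (λ i → point i ≟ g)
        ... | yes _ = ≋-refl
        ... | no  _ = ≋-sym (-‿inverseʳ 0#)

        supported-on : ∀ v i → (∀ {j} → point j ≡ point i → j ≡ i) → supported v (point i) ≡ v i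
        supported-on v i inj with any? (λ j → point j ≟ point i)
        ... | yes (j , e) = cong v (inj e)
        ... | no  none    = ⊥-elim (none (i , ≡.refl))

        supported-off : ∀ v g → (∀ i → ¬ point i ≡ g) → supported v g ≡ 0#
        supported-off v g off with any? (λ i → point i ≟ g)
        ... | yes (i , e) = ⊥-elim (off i e)
        ... | no  _       = ≡.refl

      module Gauged (K : Cocycle unscaled) (ũ-antisymmetric : Antisymmetric (Cocycle.value K))
                    (gauge : ∀ i → Cocycle.value K 𝟙 (rep (τ (Γ.rep i))) ≋ Cocycle.value K 𝟙 (rep (Γ.rep i))) where

        open Cocycle K renaming (value to ũ) hiding (move)

        private
          law : ∀ g v w → ũ g (v ∙ w) ≋ ũ g v + ũ (g · v) w
          law = unscaled-∙ crossed

          loop : Word Rotation → Word Rotation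
          loop w = w ∙ rep (coset w) ⁻¹

          loop∈Ker : ∀ w → Ker (loop w)
          loop∈Ker w = ≡.trans (∙-resp (≡.sym (coset-rep (coset w))) ≡.refl) (resp (inverseʳ _))

          loop-zero : ∀ w → ũ 𝟙 (loop w) ≋ 0# → ũ 𝟙 w ≋ ũ 𝟙 (rep (coset w))
          loop-zero w e = begin
            ũ 𝟙 w                                          ≈⟨ value-resp 𝟙 (solve (lookup (w ∷ rep (coset w) ∷ [])) (gen 0F) (gen 0F ∙ gen 1F ⁻¹ ∙ gen 1F) ≡.refl) ⟩
            ũ 𝟙 (loop w ∙ rep (coset w))                   ≈⟨ law 𝟙 (loop w) (rep (coset w)) ⟩
            ũ 𝟙 (loop w) + ũ (𝟙 · loop w) (rep (coset w))  ≈⟨ +-cong e (move ũ _ (·-Ker 𝟙 (loop∈Ker w))) ⟩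
            0# + ũ 𝟙 (rep (coset w))                       ≈⟨ +-identityˡ _ ⟩
            ũ 𝟙 (rep (coset w))                            ∎

          -- If ũ vanishes on Ker, then ũ 𝟙 w depends on coset w only, through
          -- a function H; the gauge equations and antisymmetry then force H = 0.
          module Vanishing (zero-ε : ũ 𝟙 (loop ε) ≋ 0#)
                           (zero-τ : ∀ g → ũ 𝟙 (loop (w₀ ∙ σ (rep g))) ≋ 0#) where

            H : G → Carrier
            H g = ũ 𝟙 (rep g)

            H-𝟙 : H 𝟙 ≋ 0#
            H-𝟙 = ≋-trans (≋-sym (loop-zero ε zero-ε)) (law-ε 𝟙)

            H-τ : ∀ g → H (τ g) ≋ ũ 𝟙 w₀ - H g
            H-τ g = begin
              ũ 𝟙 (rep (τ g))                  ≈⟨ loop-zero (w₀ ∙ σ (rep g)) (zero-τ g) ⟨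
              ũ 𝟙 (w₀ ∙ σ (rep g))             ≈⟨ law 𝟙 w₀ (σ (rep g)) ⟩
              ũ 𝟙 w₀ + ũ (𝟙 · w₀) (σ (rep g))  ≈⟨ +-cong ≋-refl (move ũ (σ (rep g)) 𝟙·w₀) ⟩
              ũ 𝟙 w₀ + ũ (τ 𝟙) (σ (rep g))     ≈⟨ +-cong ≋-refl (ũ-antisymmetric 𝟙 (rep g)) ⟩
              ũ 𝟙 w₀ - H g                     ∎
              where
              𝟙·w₀ : 𝟙 · w₀ ≡ τ 𝟙
              𝟙·w₀ = ≡.trans (𝟙· w₀) (≡.sym (≡.trans (τ-coset ε)
                (≡.trans (cong (λ u → coset (w₀ ∙ u)) σ-ε) (resp (identityʳ w₀)))))

            symmetric : ∀ g → H (τ g) ≋ H g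
            symmetric g with τ g ≟ g
            ... | yes e = ≋-reflexive (cong H e)
            ... | no ne with Γ.covers g ne
            ... | i , inj₁ ≡.refl = gauge i
            ... | i , inj₂ ≡.refl = ≋-trans (≋-reflexive (cong H (τ² _)))
                                      (≋-sym (gauge i))

            ũ-w₀ : ũ 𝟙 w₀ ≋ 0#
            ũ-w₀ = begin
              ũ 𝟙 w₀        ≈⟨ ring 2 (λ a h → a := a :- h :+ h) ≋-refl (ũ 𝟙 w₀) (H 𝟙) ⟩
              ũ 𝟙 w₀ - H 𝟙 + H 𝟙  ≈⟨ +-cong (≋-trans (≋-sym (H-τ 𝟙)) (≋-trans (symmetric 𝟙) H-𝟙)) H-𝟙 ⟩
              0# + 0#       ≈⟨ +-identityˡ 0# ⟩
              0#            ∎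

            H-zero : ∀ g → H g ≋ 0#
            H-zero g = two-regular (H g) (begin
              H g + H g             ≈⟨ +-cong (≋-sym (symmetric g)) ≋-refl ⟩
              H (τ g) + H g         ≈⟨ +-cong (H-τ g) ≋-refl ⟩
              ũ 𝟙 w₀ - H g + H g    ≈⟨ ring 2 (λ a h → a :- h :+ h := a) ≋-refl (ũ 𝟙 w₀) (H g) ⟩
              ũ 𝟙 w₀                ≈⟨ ũ-w₀ ⟩
              0#                    ∎)

            generator-zero : ∀ a g → ũ 𝟙 (loop (rep g ∙ gen a)) ≋ 0# → ũ g (gen a) ≋ 0#
            generator-zero a g e = begin
              ũ g (gen a)                          ≈⟨ +-identityˡ _ ⟨
              0# + ũ g (gen a)                     ≈⟨ +-cong (H-zero g) (move ũ (gen a) (≡.trans (𝟙· (rep g)) (coset-rep g))) ⟨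
              ũ 𝟙 (rep g) + ũ (𝟙 · rep g) (gen a)  ≈⟨ law 𝟙 (rep g) (gen a) ⟨
              ũ 𝟙 (rep g ∙ gen a)                  ≈⟨ loop-zero (rep g ∙ gen a) e ⟩
              H (g · gen a)                        ≈⟨ H-zero (g · gen a) ⟩
              0#                                   ∎

          nonzero : (∃ λ a → ∃ λ g → a ≢ ξ × ũ g (gen a) ≋̸ 0#) → ∃ λ w → Ker w × ũ 𝟙 w ≋̸ 0#
          nonzero (a , g , a≢ξ , ne) with ũ 𝟙 (loop ε) ≋? 0#
                     | zero-or-not (λ g → ũ 𝟙 (loop (w₀ ∙ σ (rep g))))
                     | zero-or-not (λ g → ũ 𝟙 (loop (rep g ∙ y)))
                     | zero-or-not (λ g → ũ 𝟙 (loop (rep g ∙ z)))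
          ... | no ne′ | _ | _ | _ = _ , loop∈Ker _ , ne′
          ... | _ | inj₁ (_ , ne′) | _ | _ = _ , loop∈Ker _ , ne′
          ... | _ | _ | inj₁ (_ , ne′) | _ = _ , loop∈Ker _ , ne′
          ... | _ | _ | _ | inj₁ (_ , ne′) = _ , loop∈Ker _ , ne′
          ... | yes e | inj₂ t | inj₂ s | inj₂ r = ⊥-elim (ne (Vanishing.generator-zero e t a g (zero-a a a≢ξ)))
            where
            zero-a : ∀ a → a ≢ ξ → ũ 𝟙 (loop (rep g ∙ gen a)) ≋ 0#
            zero-a ξ a≢ξ = ⊥-elim (a≢ξ ≡.refl)
            zero-a η a≢ξ = s g
            zero-a ζ a≢ξ = r g

          conjugate : ∀ {w} → Ker w → ũ 𝟙 (w₀ ∙ σ w ∙ w₀ ⁻¹) ≋ - ũ 𝟙 w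
          conjugate {w} k = begin
            ũ 𝟙 (w₀ ∙ σ w ∙ w₀ ⁻¹)
              ≈⟨ law 𝟙 (w₀ ∙ σ w) (w₀ ⁻¹) ⟩
            ũ 𝟙 (w₀ ∙ σ w) + ũ (𝟙 · (w₀ ∙ σ w)) (w₀ ⁻¹)
              ≈⟨ +-cong (law 𝟙 w₀ (σ w)) (move ũ _ (≡.trans (·-∙ 𝟙 w₀ (σ w)) (·-Ker _ (mirrorIf-Ker b k)))) ⟩
            ũ 𝟙 w₀ + ũ (𝟙 · w₀) (σ w) + ũ (𝟙 · w₀) (w₀ ⁻¹)
              ≈⟨ ring 3 (λ a t c → a :+ t :+ c := (a :+ c) :+ t) ≋-refl _ _ _ ⟩
            ũ 𝟙 w₀ + ũ (𝟙 · w₀) (w₀ ⁻¹) + ũ (𝟙 · w₀) (σ w)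
              ≈⟨ +-cong (≋-trans (≋-sym (law 𝟙 w₀ (w₀ ⁻¹))) (≋-trans (value-resp 𝟙 (inverseʳ w₀)) (law-ε 𝟙))) (move ũ (σ w) 𝟙·w₀) ⟩
            0# + ũ (τ 𝟙) (σ w)
              ≈⟨ +-identityˡ _ ⟩
            ũ (τ 𝟙) (σ w)
              ≈⟨ ũ-antisymmetric 𝟙 w ⟩
            - ũ 𝟙 w ∎
            where
            𝟙·w₀ : 𝟙 · w₀ ≡ τ 𝟙
            𝟙·w₀ = ≡.trans (𝟙· w₀) (≡.sym (≡.trans (τ-coset ε)
              (≡.trans (cong (λ u → coset (w₀ ∙ u)) σ-ε) (resp (identityʳ w₀)))))

        separates : (∃ λ a → ∃ λ g → a ≢ ξ × ũ g (gen a) ≋̸ 0#) →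
          ∃ λ w → Ker w × ũ 𝟙 w ≋̸ ũ 𝟙 (w₀ ∙ σ w ∙ w₀ ⁻¹)
        separates d with w , k , ne ← nonzero d = w , k , λ e → ne (two-regular _ (begin
          ũ 𝟙 w + ũ 𝟙 w     ≈⟨ +-cong ≋-refl (≋-trans e (conjugate k)) ⟩
          ũ 𝟙 w - ũ 𝟙 w     ≈⟨ -‿inverseʳ _ ⟩
          0#                ∎))

      -- The unknowns are values on edges. There is one equation for each polygon
      -- and, to exclude coboundaries, one for each orbit of τ that is not a point.
      record Counts : Set where
        field
          polygons : Rotation → ℕ
          polygon  : ∀ a → Fin (polygons a) → G
          spread   : ∀ a {u} → Crossed unscaled u → (∀ g → u g (x ∙ y ∙ z) ≋ 0#) → Antisymmetric u →
                     (∀ i → u (polygon a i) (gen a ^ order l m n a) ≋ 0#) →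
                     ∀ g → u g (gen a ^ order l m n a) ≋ 0#
          edgesʸ edgesᶻ : ℕ
          edgeʸ    : Fin edgesʸ → G
          edgeᶻ    : Fin edgesᶻ → G
          revealʸ  : ∀ v c i → antisymmetrised (extend unscaled (generators unscaled (supported edgeʸ v) c)) (edgeʸ i) y ≋ 0# → v i ≋ 0#
          revealᶻ  : ∀ v c i → antisymmetrised (extend unscaled (generators unscaled c (supported edgeᶻ v))) (edgeᶻ i) z ≋ 0# → v i ≋ 0#
          fewer    : polygons ξ ℕ.+ (polygons η ℕ.+ (polygons ζ ℕ.+ Γ.count)) < edgesʸ ℕ.+ edgesᶻ

      module _ (counts : Counts) where
        open Counts counts

        private
          A B : Set
          A = Fin edgesʸ ⊎ Fin edgesᶻ
          B = Fin (polygons ξ) ⊎ Fin (polygons η) ⊎ Fin (polygons ζ) ⊎ Fin Γ.count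

          atʸ atᶻ : (A → Carrier) → G → Carrier
          atʸ v = supported edgeʸ (λ i → v (inj₁ i))
          atᶻ v = supported edgeᶻ (λ i → v (inj₂ i))

          raw : (A → Carrier) → G → Word Rotation → Carrier
          raw v = extend unscaled (generators unscaled (atʸ v) (atᶻ v))

          u : (A → Carrier) → G → Word Rotation → Carrier
          u v = antisymmetrised (raw v)

          u-minus : ∀ v w g t → u (λ a → v a - w a) g t ≋ u v g t - u w g t
          u-minus v w = minus-antisymmetrised (extend-minus unscaled
            (generators-minus unscaled (supported-minus edgeʸ _ _) (supported-minus edgeᶻ _ _)))

          L : (A → Carrier) → B → Carrier
          L v (inj₁ i)               = u v (polygon ξ i) (x ^ l)
          L v (inj₂ (inj₁ i))        = u v (polygon η i) (y ^ m)
          L v (inj₂ (inj₂ (inj₁ i))) = u v (polygon ζ i) (z ^ n)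
          L v (inj₂ (inj₂ (inj₂ i))) = u v 𝟙 (rep (τ (Γ.rep i))) - u v 𝟙 (rep (Γ.rep i))

          L-minus : ∀ v w j → L (λ a → v a - w a) j ≋ L v j - L w j
          L-minus v w (inj₁ i)               = u-minus v w _ (x ^ l)
          L-minus v w (inj₂ (inj₁ i))        = u-minus v w _ (y ^ m)
          L-minus v w (inj₂ (inj₂ (inj₁ i))) = u-minus v w _ (z ^ n)
          L-minus v w (inj₂ (inj₂ (inj₂ i))) = ≋-trans
            (+-cong (u-minus v w 𝟙 (rep (τ (Γ.rep i)))) (-‿cong (u-minus v w 𝟙 (rep (Γ.rep i)))))
            (ring 4 (λ a b c d → a :- b :- (c :- d) := a :- c :- (b :- d)) ≋-refl _ _ _ _)

          solution : ∃ λ v → (∃ λ a → v a ≋̸ 0#) × (∀ j → L v j ≋ 0#)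
          solution = nontrivial-solution′ R (Fin↔ ⊎-count Fin↔)
            (Fin↔ ⊎-count Fin↔ ⊎-count Fin↔ ⊎-count Fin↔) fewer L L-minus

          v : A → Carrier
          v = proj₁ solution

          ũ : G → Word Rotation → Carrier
          ũ = u v

          C : Crossed unscaled (raw v)
          C = extend-crossed unscaled _

          raw-product : ∀ g → raw v g (x ∙ y ∙ z) ≋ 0#
          raw-product = extend-product unscaled (atʸ v) (atᶻ v)

          ũ-crossed : Crossed unscaled ũ
          ũ-crossed = antisymmetrised-crossed (raw v) C raw-product

          ũ-antisymmetric : Antisymmetric ũ
          ũ-antisymmetric = antisymmetrised-antisymmetric (raw v) C raw-product

          ũ-product : ∀ g → ũ g (x ∙ y ∙ z) ≋ 0#
          ũ-product = antisymmetrised-product (raw v) C raw-product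

          solves : ∀ j → L v j ≋ 0#
          solves = proj₂ (proj₂ solution)

          kill : ∀ a g → ũ g (gen a ^ order l m n a) ≋ 0#
          kill ξ = spread ξ ũ-crossed ũ-product ũ-antisymmetric (λ i → solves (inj₁ i))
          kill η = spread η ũ-crossed ũ-product ũ-antisymmetric (λ i → solves (inj₂ (inj₁ i)))
          kill ζ = spread ζ ũ-crossed ũ-product ũ-antisymmetric (λ i → solves (inj₂ (inj₂ (inj₁ i))))

        antisymmetricCocycle : Cocycle unscaled
        antisymmetricCocycle = cocycle unscaled ũ-crossed ũ-product kill

        separating : ∃ λ (K : Cocycle unscaled) → ∃ λ w → Ker w ×
          Cocycle.value K 𝟙 w ≋̸ Cocycle.value K 𝟙 (w₀ ∙ σ w ∙ w₀ ⁻¹)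
        separating = antisymmetricCocycle , Gauged.separates antisymmetricCocycle ũ-antisymmetric
          (λ i → minus≋0⁻¹ (solves (inj₂ (inj₂ (inj₂ i))))) (nonzero-edge (proj₁ (proj₂ solution)))
          where
          nonzero-edge : (∃ λ a → v a ≋̸ 0#) → ∃ λ a → ∃ λ g → a ≢ ξ × ũ g (gen a) ≋̸ 0#
          nonzero-edge (inj₁ i , vᵢ≢0) =
            η , edgeʸ i , (λ ()) , λ e → vᵢ≢0 (revealʸ (λ i → v (inj₁ i)) (atᶻ v) i e)
          nonzero-edge (inj₂ i , vᵢ≢0) =
            ζ , edgeᶻ i , (λ ()) , λ e → vᵢ≢0 (revealᶻ (λ i → v (inj₂ i)) (atʸ v) i e)

module Separation where

  open import Data.Bool.Base using (true; false)
  open import Data.Fin.Base using (Fin; toℕ; _↑ˡ_; _↑ʳ_; splitAt)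
  open import Data.Fin.Patterns using (0F; 1F; 2F)
  open import Data.Fin.Properties using (_≟_; splitAt-↑ˡ; splitAt-↑ʳ)
  open import Data.Integer.Base using (0ℤ)
  open import Data.Nat.Base as ℕ using (ℕ; suc; _<_; _≤_; NonZero; >-nonZero)
  open import Data.Nat.Tactic.RingSolver using (solve-∀)
  open import Data.Product.Base using (∃; _×_; _,_)
  open import Data.Sum.Base using (_⊎_; inj₁; inj₂; [_,_]′)
  open import Data.Vec.Base using (lookup; []; _∷_)
  open import Function.Base using (_∘_; id)
  open import Relation.Binary.PropositionalEquality as ≡ using (_≡_; _≢_; cong; subst)
  open import Relation.Nullary using (¬_; yes; no)
  import Data.Nat.Properties as ℕₚ
  import Relation.Binary.Reasoning.Setoid as SetoidReasoning

  open import Defs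
  open PresentedGroups
  open TriangleGroups
  open FiniteQuotients
  open Residues
  open Orbits using (Transversal; module Involution; module Cycles; iterate; fixedPoints; fixedPoints-≤)
  open Cocycles
  open Antisymmetric

  Hyperbolic : ℕ → ℕ → ℕ → Set
  Hyperbolic l m n = m ℕ.* n ℕ.+ l ℕ.* n ℕ.+ l ℕ.* m < l ℕ.* m ℕ.* n

  -- The Euler characteristic is negative. Polygons, vertices and edges are
  -- counted up to an involution with f₀, f₁, f₂ fixed points on the three kinds
  -- of flags and Fˣ, Fʸ, Fᶻ folded polygons.
  module _ {l m n d Pˣ Pʸ Pᶻ Γ Uʸ Uᶻ Fˣ Fʸ Fᶻ f₀ f₁ f₂ : ℕ} where
    open import Data.Nat.Base using (_+_; _*_)
    open ℕₚ.≤-Reasoning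

    euler-count : Hyperbolic l m n → 0 < d →
      Pˣ * (2 * l) ≤ d + Fˣ * l → Pʸ * (2 * m) ≤ d + Fʸ * m → Pᶻ * (2 * n) ≤ d + Fᶻ * n →
      Fˣ * 2 ≤ f₁ + f₂ → Fʸ * 2 ≤ f₀ + f₂ → Fᶻ * 2 ≤ f₀ + f₁ →
      Γ * 2 + f₀ ≤ d → d + f₂ ≤ Uʸ * 2 → d + f₁ ≤ Uᶻ * 2 →
      Pˣ + (Pʸ + (Pᶻ + Γ)) < Uʸ + Uᶻ
    euler-count hyp 0<d px py pz fx fy fz γ uy uz =
      ℕₚ.*-cancelˡ-< (2 * (l * m * n)) _ _ (ℕₚ.+-cancelʳ-< (l * m * n * f₀) _ _ (begin-strict
        2 * (l * m * n) * (Pˣ + (Pʸ + (Pᶻ + Γ))) + l * m * n * f₀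
          ≡⟨ expand l m n Pˣ Pʸ Pᶻ Γ f₀ ⟩
        m * n * (Pˣ * (2 * l)) + l * n * (Pʸ * (2 * m)) + l * m * (Pᶻ * (2 * n)) + l * m * n * (Γ * 2 + f₀)
          ≤⟨ ℕₚ.+-mono-≤ (ℕₚ.+-mono-≤ (ℕₚ.+-mono-≤ (ℕₚ.*-monoʳ-≤ (m * n) px) (ℕₚ.*-monoʳ-≤ (l * n) py))
               (ℕₚ.*-monoʳ-≤ (l * m) pz)) (ℕₚ.*-monoʳ-≤ (l * m * n) γ) ⟩
        m * n * (d + Fˣ * l) + l * n * (d + Fʸ * m) + l * m * (d + Fᶻ * n) + l * m * n * d
          ≡⟨ collect l m n d Fˣ Fʸ Fᶻ ⟩
        (m * n + l * n + l * m) * d + l * m * n * (Fˣ + Fʸ + Fᶻ + d)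
          <⟨ ℕₚ.+-monoˡ-< _ (ℕₚ.*-monoˡ-< d {{>-nonZero 0<d}} hyp) ⟩
        l * m * n * d + l * m * n * (Fˣ + Fʸ + Fᶻ + d)
          ≤⟨ ℕₚ.+-monoʳ-≤ (l * m * n * d) (ℕₚ.*-monoʳ-≤ (l * m * n) (ℕₚ.+-monoˡ-≤ d folded)) ⟩
        l * m * n * d + l * m * n * (f₀ + f₁ + f₂ + d)
          ≡⟨ regroup (l * m * n) d f₀ f₁ f₂ ⟩
        l * m * n * (d + f₂ + (d + f₁)) + l * m * n * f₀
          ≤⟨ ℕₚ.+-monoˡ-≤ (l * m * n * f₀) (ℕₚ.*-monoʳ-≤ (l * m * n) (ℕₚ.+-mono-≤ uy uz)) ⟩
        l * m * n * (Uʸ * 2 + Uᶻ * 2) + l * m * n * f₀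
          ≡⟨ cong (_+ l * m * n * f₀) (double (l * m * n) Uʸ Uᶻ) ⟩
        2 * (l * m * n) * (Uʸ + Uᶻ) + l * m * n * f₀ ∎))
      where
      expand : ∀ l m n a b c g f → 2 * (l * m * n) * (a + (b + (c + g))) + l * m * n * f ≡
        m * n * (a * (2 * l)) + l * n * (b * (2 * m)) + l * m * (c * (2 * n)) + l * m * n * (g * 2 + f)
      expand = solve-∀
      collect : ∀ l m n d a b c →
        m * n * (d + a * l) + l * n * (d + b * m) + l * m * (d + c * n) + l * m * n * d ≡
        (m * n + l * n + l * m) * d + l * m * n * (a + b + c + d)
      collect = solve-∀
      regroup : ∀ k d a b c → k * d + k * (a + b + c + d) ≡ k * (d + c + (d + b)) + k * a
      regroup = solve-∀
      double : ∀ k a b → k * (a * 2 + b * 2) ≡ 2 * k * (a + b)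
      double = solve-∀
      folded : Fˣ + Fʸ + Fᶻ ≤ f₀ + f₁ + f₂
      folded = ℕₚ.*-cancelʳ-≤ _ _ 2 (begin
        (Fˣ + Fʸ + Fᶻ) * 2                 ≡⟨ lemma Fˣ Fʸ Fᶻ ⟩
        Fˣ * 2 + Fʸ * 2 + Fᶻ * 2           ≤⟨ ℕₚ.+-mono-≤ (ℕₚ.+-mono-≤ fx fy) fz ⟩
        f₁ + f₂ + (f₀ + f₂) + (f₀ + f₁)    ≡⟨ lemma′ f₀ f₁ f₂ ⟩
        (f₀ + f₁ + f₂) * 2                 ∎)
        where
        lemma : ∀ a b c → (a + b + c) * 2 ≡ a * 2 + b * 2 + c * 2
        lemma = solve-∀
        lemma′ : ∀ a b c → b + c + (a + c) + (a + b) ≡ (a + b + c) * 2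
        lemma′ = solve-∀

  module RotationCycles {l m n : ℕ} (RQ : RegularQuotient l m n) (a : Rotation) where
    open RegularQuotient RQ
    private
      instance
        order≢0 : NonZero (order l m n a)
        order≢0 = >-nonZero (order-pos a)

    order-trivial : ∀ g → iterate (rotate a) (order l m n a) g ≡ g
    order-trivial g = ≡.trans (iterate-rotate a (order l m n a) g) (·-trivial g (power-relator l m n a))

    order-free : ∀ j g → 0 < j → j < order l m n a → iterate (rotate a) j g ≢ g
    order-free j g 0<j j<k e = order-exact a j 0<j j<k (∙-cancelˡ (rep g)
      (≡.trans (≡.sym (iterate-rotate a j g)) (≡.trans e (≡.sym (·-ε g)))))

    open Cycles (rotate a) (order l m n a) order-trivial order-free hiding (_^_) public

    ∼⇒· : ∀ {g h} ((j , _) : g ∼ h) → g · gen a ^ toℕ j ≡ h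
    ∼⇒· {g} (j , e) = ≡.trans (≡.sym (iterate-rotate a (toℕ j) g)) e

    size-pos : 0 < size
    size-pos with size | 𝟙
    ... | suc _ | _ = ℕₚ.0<1+n

  module _ {l m n : ℕ} (RQ : RegularQuotient l m n) (hyp : Hyperbolic l m n)
           {q : ℕ} (R : ModularRing q) where
    open RegularQuotient RQ
    open ModularRing R
    open RingSolver using (_:=_; _:+_; _:*_; _:-_; :-_; con) renaming (solve to ring)
    open Modular R
    open SetoidReasoning setoid

    module _ (two-regular : ∀ t → t + t ≋ 0# → t ≋ 0#) where

      module _ (c : Word Rotation) (c∉Ker : ¬ Ker c) (c²∈Ker : Ker (c ∙ c)) where
        open Antisymmetrise RQ R false c c²∈Ker two-regular
        private
          module O = Transversal Inv.orbits

          no-fixedPoint : ∀ g → τ g ≢ g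
          no-fixedPoint g e = c∉Ker (∙-cancelʳ (rep g)
            (≡.trans e (≡.trans (≡.sym (coset-rep g)) (resp (sym (identityˡ (rep g)))))))

          module Polygons (a : Rotation) where
            open RotationCycles RQ a public
            open Dihedral τ τ² (λ g → ^⇒∼ 1 (≡.sym (τ-· g (gen a)))) hiding (_≈_) public
            module P = Transversal unfoldedOrbits

            k : ℕ
            k = order l m n a

            spreads : ∀ {u} → Crossed unscaled u → (∀ g → u g (x ∙ y ∙ z) ≋ 0#) → Antisymmetric u →
              (∀ i → u (P.rep i) (gen a ^ k) ≋ 0#) → ∀ g → u g (gen a ^ k) ≋ 0#
            spreads {u} C u-product anti kill g with folded? g
            ... | yes fold@(j , _) = two-regular _ (begin
              u g aᵏ + u g aᵏ                ≈⟨ +-cong same ≋-refl ⟩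
              u (τ g) aᵏ + u g aᵏ            ≈⟨ +-cong (anti g aᵏ) ≋-refl ⟩
              - u g aᵏ + u g aᵏ              ≈⟨ -‿inverseˡ _ ⟩
              0#                             ∎)
              where
              aᵏ aʲ : Word Rotation
              aᵏ = gen a ^ k
              aʲ = gen a ^ toℕ j
              same : u g aᵏ ≋ u (τ g) aᵏ
              same = +-cancelˡ (u g aʲ) (begin
                u g aʲ + u g aᵏ          ≈⟨ ring 2 (λ a b → a :+ b := b :+ a) ≋-refl _ _ ⟩
                u g aᵏ + u g aʲ          ≈⟨ +-cong ≋-refl (move u aʲ (·-trivial g (power-relator l m n a))) ⟨
                u g aᵏ + u (g · aᵏ) aʲ   ≈⟨ unscaled-∙ C g aᵏ aʲ ⟨
                u g (aᵏ ∙ aʲ)            ≈⟨ product-resp unscaled C u-product g (^-comm (gen a) k (toℕ j)) ⟩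
                u g (aʲ ∙ aᵏ)            ≈⟨ unscaled-∙ C g aʲ aᵏ ⟩
                u g aʲ + u (g · aʲ) aᵏ   ≈⟨ +-cong ≋-refl (move u aᵏ (∼⇒· fold)) ⟩
                u g aʲ + u (τ g) aᵏ      ∎)
            ... | no ¬folded with P.covers g ¬folded
            ... | i , inj₁ r@(j , _) = ≋-trans
              (move u (gen a ^ k) (≡.sym (∼⇒· r)))
              (power-shift unscaled C u-product a (toℕ j) (P.rep i) (kill i))
            ... | i , inj₂ r@(j , _) = ≋-trans
              (move u (gen a ^ k) (≡.sym (∼⇒· r)))
              (power-shift unscaled C u-product a (toℕ j) (τ (P.rep i)) (begin
                u (τ (P.rep i)) (gen a ^ k)  ≈⟨ anti (P.rep i) (gen a ^ k) ⟩
                - u (P.rep i) (gen a ^ k)    ≈⟨ -‿cong (kill i) ⟩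
                - 0#                         ≈⟨ ring 0 (:- con 0ℤ := con 0ℤ) ≋-refl ⟩
                0#                           ∎))

            bound : P.count ℕ.* (2 ℕ.* k) ≤ size ℕ.+ 0 ℕ.* k
            bound = ℕₚ.≤-trans (ℕₚ.m≤m+n _ _) (ℕₚ.≤-trans orbits-bound (ℕₚ.m≤m+n size 0))

          reveal : ∀ v i → supported O.rep v (O.rep i) - supported O.rep v (τ (O.rep i)) ≋ 0# → v i ≋ 0#
          reveal v i e = begin
            v i                     ≈⟨ ring 1 (λ a → a := a :- con 0ℤ) ≋-refl (v i) ⟩
            v i - 0#                ≈⟨ +-cong (≋-reflexive (supported-on O.rep v i λ {j} p → O.separated (inj₁ p) (inj₁ (≡.sym p))))
                                         (-‿cong (≋-reflexive (supported-off O.rep v _ off))) ⟨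
            supported O.rep v (O.rep i) - supported O.rep v (τ (O.rep i))  ≈⟨ e ⟩
            0#                      ∎
            where
            off : ∀ j → O.rep j ≢ τ (O.rep i)
            off j p with ≡.refl ← O.separated {i} {j} (inj₂ (≡.sym p)) (Inv.~-sym (inj₂ (≡.sym p))) =
              no-fixedPoint _ (≡.sym p)

          counts : Counts
          counts = record
            { polygons = λ a → Polygons.P.count a
            ; polygon  = λ a → Polygons.P.rep a
            ; spread   = λ a → Polygons.spreads a
            ; edgeʸ    = O.rep
            ; edgeᶻ    = O.rep
            ; revealʸ  = λ v _ → reveal v
            ; revealᶻ  = λ v _ → reveal v
            ; fewer    = euler-count {l} {m} {n} {size} {Polygons.P.count ξ} {Polygons.P.count η} {Polygons.P.count ζ}
                {Γ.count} {O.count} {O.count} {0} {0} {0} {0} {0} {0} hyp (RotationCycles.size-pos RQ ξ)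
                (Polygons.bound ξ) (Polygons.bound η) (Polygons.bound ζ) ℕₚ.≤-refl ℕₚ.≤-refl ℕₚ.≤-refl
                (ℕₚ.≤-trans (ℕₚ.+-monoʳ-≤ _ ℕ.z≤n) Inv.properOrbits-bound) edges-bound edges-bound
            }
            where
            edges-bound : size ℕ.+ 0 ≤ O.count ℕ.* 2
            edges-bound = ℕₚ.≤-trans (ℕₚ.+-monoʳ-≤ size ℕ.z≤n) Inv.orbits-bound

        abstract
          even-separating : ∃ λ (K : Cocycle unscaled) → ∃ λ w → Ker w ×
            Cocycle.value K 𝟙 w ≋̸ Cocycle.value K 𝟙 (c ∙ w ∙ c ⁻¹)
          even-separating = separating counts

      -- An element w r₀ of Δ* of order two modulo the kernel reverses polygons and
      -- may fix flags.
      module _ (w : Word Rotation) (w-involutive : Ker (w ∙ mirror w)) where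
        open Antisymmetrise RQ R true w w-involutive two-regular

        private
          τₐ : Rotation → G → G
          τₐ a g = τ g · twist a ⁻¹

          β : Rotation → G → G
          β a g = τ (g · gen a)

          mirror-twist : ∀ a → mirror (twist a ⁻¹) ∙ twist a ⁻¹ ≈ ε
          mirror-twist ξ = solve (lookup (y ∷ [])) ((ε ⁻¹ ∙ gen 0F ⁻¹ ∙ ε) ⁻¹ ∙ gen 0F ⁻¹) ε ≡.refl
          mirror-twist η = solve (lookup []) (ε ⁻¹ ∙ ε ⁻¹) ε ≡.refl
          mirror-twist ζ = solve (lookup []) (ε ⁻¹ ∙ ε ⁻¹) ε ≡.refl

          τₐ² : ∀ a g → τₐ a (τₐ a g) ≡ g
          τₐ² a g = ≡.trans (cong (_· twist a ⁻¹) (≡.trans (τ-· (τ g) (twist a ⁻¹)) (cong (_· mirror (twist a ⁻¹)) (τ² g))))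
            (≡.trans (≡.sym (·-∙ g _ _)) (·-trivial g (mirror-twist a)))

          τₐ-reverse : ∀ a g → rotate a (τₐ a (rotate a g)) ≡ τₐ a g
          τₐ-reverse a g =
            ≡.trans (cong (λ h → h · twist a ⁻¹ · gen a) (τ-· g (gen a)))
            (≡.trans (cong (_· gen a) (≡.sym (·-∙ (τ g) _ _)))
            (≡.trans (≡.sym (·-∙ (τ g) _ _))
            (·-resp (τ g) (solve (lookup (gen a ∷ twist a ∷ []))
              (gen 1F ⁻¹ ∙ gen 0F ⁻¹ ∙ gen 1F ∙ gen 1F ⁻¹ ∙ gen 0F) (gen 1F ⁻¹) ≡.refl))))

          β² : ∀ a → twist a ≡ ε → ∀ g → β a (β a g) ≡ g
          β² a e g = ≡.trans (τ-· (τ (g · gen a)) (gen a))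
            (≡.trans (cong (_· mirror (gen a)) (τ² (g · gen a)))
            (≡.trans (≡.sym (·-∙ g _ _)) (·-trivial g (cancel (twist a) e))))
            where
            cancel : ∀ t → t ≡ ε → gen a ∙ (t ⁻¹ ∙ gen a ⁻¹ ∙ t) ≈ ε
            cancel _ ≡.refl = solve (lookup (gen a ∷ [])) (gen 0F ∙ (ε ⁻¹ ∙ gen 0F ⁻¹ ∙ ε)) ε ≡.refl

          fix : (G → G) → ℕ
          fix f = Transversal.count (fixedPoints f)

          module Polygons (a : Rotation) where
            open RotationCycles RQ a public
            open Reversing (τₐ a) (τₐ² a) (τₐ-reverse a) hiding (_≈_) public
            module U = Transversal unfoldedOrbits
            module F = Transversal foldedOrbits

            k : ℕ
            k = order l m n a

            aᵏ : Word Rotation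
            aᵏ = gen a ^ k

            polygon : Fin (U.count ℕ.+ F.count) → G
            polygon i = [ U.rep , F.rep ]′ (splitAt U.count i)

            polygon-covers : ∀ g → ∃ λ i → polygon i ∼ g ⊎ τₐ a (polygon i) ∼ g
            polygon-covers g with folded? g
            ... | yes folded with i , r ← F.covers g folded =
              U.count ↑ʳ i , subst (λ h → h ∼ g ⊎ τₐ a h ∼ g)
                (≡.sym (cong [ U.rep , F.rep ]′ (splitAt-↑ʳ U.count F.count i))) r
            ... | no ¬folded with i , r ← U.covers g ¬folded =
              i ↑ˡ F.count , subst (λ h → h ∼ g ⊎ τₐ a h ∼ g)
                (≡.sym (cong [ U.rep , F.rep ]′ (splitAt-↑ˡ U.count i F.count))) r

            module _ {u} (C : Crossed unscaled u) (u-product : ∀ g → u g (x ∙ y ∙ z) ≋ 0#) (anti : Antisymmetric u) where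

              reflected : ∀ g → u g aᵏ ≋ 0# → u (τₐ a g) aᵏ ≋ 0#
              reflected g e = begin
                u h aᵏ
                  ≈⟨ ring 1 (λ b → b := :- :- b) ≋-refl (u h aᵏ) ⟩
                - - u h aᵏ
                  ≈⟨ -‿cong (-‿cong (move u aᵏ (trivial (aᵏ ⁻¹) (⁻¹-trivial aᵏ≈ε)))) ⟨
                - - u (h · aᵏ ⁻¹) aᵏ
                  ≈⟨ -‿cong (unscaled-⁻¹ C h aᵏ) ⟨
                - u h (aᵏ ⁻¹)
                  ≈⟨ -‿cong middle ⟩
                - 0#
                  ≈⟨ ring 0 (:- con 0ℤ := con 0ℤ) ≋-refl ⟩
                0# ∎
                where
                h : G
                h = τₐ a g
                t : Word Rotation
                t = twist a
                aᵏ≈ε : aᵏ ≈ ε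
                aᵏ≈ε = power-relator l m n a
                ⁻¹-trivial : ∀ {v} → v ≈ ε → v ⁻¹ ≈ ε
                ⁻¹-trivial v≈ε = trans (⁻¹-cong v≈ε) (solve (lookup []) (ε ⁻¹) ε ≡.refl)
                trivial : ∀ v → v ≈ ε → h · v ≡ h
                trivial v = ·-trivial h
                returns : τ g · (t ⁻¹ ∙ aᵏ ⁻¹) ≡ h
                returns = ≡.trans (·-∙ (τ g) _ _) (trivial (aᵏ ⁻¹) (⁻¹-trivial aᵏ≈ε))
                around : u (τ g) (t ⁻¹) + u h t ≋ 0#
                around = begin
                  u (τ g) (t ⁻¹) + u h t  ≈⟨ unscaled-∙ C (τ g) (t ⁻¹) t ⟨
                  u (τ g) (t ⁻¹ ∙ t)      ≈⟨ product-resp unscaled C u-product (τ g) (inverseˡ t) ⟩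
                  u (τ g) ε               ≈⟨ Crossed.law-ε C (τ g) ⟩
                  0#                      ∎
                middle : u h (aᵏ ⁻¹) ≋ 0#
                middle = begin
                  u h (aᵏ ⁻¹)
                    ≈⟨ +-identityʳ _ ⟨
                  u h (aᵏ ⁻¹) + 0#
                    ≈⟨ +-cong ≋-refl around ⟨
                  u h (aᵏ ⁻¹) + (u (τ g) (t ⁻¹) + u h t)
                    ≈⟨ ring 3 (λ a b c → a :+ (b :+ c) := b :+ a :+ c) ≋-refl _ _ _ ⟩
                  u (τ g) (t ⁻¹) + u h (aᵏ ⁻¹) + u h t
                    ≈⟨ +-cong (unscaled-∙ C (τ g) (t ⁻¹) (aᵏ ⁻¹)) (move u t returns) ⟨
                  u (τ g) (t ⁻¹ ∙ aᵏ ⁻¹) + u (τ g · (t ⁻¹ ∙ aᵏ ⁻¹)) t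
                    ≈⟨ unscaled-∙ C (τ g) (t ⁻¹ ∙ aᵏ ⁻¹) t ⟨
                  u (τ g) (t ⁻¹ ∙ aᵏ ⁻¹ ∙ t)
                    ≈⟨ product-resp unscaled C u-product (τ g) (mirror-^ a k) ⟨
                  u (τ g) (mirror aᵏ)
                    ≈⟨ anti g aᵏ ⟩
                  - u g aᵏ
                    ≈⟨ -‿cong e ⟩
                  - 0#
                    ≈⟨ ring 0 (:- con 0ℤ := con 0ℤ) ≋-refl ⟩
                  0# ∎

              spreads : (∀ i → u (polygon i) aᵏ ≋ 0#) → ∀ g → u g aᵏ ≋ 0#
              spreads kill g with polygon-covers g
              ... | i , inj₁ r@(j , _) = ≋-trans
                (move u aᵏ (≡.sym (∼⇒· r)))
                (power-shift unscaled C u-product a (toℕ j) (polygon i) (kill i))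
              ... | i , inj₂ r@(j , _) = ≋-trans
                (move u aᵏ (≡.sym (∼⇒· r)))
                (power-shift unscaled C u-product a (toℕ j) (τₐ a (polygon i)) (reflected (polygon i) (kill i)))

            polygons-bound : (U.count ℕ.+ F.count) ℕ.* (2 ℕ.* k) ≤ size ℕ.+ F.count ℕ.* k
            polygons-bound = ℕₚ.≤-trans (ℕₚ.≤-reflexive (rearrange U.count F.count k))
              (ℕₚ.+-monoˡ-≤ (F.count ℕ.* k) orbits-bound)
              where
              rearrange : ∀ u f k → (u ℕ.+ f) ℕ.* (2 ℕ.* k) ≡ u ℕ.* (2 ℕ.* k) ℕ.+ f ℕ.* k ℕ.+ f ℕ.* k
              rearrange = solve-∀

            folded-bound : ∀ {f f′} → fix (τₐ a) ≤ f → fix (τₐ a ∘ rotate a) ≤ f′ → F.count ℕ.* 2 ≤ f ℕ.+ f′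
            folded-bound p r = ℕₚ.≤-trans foldedOrbits-bound (ℕₚ.+-mono-≤ p r)

          module Edges (a : Rotation) (flat : twist a ≡ ε) where
            open Involution (β a) (β² a flat) public
            module O = Transversal orbits

            mirrored : ∀ {u} → Crossed unscaled u → (∀ g → u g (x ∙ y ∙ z) ≋ 0#) →
                       ∀ g → u (τ g) (mirror (gen a)) ≋ - u (β a g) (gen a)
            mirrored {u} C u-product g = begin
              u (τ g) (mirror (gen a))      ≈⟨ product-resp unscaled C u-product (τ g) simplify ⟩
              u (τ g) (gen a ⁻¹)            ≈⟨ unscaled-⁻¹ C (τ g) (gen a) ⟩
              - u (τ g · gen a ⁻¹) (gen a)  ≈⟨ -‿cong (move u (gen a) (≡.trans (·-resp (τ g) (sym simplify)) (≡.sym (τ-· g (gen a))))) ⟩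
              - u (β a g) (gen a)           ∎
              where
              lemma : ∀ t {S} → t ≡ ε → Equal S (t ⁻¹ ∙ gen a ⁻¹ ∙ t) (gen a ⁻¹)
              lemma _ ≡.refl = solve (lookup (gen a ∷ [])) (ε ⁻¹ ∙ gen 0F ⁻¹ ∙ ε) (gen 0F ⁻¹) ≡.refl
              simplify : ∀ {S} → Equal S (mirror (gen a)) (gen a ⁻¹)
              simplify = lemma (twist a) flat

            reveal : ∀ v i → supported O.rep v (O.rep i) + supported O.rep v (β a (O.rep i)) ≋ 0# → v i ≋ 0#
            reveal v i e with β a (O.rep i) ≟ O.rep i
            ... | yes fixed = two-regular (v i) (≋-trans
              (+-cong (≋-reflexive (≡.sym on)) (≋-reflexive (≡.sym (≡.trans (cong (supported O.rep v) fixed) on)))) e)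
              where
              on : supported O.rep v (O.rep i) ≡ v i
              on = supported-on O.rep v i λ p → O.separated (inj₁ p) (inj₁ (≡.sym p))
            ... | no moved = begin
              v i         ≈⟨ +-identityʳ (v i) ⟨
              v i + 0#    ≈⟨ +-cong (≋-reflexive (supported-on O.rep v i λ p → O.separated (inj₁ p) (inj₁ (≡.sym p))))
                               (≋-reflexive (supported-off O.rep v _ off)) ⟨
              supported O.rep v (O.rep i) + supported O.rep v (β a (O.rep i))  ≈⟨ e ⟩
              0#          ∎
              where
              off : ∀ j → O.rep j ≢ β a (O.rep i)
              off j p with ≡.refl ← O.separated {i} {j} (inj₂ (≡.sym p)) (~-sym (inj₂ (≡.sym p))) =
                moved (≡.sym p)

            reveal-raw : ∀ (e : Rotation → G → Carrier) v i → (∀ g → e a g ≡ supported O.rep v g) →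
              (∀ g → extend unscaled e g (x ∙ y ∙ z) ≋ 0#) →
              antisymmetrised (extend unscaled e) (O.rep i) (gen a) ≋ 0# → v i ≋ 0#
            reveal-raw e v i same e-product zero-here = reveal v i (begin
              supported O.rep v (O.rep i) + supported O.rep v (β a (O.rep i))
                ≈⟨ +-cong (≋-reflexive (same (O.rep i))) (≋-reflexive (same (β a (O.rep i)))) ⟨
              e a (O.rep i) + e a (β a (O.rep i))
                ≈⟨ ring 2 (λ p r → p :+ r := p :- :- r) ≋-refl _ _ ⟩
              e a (O.rep i) - - e a (β a (O.rep i))
                ≈⟨ +-cong ≋-refl (-‿cong (mirrored (extend-crossed unscaled e) e-product (O.rep i))) ⟨
              antisymmetrised (extend unscaled e) (O.rep i) (gen a)
                ≈⟨ zero-here ⟩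
              0# ∎)

          module Eʸ = Edges η ≡.refl
          module Eᶻ = Edges ζ ≡.refl

          τ-plain : ∀ g → τ g · ε ⁻¹ ≡ τ g
          τ-plain g = ·-trivial (τ g) (solve (lookup []) (ε ⁻¹) ε ≡.refl)

          -- Each polygon of kind a has two axes; the reflections in them fix
          -- flags of the two kinds of edges that bound the polygon.
          fix-τ-flat : ∀ a → twist a ≡ ε → fix (τₐ a) ≤ fix τ
          fix-τ-flat a flat = fixedPoints-≤ (τₐ a) τ id id λ g e →
            ≡.trans (≡.sym (plain (twist a) flat g)) e
            where
            plain : ∀ t → t ≡ ε → ∀ g → τ g · t ⁻¹ ≡ τ g
            plain _ ≡.refl = τ-plain

          fix-β-flat : ∀ a → twist a ≡ ε → fix (τₐ a ∘ rotate a) ≤ fix (β a)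
          fix-β-flat a flat = fixedPoints-≤ (τₐ a ∘ rotate a) (β a) id id λ g e →
            ≡.trans (≡.sym (plain (twist a) flat (g · gen a))) e
            where
            plain : ∀ t → t ≡ ε → ∀ g → τ g · t ⁻¹ ≡ τ g
            plain _ ≡.refl = τ-plain

          fix-ξ : fix (τₐ ξ) ≤ fix (β η)
          fix-ξ = fixedPoints-≤ (τₐ ξ) (β η) id id λ g e → ≡.trans (τ-· g y)
            (≡.trans (·-resp (τ g) (solve (lookup (y ∷ [])) (ε ⁻¹ ∙ gen 0F ⁻¹ ∙ ε) (gen 0F ⁻¹) ≡.refl)) e)

          fix-β-ξ : fix (τₐ ξ ∘ rotate ξ) ≤ fix (β ζ)
          fix-β-ξ = fixedPoints-≤ (τₐ ξ ∘ rotate ξ) (β ζ) τ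
            (λ {g} {h} e → ≡.trans (≡.sym (τ² g)) (≡.trans (cong τ e) (τ² h)))
            λ g e → cong τ (≡.trans (≡.trans (·-resp (τ g) z≈) (≡.trans (·-∙ (τ g) (mirror x) (y ⁻¹))
              (cong (_· y ⁻¹) (≡.sym (τ-· g x))))) e)
            where
            z≈ : z ≈ mirror x ∙ y ⁻¹
            z≈ = trans (solve (lookup (x ∷ y ∷ z ∷ [])) (gen 2F) ((gen 0F ∙ gen 1F) ⁻¹ ∙ (gen 0F ∙ gen 1F ∙ gen 2F)) ≡.refl)
              (trans (∙-cong refl (relator (xyz∈relators l m n)))
              (solve (lookup (x ∷ y ∷ [])) ((gen 0F ∙ gen 1F) ⁻¹ ∙ ε)
                (gen 1F ⁻¹ ∙ gen 0F ⁻¹ ∙ gen 1F ∙ gen 1F ⁻¹) ≡.refl))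

          counts : Counts
          counts = record
            { polygons = λ a → Polygons.U.count a ℕ.+ Polygons.F.count a
            ; polygon  = λ a → Polygons.polygon a
            ; spread   = λ a → Polygons.spreads a
            ; edgeʸ    = Eʸ.O.rep
            ; edgeᶻ    = Eᶻ.O.rep
            ; revealʸ  = λ v c i → Eʸ.reveal-raw (generators unscaled (supported Eʸ.O.rep v) c) v i (λ _ → ≡.refl)
                                     (extend-product unscaled (supported Eʸ.O.rep v) c)
            ; revealᶻ  = λ v c i → Eᶻ.reveal-raw (generators unscaled c (supported Eᶻ.O.rep v)) v i (λ _ → ≡.refl)
                                     (extend-product unscaled c (supported Eᶻ.O.rep v))
            ; fewer    = euler-count {l} {m} {n} {size} {Polygons.U.count ξ ℕ.+ Polygons.F.count ξ}
                {Polygons.U.count η ℕ.+ Polygons.F.count η} {Polygons.U.count ζ ℕ.+ Polygons.F.count ζ}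
                {Γ.count} {Eʸ.O.count} {Eᶻ.O.count} {Polygons.F.count ξ} {Polygons.F.count η} {Polygons.F.count ζ}
                {fix τ} {fix (β ζ)} {fix (β η)}
                hyp (RotationCycles.size-pos RQ ξ)
                (Polygons.polygons-bound ξ) (Polygons.polygons-bound η) (Polygons.polygons-bound ζ)
                (ℕₚ.≤-trans (Polygons.folded-bound ξ fix-ξ fix-β-ξ) (ℕₚ.≤-reflexive (ℕₚ.+-comm (fix (β η)) _)))
                (Polygons.folded-bound η (fix-τ-flat η ≡.refl) (fix-β-flat η ≡.refl))
                (Polygons.folded-bound ζ (fix-τ-flat ζ ≡.refl) (fix-β-flat ζ ≡.refl))
                Inv.properOrbits-bound Eʸ.orbits-bound Eᶻ.orbits-bound
            }

        abstract
          odd-separating : ∃ λ (K : Cocycle unscaled) → ∃ λ v → Ker v ×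
            Cocycle.value K 𝟙 v ≋̸ Cocycle.value K 𝟙 (w ∙ mirror v ∙ w ⁻¹)
          odd-separating = separating counts

module Exponents where

  open import Data.Empty using (⊥-elim)
  open import Data.Fin.Base using (Fin; zero; suc; toℕ)
  open import Data.Fin.Patterns using (0F; 1F; 2F)
  open import Data.Fin.Properties using (any?; all?; ¬∀⟶∃¬; pigeonhole; toℕ<n; toℕ-injective)
  open import Data.Integer.Base using (+_; 0ℤ; 1ℤ)
  open import Data.Nat.Base as ℕ using (ℕ; zero; suc; _<_; _≤_; s≤s; z≤n)
  open import Data.Product.Base using (∃; _×_; _,_; proj₁; proj₂)
  open import Data.Sum.Base using (_⊎_; inj₁; inj₂)
  open import Data.Vec.Base using (lookup; []; _∷_)
  open import Function.Base using (_∘_)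
  open import Relation.Binary.PropositionalEquality as ≡ using (_≡_; _≢_; cong; subst)
  open import Relation.Nullary using (¬_; Dec; yes; no; ¬?)
  open import Relation.Nullary.Decidable using (decidable-stable)
  import Data.Fin.Base as Fin
  import Data.Nat.Properties as ℕₚ
  import Data.Fin.Properties as Finₚ
  import Relation.Binary.Reasoning.Setoid as SetoidReasoning

  open import Defs
  open PresentedGroups
  open TriangleGroups
  open FiniteQuotients
  open Residues
  open Orbits using (halve; iterate; iterate-sucʳ)
  open Cocycles
  open Antisymmetric
  open Separation

  module _ {l m n : ℕ} (RQ : RegularQuotient l m n) where
    open RegularQuotient RQ

    finite-order : ∀ e → ∃ λ s → 0 < s × Ker (e ^ s)
    finite-order e with pigeonhole (ℕₚ.n<1+n size) (λ i → coset (e ^ toℕ i))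
    ... | i , j , i<j , same = toℕ j ℕ.∸ toℕ i , ℕₚ.m<n⇒0<n∸m i<j , ∙-cancelˡ (e ^ toℕ i)
      (≡.trans (≡.sym (resp (^-+ e (toℕ i) (toℕ j ℕ.∸ toℕ i))))
      (≡.trans (cong (λ k → coset (e ^ k)) (ℕₚ.m+[n∸m]≡n (ℕₚ.<⇒≤ i<j)))
      (≡.trans (≡.sym same) (resp (sym (identityʳ (e ^ toℕ i)))))))

    ker? : ∀ w → Dec (Ker w)
    ker? w = coset w Finₚ.≟ coset ε

    even-or-odd-order : ∀ e → (∃ λ j → ¬ Ker (e ^ j) × Ker (e ^ j ∙ e ^ j)) ⊎ (∃ λ j → Ker (e ^ suc (j ℕ.+ j)))
    even-or-odd-order e with finite-order e
    ... | s , 0<s , k = descend s s ℕₚ.≤-refl 0<s k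
      where
      descend : ∀ bound s → s ≤ bound → 0 < s → Ker (e ^ s) →
        (∃ λ j → ¬ Ker (e ^ j) × Ker (e ^ j ∙ e ^ j)) ⊎ (∃ λ j → Ker (e ^ suc (j ℕ.+ j)))
      descend bound s s≤ 0<s k with halve s
      ... | j , inj₂ ≡.refl = inj₂ (j , k)
      ... | zero , inj₁ ≡.refl = ⊥-elim (ℕₚ.<-irrefl ≡.refl 0<s)
      descend (suc bound) s s≤ 0<s k | j@(suc i) , inj₁ ≡.refl with ker? (e ^ j)
      ... | yes k′ = descend bound j (ℕₚ.≤-trans (s≤s (ℕₚ.m≤m+n i i))
                       (ℕₚ.≤-trans (ℕₚ.≤-reflexive (≡.sym (ℕₚ.+-suc i i))) (ℕ.s≤s⁻¹ s≤))) (s≤s z≤n) k′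
      ... | no ∉ = inj₁ (j , ∉ , Ker-resp (^-+ e j j) k)

    module _ (hyp : Hyperbolic l m n) {q : ℕ} (R : ModularRing q) where
      open ModularRing R
      open RingSolver using (_:=_; _:+_; _:*_; _:-_; :-_; con) renaming (solve to ring)
      open Modular R
      open SetoidReasoning setoid

      first-change : ∀ (f : ℕ → Carrier) k → f 0 ≋̸ f k → ∃ λ i → f i ≋̸ f (suc i)
      first-change f zero    ne = ⊥-elim (ne ≋-refl)
      first-change f (suc k) ne with f k ≋? f (suc k)
      ... | no ne′ = k , ne′
      ... | yes e  = first-change f k (λ e′ → ne (≋-trans e′ e))

      module _ (K : Cocycle unscaled) where
        open Cocycle K

        law : ∀ g v w → value g (v ∙ w) ≋ value g v + value (g · v) w
        law g v w = ≋-trans (law-∙ g v w) (+-cong ≋-refl (*-identityˡ _))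

        value-conj : ∀ w {v} → Ker v → value 𝟙 (w ∙ v ∙ w ⁻¹) ≋ value (coset w) v
        value-conj w {v} k = begin
          value 𝟙 (w ∙ v ∙ w ⁻¹)
            ≈⟨ law 𝟙 (w ∙ v) (w ⁻¹) ⟩
          value 𝟙 (w ∙ v) + value (𝟙 · (w ∙ v)) (w ⁻¹)
            ≈⟨ +-cong (law 𝟙 w v) (move (w ⁻¹) (≡.trans (·-∙ 𝟙 w v) (·-Ker _ k))) ⟩
          value 𝟙 w + value (𝟙 · w) v + value (𝟙 · w) (w ⁻¹)
            ≈⟨ ring 3 (λ a t c → a :+ t :+ c := (a :+ c) :+ t) ≋-refl _ _ _ ⟩
          value 𝟙 w + value (𝟙 · w) (w ⁻¹) + value (𝟙 · w) v
            ≈⟨ +-cong (≋-trans (≋-sym (law 𝟙 w (w ⁻¹))) (value-trivial 𝟙 (inverseʳ w))) (move v (𝟙· w)) ⟩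
          0# + value (coset w) v
            ≈⟨ +-identityˡ _ ⟩
          value (coset w) v ∎

      module _ (two-regular : ∀ t → t + t ≋ 0# → t ≋ 0#) where

        -- An odd element t = w r₀ of Δ* acts nontrivially on Hom(Ker, ℤ/q): some
        -- power of t has order two modulo Ker, and it acts nontrivially.
        module _ (w : Word Rotation) where

          private
            α : Word Rotation → Word Rotation
            α v = w ∙ mirror v ∙ w ⁻¹

            e : Word Rotation
            e = w ∙ mirror w

            α-Ker : ∀ {v} → Ker v → Ker (α v)
            α-Ker k = Ker-conj w (mirror-Ker k)

            iterate-α-Ker : ∀ i {v} → Ker v → Ker (iterate α i v)
            iterate-α-Ker zero    k = k
            iterate-α-Ker (suc i) k = iterate-α-Ker i (α-Ker k)

            α-resp : ∀ {u v} → u ≈ v → α u ≈ α v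
            α-resp p = ∙-cong (∙-cong refl (mirror-resp {l} {m} {n} p)) refl

            iterate-α-resp : ∀ i {u v} → u ≈ v → iterate α i u ≈ iterate α i v
            iterate-α-resp zero    p = p
            iterate-α-resp (suc i) p = iterate-α-resp i (α-resp p)

            α² : ∀ v → α (α v) ≈ e ∙ v ∙ e ⁻¹
            α² v = trans
              (∙-cong (∙-cong refl (∙-cong (∙-cong refl (mirror-involutive v)) refl)) refl)
              (solve (lookup (w ∷ mirror w ∷ v ∷ []))
                (gen 0F ∙ (gen 1F ∙ gen 2F ∙ gen 1F ⁻¹) ∙ gen 0F ⁻¹)
                (gen 0F ∙ gen 1F ∙ gen 2F ∙ (gen 0F ∙ gen 1F) ⁻¹) ≡.refl)

            iterate-α-even : ∀ j v → iterate α (j ℕ.+ j) v ≈ e ^ j ∙ v ∙ (e ^ j) ⁻¹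
            iterate-α-even zero    v = solve (lookup (v ∷ [])) (gen 0F) (ε ∙ gen 0F ∙ ε ⁻¹) ≡.refl
            iterate-α-even (suc j) v rewrite ℕₚ.+-suc j j =
              trans (iterate-α-resp (j ℕ.+ j) (α² v))
              (trans (iterate-α-even j (e ∙ v ∙ e ⁻¹))
              (trans (solve (lookup (e ∷ e ^ j ∷ v ∷ []))
                (gen 1F ∙ (gen 0F ∙ gen 2F ∙ gen 0F ⁻¹) ∙ gen 1F ⁻¹)
                (gen 1F ∙ gen 0F ∙ gen 2F ∙ (gen 1F ∙ gen 0F) ⁻¹) ≡.refl)
              (∙-cong (∙-cong (sym (^-sucʳ e j)) refl) (⁻¹-cong (sym (^-sucʳ e j))))))

            mirror-e : mirror e ≈ mirror w ∙ w
            mirror-e = ∙-cong refl (mirror-involutive w)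

            slide : ∀ j → w ∙ (mirror w ∙ w) ^ j ≈ e ^ j ∙ w
            slide zero    = trans (identityʳ w) (sym (identityˡ w))
            slide (suc j) = trans
              (solve (lookup (w ∷ mirror w ∷ (mirror w ∙ w) ^ j ∷ []))
                (gen 0F ∙ (gen 1F ∙ gen 0F ∙ gen 2F)) (gen 0F ∙ gen 1F ∙ (gen 0F ∙ gen 2F)) ≡.refl)
              (trans (∙-cong refl (slide j)) (sym (assoc _ _ _)))

            odd-involutive : ∀ j → Ker (e ^ suc (j ℕ.+ j)) → Ker (e ^ j ∙ w ∙ mirror (e ^ j ∙ w))
            odd-involutive j = Ker-resp (sym (trans (∙-cong refl (∙-cong
              (trans (≡⇒≈ (substitute-^ _ e j)) (^-cong j mirror-e)) refl))
              (trans (solve (lookup (e ^ j ∷ w ∷ (mirror w ∙ w) ^ j ∷ mirror w ∷ []))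
                (gen 0F ∙ gen 1F ∙ (gen 2F ∙ gen 3F)) (gen 0F ∙ (gen 1F ∙ gen 2F) ∙ gen 3F) ≡.refl)
              (trans (∙-cong (∙-cong refl (slide j)) refl)
              (trans (solve (lookup (e ^ j ∷ w ∷ mirror w ∷ []))
                (gen 0F ∙ (gen 0F ∙ gen 1F) ∙ gen 2F) (gen 0F ∙ gen 0F ∙ (gen 1F ∙ gen 2F)) ≡.refl)
              (trans (∙-cong (sym (^-+ e j j)) refl) (sym (^-sucʳ e (j ℕ.+ j)))))))))
              where
              open import Data.Fin.Patterns using (3F)
              ≡⇒≈ : ∀ {u v} → u ≡ v → u ≈ v
              ≡⇒≈ ≡.refl = refl

            find : (K : Cocycle unscaled) → ∀ i {v} → Ker v →
              Cocycle.value K 𝟙 v ≋̸ Cocycle.value K 𝟙 (iterate α i v) →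
              ∃ λ v → Ker v × Cocycle.value K 𝟙 v ≋̸ Cocycle.value K 𝟙 (α v)
            find K i {v} k ne with first-change (λ i → Cocycle.value K 𝟙 (iterate α i v)) i ne
            ... | i , ne′ = iterate α i v , iterate-α-Ker i k ,
              subst (λ u → Cocycle.value K 𝟙 (iterate α i v) ≋̸ Cocycle.value K 𝟙 u) (iterate-sucʳ α i v) ne′

          abstract
            moved-by-odd : ∃ λ (K : Cocycle unscaled) → ∃ λ v → Ker v ×
              Cocycle.value K 𝟙 v ≋̸ Cocycle.value K 𝟙 (w ∙ mirror v ∙ w ⁻¹)
            moved-by-odd with even-or-odd-order e
            ... | inj₁ (j , ∉ , k) with even-separating RQ hyp R two-regular (e ^ j) ∉ k
            ... | K , v , v∈ , ne = K , find K (j ℕ.+ j) v∈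
              (λ p → ne (≋-trans p (Cocycle.value-resp K 𝟙 (iterate-α-even j v))))
            moved-by-odd | inj₂ (j , k) with odd-separating RQ hyp R two-regular (e ^ j ∙ w) (odd-involutive j k)
            ... | K , v , v∈ , ne = K , find K (suc (j ℕ.+ j)) v∈
              (λ p → ne (≋-trans p (Cocycle.value-resp K 𝟙 (trans (iterate-α-even j (α v))
                (solve (lookup (e ^ j ∷ w ∷ mirror v ∷ []))
                  (gen 0F ∙ (gen 1F ∙ gen 2F ∙ gen 1F ⁻¹) ∙ gen 0F ⁻¹)
                  (gen 0F ∙ gen 1F ∙ gen 2F ∙ (gen 0F ∙ gen 1F) ⁻¹) ≡.refl)))))

        defect : Cocycle unscaled → G → Word Rotation → Carrier
        defect K g v = Cocycle.value K g v - Cocycle.value K 𝟙 (mirror v)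

        Distinguishes : Cocycle unscaled → G → Set
        Distinguishes K g = ∃ λ v → Ker v × defect K g v ≋̸ 0#

        abstract
          distinguish : ∀ g → ∃ λ K → Distinguishes K g
          distinguish g with moved-by-odd (mirror (rep g) ⁻¹)
          ... | K , v , k , ne = K , rep g ⁻¹ ∙ v ∙ rep g ,
            Ker-resp (∙-cong refl ⁻¹⁻¹) k′ , λ e → ne (begin
              value 𝟙 v                                    ≈⟨ value-resp 𝟙 (solve (lookup (rep g ∷ v ∷ []))
                                                                (gen 1F) (gen 0F ∙ (gen 0F ⁻¹ ∙ gen 1F ∙ gen 0F) ∙ gen 0F ⁻¹) ≡.refl) ⟩
              value 𝟙 (rep g ∙ (rep g ⁻¹ ∙ v ∙ rep g) ∙ rep g ⁻¹)  ≈⟨ value-conj K (rep g) (Ker-resp (∙-cong refl ⁻¹⁻¹) k′) ⟩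
              value (coset (rep g)) (rep g ⁻¹ ∙ v ∙ rep g) ≈⟨ move _ (coset-rep g) ⟩
              value g (rep g ⁻¹ ∙ v ∙ rep g)               ≈⟨ minus≋0⁻¹ e ⟩
              value 𝟙 (mirror (rep g ⁻¹ ∙ v ∙ rep g))      ≈⟨ value-resp 𝟙 (∙-cong refl (sym ⁻¹⁻¹)) ⟩
              value 𝟙 (mirror (rep g) ⁻¹ ∙ mirror v ∙ mirror (rep g) ⁻¹ ⁻¹)  ∎)
            where
            open Cocycle K
            ⁻¹⁻¹ : ∀ {u} → u ⁻¹ ⁻¹ ≈ u
            ⁻¹⁻¹ {u} = solve (lookup (u ∷ [])) (gen 0F ⁻¹ ⁻¹) (gen 0F) ≡.refl
            k′ : Ker (rep g ⁻¹ ∙ v ∙ rep g ⁻¹ ⁻¹)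
            k′ = Ker-conj (rep g ⁻¹) k

        module _ (K : Cocycle unscaled) (a : Carrier) (K′ : Cocycle unscaled) where
          private
            module K = Cocycle K
            module K′ = Cocycle K′

          combination : Cocycle unscaled
          combination = record
            { value      = λ g w → K.value g w + a * K′.value g w
            ; value-resp = λ g e → +-cong (K.value-resp g e) (*-cong ≋-refl (K′.value-resp g e))
            ; crossed    = record
              { law-ε  = λ g → ≋-trans (+-cong (K.law-ε g) (*-cong ≋-refl (K′.law-ε g)))
                  (ring 1 (λ a → con 0ℤ :+ a :* con 0ℤ := con 0ℤ) ≋-refl a)
              ; law-∙  = λ g v w → ≋-trans (+-cong (K.law-∙ g v w) (*-cong ≋-refl (K′.law-∙ g v w)))
                  (ring 5 (λ a b c d e → b :+ con 1ℤ :* c :+ a :* (d :+ con 1ℤ :* e) :=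
                                         b :+ a :* d :+ con 1ℤ :* (c :+ a :* e)) ≋-refl a _ _ _ _)
              ; law-⁻¹ = λ g w → ≋-trans (+-cong (K.law-⁻¹ g w) (*-cong ≋-refl (K′.law-⁻¹ g w)))
                  (ring 3 (λ a b c → :- (con 1ℤ :* b) :+ a :* :- (con 1ℤ :* c) :=
                                     :- (con 1ℤ :* (b :+ a :* c))) ≋-refl a _ _)
              }
            }

          defect-combination : ∀ g v → defect combination g v ≋ defect K g v + a * defect K′ g v
          defect-combination g v = ring 5
            (λ a b c d e → b :+ a :* c :- (d :+ a :* e) := (b :- d) :+ a :* (c :- e)) ≋-refl a _ _ _ _

        module _ (differences-regular : ∀ {i j} → i < q → j < q → i ≢ j →
                                        ∀ t → (ι (+ i) - ι (+ j)) * t ≋ 0# → t ≋ 0#) where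

          -- Each condition excludes at most one coefficient of the combination.
          distinguish-all : ∀ k → k < q → (point : Fin k → G) → ∃ λ K → ∀ i → Distinguishes K (point i)
          distinguish-all zero    _   point = proj₁ (distinguish 𝟙) , λ ()
          distinguish-all (suc k) k<q point with distinguish-all k (ℕₚ.<-trans (ℕₚ.n<1+n k) k<q) (point ∘ suc) | distinguish (point zero)
          ... | K , old | K′ , new = choose (any? λ c → all? λ i → ¬? (tested c i ≋? 0#))
            where
            witness : Fin (suc k) → Word Rotation
            witness zero    = proj₁ new
            witness (suc i) = proj₁ (old i)

            witness∈ : ∀ i → Ker (witness i)
            witness∈ zero    = proj₁ (proj₂ new)
            witness∈ (suc i) = proj₁ (proj₂ (old i))

            tested : Fin q → Fin (suc k) → Carrier
            tested c i = defect K (point i) (witness i) + ι (+ toℕ c) * defect K′ (point i) (witness i)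

            both-zero : ∀ {c c′} i → c ≢ c′ → tested c i ≋ 0# → tested c′ i ≋ 0# →
              defect K (point i) (witness i) ≋ 0# × defect K′ (point i) (witness i) ≋ 0#
            both-zero {c} {c′} i c≢c′ e e′ = A≋0 , B≋0
              where
              A B s s′ : Carrier
              A = defect K (point i) (witness i)
              B = defect K′ (point i) (witness i)
              s = ι (+ toℕ c)
              s′ = ι (+ toℕ c′)
              B≋0 : B ≋ 0#
              B≋0 = differences-regular (toℕ<n c) (toℕ<n c′) (c≢c′ ∘ toℕ-injective) B (begin
                (s - s′) * B             ≈⟨ ring 4 (λ a b s t → (s :- t) :* b := a :+ s :* b :- (a :+ t :* b)) ≋-refl A B s s′ ⟩
                A + s * B - (A + s′ * B) ≈⟨ +-cong e (-‿cong e′) ⟩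
                0# - 0#                  ≈⟨ -‿inverseʳ 0# ⟩
                0#                       ∎)
              A≋0 : A ≋ 0#
              A≋0 = begin
                A           ≈⟨ ring 2 (λ a s → a := a :+ s :* con 0ℤ) ≋-refl A s ⟩
                A + s * 0#  ≈⟨ +-cong ≋-refl (*-cong ≋-refl B≋0) ⟨
                A + s * B   ≈⟨ e ⟩
                0#          ∎

            excludes-one : ∀ {c c′} i → c ≢ c′ → tested c i ≋ 0# → tested c′ i ≋̸ 0#
            excludes-one zero    c≢c′ e e′ = proj₂ (proj₂ new) (proj₂ (both-zero zero c≢c′ e e′))
            excludes-one (suc i) c≢c′ e e′ = proj₂ (proj₂ (old i)) (proj₁ (both-zero (suc i) c≢c′ e e′))

            choose : Dec (∃ λ c → ∀ i → tested c i ≋̸ 0#) → ∃ λ K → ∀ i → Distinguishes K (point i)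
            choose (yes (c , good)) = combination K (ι (+ toℕ c)) K′ , λ i →
              witness i , witness∈ i , λ e → good i (≋-trans (≋-sym (defect-combination K _ K′ (point i) (witness i))) e)
            choose (no none) = ⊥-elim (excludes-one (proj₁ (bad c)) (Finₚ.<⇒≢ c<c′) (proj₂ (bad c))
              (≋-trans (≋-reflexive (cong (tested c′) same)) (proj₂ (bad c′))))
              where
              bad : ∀ c → ∃ λ i → tested c i ≋ 0#
              bad c with ¬∀⟶∃¬ (suc k) _ (λ i → ¬? (tested c i ≋? 0#)) (λ good → none (c , good))
              ... | i , ¬¬e = i , decidable-stable (tested c i ≋? 0#) ¬¬e
              collision : ∃ λ c → ∃ λ c′ → c Fin.< c′ × proj₁ (bad c) ≡ proj₁ (bad c′)
              collision = pigeonhole k<q (λ c → proj₁ (bad c))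
              c c′ : Fin q
              c = proj₁ collision
              c′ = proj₁ (proj₂ collision)
              c<c′ : c Fin.< c′
              c<c′ = proj₁ (proj₂ (proj₂ collision))
              same : proj₁ (bad c) ≡ proj₁ (bad c′)
              same = proj₂ (proj₂ (proj₂ collision))

module ChiralCovers where

  open import Data.Empty using (⊥-elim)
  open import Data.Fin.Base using (Fin; zero; suc; toℕ; combine; funToFin)
  open import Data.Fin.Patterns using (0F; 1F)
  open import Data.Fin.Properties using (_≟_; toℕ<n; toℕ-injective; combine-injective)
  open import Data.Integer.Base using (+_; 0ℤ; 1ℤ)
  open import Data.Nat.Base as ℕ using (ℕ; zero; suc; _<_; _≤_; z≤n; NonZero; >-nonZero)
  open import Data.Nat.DivMod using (_%_; _/_; m%n<n; m≡m%n+[m/n]*n)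
  open import Data.Product.Base using (∃; _×_; _,_; proj₁; proj₂)
  open import Data.Sum.Base using (_⊎_; inj₁; inj₂)
  open import Data.Unit.Base using (tt)
  open import Data.Vec.Base using (lookup; []; _∷_)
  open import Function.Base using (_∘_)
  open import Function.Bundles using (_⇔_; mk⇔; Equivalence)
  open import Relation.Binary.PropositionalEquality as ≡ using (_≡_; _≢_; cong; cong₂; subst)
  open import Relation.Nullary using (¬_; yes; no)
  import Data.Nat.Properties as ℕₚ
  import Relation.Binary.Reasoning.Setoid as SetoidReasoning

  open import Defs
  open PresentedGroups
  open TriangleGroups
  open FiniteQuotients
  open Residues
  open Orbits using (Transversal; _⊎-count_; Fin↔)
  open Cocycles
  open Antisymmetric
  open Separation
  open Exponents

  module _ {q : ℕ} (R : ModularRing q) where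
    open ModularRing R

    pow : Carrier → ℕ → Carrier
    pow a zero    = 1#
    pow a (suc k) = a * pow a k

    pow-+ : ∀ a i j → pow a (i ℕ.+ j) ≋ pow a i * pow a j
    pow-+ a zero    j = ≋-sym (*-identityˡ _)
    pow-+ a (suc i) j = ≋-trans (*-cong ≋-refl (pow-+ a i j)) (≋-sym (*-assoc _ _ _))

    module Exponential (a : Carrier) {p : ℕ} (P : ModularRing p) (aᵖ : pow a p ≋ 1#) where
      private
        module P = ModularRing P
        instance
          p≢0 : NonZero p
          p≢0 = >-nonZero (ℕₚ.<-trans ℕₚ.0<1+n P.1<q)

      pow-multiple : ∀ k → pow a (k ℕ.* p) ≋ 1#
      pow-multiple zero    = ≋-refl
      pow-multiple (suc k) = ≋-trans (pow-+ a p (k ℕ.* p))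
        (≋-trans (*-cong aᵖ (pow-multiple k)) (*-identityˡ 1#))

      ι-multiple : ∀ k → P.ι (+ (k ℕ.* p)) P.≋ P.0#
      ι-multiple zero    = P.≋-refl
      ι-multiple (suc k) = P.≋-trans (P.ι-+ (+ p) (+ (k ℕ.* p)))
        (P.≋-trans (P.+-cong P.ι-q (ι-multiple k)) (P.+-identityˡ P.0#))

      pow-% : ∀ i → pow a i ≋ pow a (i % p)
      pow-% i = ≋-trans (≋-reflexive (cong (pow a) (m≡m%n+[m/n]*n i p)))
        (≋-trans (pow-+ a (i % p) (i / p ℕ.* p))
        (≋-trans (*-cong ≋-refl (pow-multiple (i / p))) (*-identityʳ _)))

      ι-% : ∀ i → P.ι (+ i) P.≋ P.ι (+ (i % p))
      ι-% i = P.≋-trans (P.≋-reflexive (cong (λ t → P.ι (+ t)) (m≡m%n+[m/n]*n i p)))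
        (P.≋-trans (P.ι-+ (+ (i % p)) (+ (i / p ℕ.* p)))
        (P.≋-trans (P.+-cong P.≋-refl (ι-multiple (i / p))) (P.+-identityʳ _)))

      pow-cong : ∀ i j → P.ι (+ i) P.≋ P.ι (+ j) → pow a i ≋ pow a j
      pow-cong i j e = ≋-trans (pow-% i) (≋-trans
        (≋-reflexive (cong (pow a) (P.ι-injective (m%n<n i p) (m%n<n j p)
          (P.≋-trans (P.≋-sym (ι-% i)) (P.≋-trans e (ι-% j))))))
        (≋-sym (pow-% j)))

      exp : P.Carrier → Carrier
      exp t = pow a (toℕ (P.residue t))

      exp-cong : ∀ {s t} → s P.≋ t → exp s ≋ exp t
      exp-cong e = ≋-reflexive (cong (λ i → pow a (toℕ i)) (P.residue-cong e))

      exp-0 : exp P.0# ≋ 1#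
      exp-0 = pow-cong (toℕ (P.residue P.0#)) 0 (P.≋-sym (P.ι-residue P.0#))

      exp-+ : ∀ s t → exp (s P.+ t) ≋ exp s * exp t
      exp-+ s t = ≋-trans
        (pow-cong (toℕ (P.residue (s P.+ t))) (toℕ (P.residue s) ℕ.+ toℕ (P.residue t))
          (P.≋-trans (P.≋-sym (P.ι-residue (s P.+ t)))
          (P.≋-trans (P.+-cong (P.ι-residue s) (P.ι-residue t))
                     (P.≋-sym (P.ι-+ (+ toℕ (P.residue s)) (+ toℕ (P.residue t)))))))
        (pow-+ a (toℕ (P.residue s)) (toℕ (P.residue t)))

  module _ {l m n : ℕ} (Q : FiniteQuotient l m n) (S : Section l m n Q) {q : ℕ} (R : ModularRing q) where
    open FiniteQuotient Q
    open Action Q S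
    open ModularRing R
    open RingSolver using (_:=_; _:+_; _:*_; _:-_; :-_; con) renaming (solve to ring)
    open Modular R
    open SetoidReasoning setoid

    exponential : (a : Carrier) {p : ℕ} (P : ModularRing p) → pow R a p ≋ 1# →
                  Modular.Cocycle P (Modular.unscaled P) → Multiplier
    exponential a P aᵖ K = record
      { scale      = λ g w → exp (value g w)
      ; scale-resp = λ g e → exp-cong (value-resp g e)
      ; scale-ε    = λ g → ≋-trans (exp-cong (law-ε g)) exp-0
      ; scale-∙    = λ g u v → ≋-trans
          (exp-cong (P.≋-trans (law-∙ g u v) (P.+-cong P.≋-refl (P.*-identityˡ _))))
          (exp-+ (value g u) (value (g · u) v))
      }
      where
      module P = ModularRing P
      open Exponential R a P aᵖ
      open Modular.Cocycle K

    module Affine (M : Multiplier) (U : Cocycle M) where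
      open Multiplier M
      open Cocycle U

      private
        code : Word Rotation → Fin (size ℕ.* (q ℕ.^ size ℕ.* q ℕ.^ size))
        code w = combine (coset w) (combine (funToFin (λ g → residue (scale g w))) (funToFin (λ g → residue (value g w))))

      infix 4 _≃_
      _≃_ : Word Rotation → Word Rotation → Set
      v ≃ w = coset v ≡ coset w × (∀ g → scale g v ≋ scale g w) × (∀ g → value g v ≋ value g w)

      private
        encode : ∀ {v w} → v ≃ w → code v ≡ code w
        encode (e₁ , e₂ , e₃) = cong₂ combine e₁ (cong₂ combine
          (funToFin-cong (λ g → residue-cong (e₂ g))) (funToFin-cong (λ g → residue-cong (e₃ g))))

        decode : ∀ {v w} → code v ≡ code w → v ≃ w
        decode e with combine-injective _ _ _ _ e
        ... | e₁ , e′ with combine-injective _ _ _ _ e′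
        ... | e₂ , e₃ = e₁ , (λ g → residue-injective (funToFin-injective e₂ g)) , (λ g → residue-injective (funToFin-injective e₃ g))

        ≃-∙ : ∀ {u u′ v v′} → u ≃ u′ → v ≃ v′ → u ∙ v ≃ u′ ∙ v′
        ≃-∙ {u} {u′} {v} {v′} (e₁ , e₂ , e₃) (f₁ , f₂ , f₃) = ∙-resp e₁ f₁
          , (λ g → begin
            scale g (u ∙ v)                ≈⟨ scale-∙ g u v ⟩
            scale g u * scale (g · u) v    ≈⟨ *-cong (e₂ g) (≋-trans (≋-reflexive (cong (λ h → scale h v) (same g))) (f₂ (g · u′))) ⟩
            scale g u′ * scale (g · u′) v′ ≈⟨ scale-∙ g u′ v′ ⟨
            scale g (u′ ∙ v′)              ∎)
          , (λ g → begin
            value g (u ∙ v)                             ≈⟨ law-∙ g u v ⟩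
            value g u + scale g u * value (g · u) v     ≈⟨ +-cong (e₃ g) (*-cong (e₂ g) (≋-trans (move v (same g)) (f₃ (g · u′)))) ⟩
            value g u′ + scale g u′ * value (g · u′) v′ ≈⟨ law-∙ g u′ v′ ⟨
            value g (u′ ∙ v′)                           ∎)
          where
          same : ∀ g → g · u ≡ g · u′
          same g = ∙-resp ≡.refl e₁

      -- Δ acts on G × R × R by affine maps; this is the image of that action.
      cocycleQuotient : FiniteQuotient l m n
      cocycleQuotient = record
        { size   = size ℕ.* (q ℕ.^ size ℕ.* q ℕ.^ size)
        ; coset  = code
        ; resp   = λ {v} {w} e → encode {v} {w} (resp e , (λ g → scale-resp g e) , (λ g → value-resp g e))
        ; ∙-resp = λ {u} {u′} {v} {v′} e f →
            encode {u ∙ v} {u′ ∙ v′} (≃-∙ {u} {u′} {v} {v′} (decode {u} {u′} e) (decode {v} {v′} f))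
        }

      cocycleQuotient⇔ : ∀ {v w} →
        FiniteQuotient.coset cocycleQuotient v ≡ FiniteQuotient.coset cocycleQuotient w ⇔ v ≃ w
      cocycleQuotient⇔ {v} {w} = mk⇔ (decode {v} {w}) (encode {v} {w})

      -- The words that act on G × R × R as translations of the last factor.
      record Translation (w : Word Rotation) : Set where
        constructor translation
        field
          inKer : Ker w
          unit  : ∀ g → scale g w ≋ 1#

      open Translation

      Translation-resp : ∀ {v w} → v ≈ w → Translation v → Translation w
      Translation-resp e t = translation (Ker-resp e (inKer t))
        (λ g → ≋-trans (scale-resp g (sym e)) (unit t g))

      Translation-∙ : ∀ {v w} → Translation v → Translation w → Translation (v ∙ w)
      Translation-∙ {v} {w} s t = translation (Ker-∙ (inKer s) (inKer t)) λ g →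
        ≋-trans (scale-∙ g v w) (≋-trans (*-cong (unit s g) (unit t _)) (*-identityˡ 1#))

      Translation-⁻¹ : ∀ {w} → Translation w → Translation (w ⁻¹)
      Translation-⁻¹ {w} t = translation (Ker-⁻¹ (inKer t)) λ g → begin
        scale g (w ⁻¹)                   ≡⟨ cong (λ h → scale h (w ⁻¹)) (·-Ker g (inKer t)) ⟨
        scale (g · w) (w ⁻¹)             ≈⟨ *-identityˡ _ ⟨
        1# * scale (g · w) (w ⁻¹)        ≈⟨ *-cong (unit t g) ≋-refl ⟨
        scale g w * scale (g · w) (w ⁻¹) ≈⟨ scale-inverse g w ⟩
        1#                               ∎

      Translation-^ : ∀ {w} k → Translation w → Translation (w ^ k)
      Translation-^ zero    t = translation Ker-ε scale-ε
      Translation-^ (suc k) t = Translation-∙ t (Translation-^ k t)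

      scale-Ker-inverse : ∀ g {w} → Ker w → scale g w * scale g (w ⁻¹) ≋ 1#
      scale-Ker-inverse g {w} k = ≋-trans
        (*-cong ≋-refl (≋-reflexive (cong (λ h → scale h (w ⁻¹)) (≡.sym (·-Ker g k))))) (scale-inverse g w)

      scale-Ker-∙ : ∀ g {v} w → Ker v → scale g (v ∙ w) ≋ scale g v * scale g w
      scale-Ker-∙ g {v} w k = ≋-trans (scale-∙ g v w)
        (*-cong ≋-refl (≋-reflexive (cong (λ h → scale h w) (·-Ker g k))))

      Translation-conj : ∀ {v w} → Ker v → Translation w → Translation (v ∙ w ∙ v ⁻¹)
      Translation-conj {v} {w} k t = translation (Ker-conj v (inKer t)) λ g → begin
        scale g (v ∙ w ∙ v ⁻¹)                 ≈⟨ scale-Ker-∙ g (v ⁻¹) (Ker-∙ k (inKer t)) ⟩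
        scale g (v ∙ w) * scale g (v ⁻¹)       ≈⟨ *-cong (scale-Ker-∙ g w k) ≋-refl ⟩
        scale g v * scale g w * scale g (v ⁻¹) ≈⟨ *-cong (*-cong ≋-refl (unit t g)) ≋-refl ⟩
        scale g v * 1# * scale g (v ⁻¹)        ≈⟨ *-cong (*-identityʳ _) ≋-refl ⟩
        scale g v * scale g (v ⁻¹)             ≈⟨ scale-Ker-inverse g k ⟩
        1#                                     ∎

      Translation-commutator : ∀ {v w} → Ker v → Ker w → Translation (v ∙ w ∙ v ⁻¹ ∙ w ⁻¹)
      Translation-commutator {v} {w} j k = translation (Ker-∙ (Ker-conj v k) (Ker-⁻¹ k)) λ g → begin
        scale g (v ∙ w ∙ v ⁻¹ ∙ w ⁻¹)
          ≈⟨ scale-Ker-∙ g (w ⁻¹) (Ker-conj v k) ⟩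
        scale g (v ∙ w ∙ v ⁻¹) * scale g (w ⁻¹)
          ≈⟨ *-cong (≋-trans (scale-Ker-∙ g (v ⁻¹) (Ker-∙ j k)) (*-cong (scale-Ker-∙ g w j) ≋-refl)) ≋-refl ⟩
        scale g v * scale g w * scale g (v ⁻¹) * scale g (w ⁻¹)
          ≈⟨ ring 4 (λ a b c d → a :* b :* c :* d := a :* c :* (b :* d)) ≋-refl _ _ _ _ ⟩
        scale g v * scale g (v ⁻¹) * (scale g w * scale g (w ⁻¹))
          ≈⟨ *-cong (scale-Ker-inverse g j) (scale-Ker-inverse g k) ⟩
        1# * 1#
          ≈⟨ *-identityˡ 1# ⟩
        1# ∎

      value-Ker-∙ : ∀ g {v} w → Ker v → value g (v ∙ w) ≋ value g v + scale g v * value g w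
      value-Ker-∙ g {v} w k = ≋-trans (law-∙ g v w) (+-cong ≋-refl (*-cong ≋-refl (move w (·-Ker g k))))

      value-Translation-∙ : ∀ g {v} w → Translation v → value g (v ∙ w) ≋ value g v + value g w
      value-Translation-∙ g w t = ≋-trans (value-Ker-∙ g w (inKer t))
        (+-cong ≋-refl (≋-trans (*-cong (unit t g) ≋-refl) (*-identityˡ _)))

      value-Translation-^ : ∀ g {w} k → Translation w → value g (w ^ k) ≋ ι (+ k) * value g w
      value-Translation-^ g {w} zero    t = ≋-trans (law-ε g) (≋-sym (zeroˡ _))
      value-Translation-^ g {w} (suc k) t = begin
        value g (w ∙ w ^ k)                ≈⟨ value-Translation-∙ g (w ^ k) t ⟩
        value g w + value g (w ^ k)        ≈⟨ +-cong ≋-refl (value-Translation-^ g k t) ⟩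
        value g w + ι (+ k) * value g w    ≈⟨ ring 2 (λ a k → a :+ k :* a := (con 1ℤ :+ k) :* a) ≋-refl (value g w) (ι (+ k)) ⟩
        (1# + ι (+ k)) * value g w         ≈⟨ *-cong (ι-+ (+ 1) (+ k)) ≋-refl ⟨
        ι (+ suc k) * value g w            ∎

      value-Translation-⁻¹ : ∀ g {w} → Translation w → value g (w ⁻¹) ≋ - value g w
      value-Translation-⁻¹ g {w} t = begin
        value g (w ⁻¹)                          ≈⟨ ring 2 (λ a b → a := :- b :+ (b :+ a)) ≋-refl (value g (w ⁻¹)) (value g w) ⟩
        - value g w + (value g w + value g (w ⁻¹)) ≈⟨ +-cong ≋-refl (≋-sym (value-Translation-∙ g (w ⁻¹) t)) ⟩
        - value g w + value g (w ∙ w ⁻¹)        ≈⟨ +-cong ≋-refl (value-trivial g (inverseʳ w)) ⟩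
        - value g w + 0#                        ≈⟨ +-identityʳ _ ⟩
        - value g w                             ∎

      value-Translation-conj : ∀ g {v w} → Ker v → Translation w → value g (v ∙ w ∙ v ⁻¹) ≋ scale g v * value g w
      value-Translation-conj g {v} {w} k t = begin
        value g (v ∙ w ∙ v ⁻¹)
          ≈⟨ value-Ker-∙ g (v ⁻¹) (Ker-∙ k (inKer t)) ⟩
        value g (v ∙ w) + scale g (v ∙ w) * value g (v ⁻¹)
          ≈⟨ +-cong (value-Ker-∙ g w k) (*-cong (≋-trans (scale-Ker-∙ g w k) (≋-trans (*-cong ≋-refl (unit t g)) (*-identityʳ _))) ≋-refl) ⟩
        value g v + scale g v * value g w + scale g v * value g (v ⁻¹)
          ≈⟨ ring 3 (λ a b c → a :+ b :+ c := (a :+ c) :+ b) ≋-refl _ _ _ ⟩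
        value g v + scale g v * value g (v ⁻¹) + scale g v * value g w
          ≈⟨ +-cong (≋-trans (≋-sym (value-Ker-∙ g (v ⁻¹) k)) (value-trivial g (inverseʳ v))) ≋-refl ⟩
        0# + scale g v * value g w
          ≈⟨ +-identityˡ _ ⟩
        scale g v * value g w ∎

      -- On translations, conjugation by v followed by subtraction of the c-fold
      -- multiplies the value at g by scale g v - c.
      eliminate : Word Rotation → ℕ → Word Rotation → Word Rotation
      eliminate v c w = v ∙ w ∙ v ⁻¹ ∙ (w ^ c) ⁻¹

      Translation-eliminate : ∀ {v} c {w} → Ker v → Translation w → Translation (eliminate v c w)
      Translation-eliminate c k t = Translation-∙ (Translation-conj k t) (Translation-⁻¹ (Translation-^ c t))

      value-eliminate : ∀ g {v} c {w} → Ker v → Translation w →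
        value g (eliminate v c w) ≋ (scale g v - ι (+ c)) * value g w
      value-eliminate g {v} c {w} k t = begin
        value g (v ∙ w ∙ v ⁻¹ ∙ (w ^ c) ⁻¹)
          ≈⟨ value-Translation-∙ g ((w ^ c) ⁻¹) (Translation-conj k t) ⟩
        value g (v ∙ w ∙ v ⁻¹) + value g ((w ^ c) ⁻¹)
          ≈⟨ +-cong (value-Translation-conj g k t) (≋-trans (value-Translation-⁻¹ g (Translation-^ c t))
               (-‿cong (value-Translation-^ g c t))) ⟩
        scale g v * value g w + - (ι (+ c) * value g w)
          ≈⟨ ring 3 (λ s c a → s :* a :+ :- (c :* a) := (s :- c) :* a) ≋-refl _ _ _ ⟩
        (scale g v - ι (+ c)) * value g w ∎

  mirror-eliminate : ∀ v c w → mirror (v ∙ w ∙ v ⁻¹ ∙ (w ^ c) ⁻¹) ≡ mirror v ∙ mirror w ∙ mirror v ⁻¹ ∙ (mirror w ^ c) ⁻¹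
  mirror-eliminate v c w = cong (λ u → mirror v ∙ mirror w ∙ mirror v ⁻¹ ∙ u ⁻¹) (substitute-^ _ w c)

  module _ {l m n : ℕ} (RQ : RegularQuotient l m n) (hyp : Hyperbolic l m n)
           {p : ℕ} (P : ModularRing p) {q : ℕ} (R : ModularRing q) where
    open RegularQuotient RQ
    open ModularRing R
    open RingSolver using (_:=_; _:+_; _:*_; _:-_; :-_; con) renaming (solve to ring)
    open Modular R
    open SetoidReasoning setoid
    private module P = ModularRing P

    module _ (ω : Carrier) (ωᵖ : pow R ω p ≋ 1#)
             (ω-regular : ∀ {i j} → i < p → j < p → i ≢ j → ∀ t → (pow R ω i - pow R ω j) * t ≋ 0# → t ≋ 0#)
             (κ : Modular.Cocycle P (Modular.unscaled P))
             (κ-distinguishes : ∀ g → ∃ λ v → Ker v × ¬ (Modular.Cocycle.value κ g v P.≋ Modular.Cocycle.value κ 𝟙 (mirror v)))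
             where

      private
        module κ = Modular.Cocycle κ
        open Exponential R ω P ωᵖ

        M : Multiplier
        M = exponential quotient section R ω P ωᵖ κ
        open Multiplier M

      exp-regular : ∀ {s t} → ¬ (s P.≋ t) → ∀ a → (exp s - exp t) * a ≋ 0# → a ≋ 0#
      exp-regular {s} {t} ne = ω-regular (toℕ<n (P.residue s)) (toℕ<n (P.residue t))
        (λ e → ne (P.residue-injective (toℕ-injective e)))

      nontrivial : ∃ λ v → Ker v × ¬ (κ.value 𝟙 v P.≋ P.0#)
      nontrivial with κ-distinguishes 𝟙
      ... | v , k , ne with κ.value 𝟙 v P.≋? P.0#
      ... | no ne′ = v , k , ne′
      ... | yes e = mirror v , mirror-Ker k , λ e′ → ne (P.≋-trans e (P.≋-sym e′))

      n₀ : Word Rotation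
      n₀ = proj₁ nontrivial

      n₀∈Ker : Ker n₀
      n₀∈Ker = proj₁ (proj₂ nontrivial)

      gaugeWord : G → Word Rotation
      gaugeWord g with g ≟ 𝟙
      ... | yes _ = n₀
      ... | no  _ = rep g

      coset-gaugeWord : ∀ g → coset (gaugeWord g) ≡ g
      coset-gaugeWord g with g ≟ 𝟙
      ... | yes ≡.refl = n₀∈Ker
      ... | no  _      = coset-rep g

      gaugeWord-𝟙 : gaugeWord 𝟙 ≡ n₀
      gaugeWord-𝟙 with 𝟙 ≟ 𝟙
      ... | yes _  = ≡.refl
      ... | no  ne = ⊥-elim (ne ≡.refl)

      private
        module Cyc (a : Rotation) where
          open RotationCycles RQ a public
          module C = Transversal cycles

          k : ℕ
          k = order l m n a

          bound : C.count ℕ.* (2 ℕ.* k) ≤ size ℕ.+ size ℕ.+ 0 ℕ.* k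
          bound = ℕₚ.≤-trans (ℕₚ.≤-reflexive (rearrange C.count k))
            (ℕₚ.≤-trans (ℕₚ.+-mono-≤ cycles-bound cycles-bound) (ℕₚ.m≤m+n _ 0))
            where
            open import Data.Nat.Tactic.RingSolver using (solve-∀)
            rearrange : ∀ c k → c ℕ.* (2 ℕ.* k) ≡ c ℕ.* k ℕ.+ c ℕ.* k
            rearrange = solve-∀

        A B : Set
        A = G ⊎ G
        B = Fin (Cyc.C.count ξ) ⊎ Fin (Cyc.C.count η) ⊎ Fin (Cyc.C.count ζ) ⊎ G

        edges : (A → Carrier) → Rotation → G → Carrier
        edges v = generators M (v ∘ inj₁) (v ∘ inj₂)

        u : (A → Carrier) → G → Word Rotation → Carrier
        u v = extend M (edges v)

        u-minus : ∀ v w g t → u (λ a → v a - w a) g t ≋ u v g t - u w g t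
        u-minus v w = extend-minus M (generators-minus M (λ _ → ≋-refl) (λ _ → ≋-refl))

        L : (A → Carrier) → B → Carrier
        L v (inj₁ i)               = u v (Cyc.C.rep ξ i) (x ^ l)
        L v (inj₂ (inj₁ i))        = u v (Cyc.C.rep η i) (y ^ m)
        L v (inj₂ (inj₂ (inj₁ i))) = u v (Cyc.C.rep ζ i) (z ^ n)
        L v (inj₂ (inj₂ (inj₂ g))) = u v 𝟙 (gaugeWord g)

        L-minus : ∀ v w j → L (λ a → v a - w a) j ≋ L v j - L w j
        L-minus v w (inj₁ i)               = u-minus v w _ (x ^ l)
        L-minus v w (inj₂ (inj₁ i))        = u-minus v w _ (y ^ m)
        L-minus v w (inj₂ (inj₂ (inj₁ i))) = u-minus v w _ (z ^ n)
        L-minus v w (inj₂ (inj₂ (inj₂ g))) = u-minus v w 𝟙 (gaugeWord g)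

        fewer : Cyc.C.count ξ ℕ.+ (Cyc.C.count η ℕ.+ (Cyc.C.count ζ ℕ.+ size)) < size ℕ.+ size
        fewer = euler-count {l} {m} {n} {size ℕ.+ size} {Cyc.C.count ξ} {Cyc.C.count η} {Cyc.C.count ζ}
          {size} {size} {size} {0} {0} {0} {0} {0} {0} hyp
          (ℕₚ.<-≤-trans (Cyc.size-pos ξ) (ℕₚ.m≤m+n size size)) (Cyc.bound ξ) (Cyc.bound η) (Cyc.bound ζ) z≤n z≤n z≤n
          (ℕₚ.≤-reflexive (twice size)) (ℕₚ.≤-reflexive (≡.sym (twice′ size))) (ℕₚ.≤-reflexive (≡.sym (twice′ size)))
          where
          open import Data.Nat.Tactic.RingSolver using (solve-∀)
          twice : ∀ d → d ℕ.* 2 ℕ.+ 0 ≡ d ℕ.+ d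
          twice = solve-∀
          twice′ : ∀ d → d ℕ.* 2 ≡ d ℕ.+ d ℕ.+ 0
          twice′ = solve-∀

      record Gauged : Set where
        field
          cocycleᵍ : Cocycle M
          gauge    : ∀ g → Cocycle.value cocycleᵍ 𝟙 (gaugeWord g) ≋ 0#
          nonzero  : ∃ λ a → ∃ λ g → Cocycle.value cocycleᵍ g (gen a) ≋̸ 0#

      private
        module FromSolution (v : A → Carrier) (v≢0 : ∃ λ a → v a ≋̸ 0#) (solves : ∀ j → L v j ≋ 0#) where

          crossed : Crossed M (u v)
          crossed = extend-crossed M (edges v)

          u-product : ∀ g → u v g (x ∙ y ∙ z) ≋ 0#
          u-product = extend-product M (v ∘ inj₁) (v ∘ inj₂)

          spread : ∀ a → (∀ i → u v (Cyc.C.rep a i) (gen a ^ order l m n a) ≋ 0#) →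
                   ∀ g → u v g (gen a ^ order l m n a) ≋ 0#
          spread a zeros g with Cyc.C.covers a g tt
          ... | i , r@(j , _) = ≋-trans
            (≋-reflexive (cong (λ h → u v h (gen a ^ order l m n a)) (≡.sym (Cyc.∼⇒· a r))))
            (power-shift M crossed u-product a (toℕ j) (Cyc.C.rep a i) (zeros i))

          kill : ∀ a g → u v g (gen a ^ order l m n a) ≋ 0#
          kill ξ = spread ξ (λ i → solves (inj₁ i))
          kill η = spread η (λ i → solves (inj₂ (inj₁ i)))
          kill ζ = spread ζ (λ i → solves (inj₂ (inj₂ (inj₁ i))))

          edge : (∃ λ a → v a ≋̸ 0#) → ∃ λ a → ∃ λ g → u v g (gen a) ≋̸ 0#
          edge (inj₁ g , ne) = η , g , ne
          edge (inj₂ g , ne) = ζ , g , ne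

          result : Gauged
          result = record
            { cocycleᵍ = cocycle M crossed u-product kill
            ; gauge    = λ g → solves (inj₂ (inj₂ (inj₂ g)))
            ; nonzero  = edge v≢0
            }

      abstract
        gauged : Gauged
        gauged =
          let v , v≢0 , solves = nontrivial-solution′ R (Fin↔ ⊎-count Fin↔)
                (Fin↔ ⊎-count Fin↔ ⊎-count Fin↔ ⊎-count Fin↔) fewer L L-minus
          in FromSolution.result v v≢0 solves

      open Gauged gauged
      private
        U : Cocycle M
        U = cocycleᵍ
      open Cocycle U using (value; value-resp; law-∙; law-ε; law-⁻¹; move)
      open Affine quotient section R M U

      loop : ∃ λ w → Ker w × value 𝟙 w ≋̸ 0#
      loop with nonzero
      ... | a , g , ne = gaugeWord g ∙ gen a ∙ gaugeWord h ⁻¹ , inKer , λ e → ne (scale-cancel 𝟙 (gaugeWord g) (begin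
        scale 𝟙 (gaugeWord g) * value g (gen a)
          ≈⟨ *-cong ≋-refl (move (gen a) (to g)) ⟨
        scale 𝟙 (gaugeWord g) * value (𝟙 · gaugeWord g) (gen a)
          ≈⟨ +-identityˡ _ ⟨
        0# + scale 𝟙 (gaugeWord g) * value (𝟙 · gaugeWord g) (gen a)
          ≈⟨ +-cong (gauge g) ≋-refl ⟨
        value 𝟙 (gaugeWord g) + scale 𝟙 (gaugeWord g) * value (𝟙 · gaugeWord g) (gen a)
          ≈⟨ law-∙ 𝟙 (gaugeWord g) (gen a) ⟨
        value 𝟙 (gaugeWord g ∙ gen a)
          ≈⟨ ring 2 (λ a s → a := a :+ s :* con 0ℤ) ≋-refl _ (scale 𝟙 (gaugeWord g ∙ gen a)) ⟩
        value 𝟙 (gaugeWord g ∙ gen a) + scale 𝟙 (gaugeWord g ∙ gen a) * 0#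
          ≈⟨ +-cong ≋-refl (*-cong ≋-refl (≋-trans (move _ there) back)) ⟨
        value 𝟙 (gaugeWord g ∙ gen a) + scale 𝟙 (gaugeWord g ∙ gen a) * value (𝟙 · (gaugeWord g ∙ gen a)) (gaugeWord h ⁻¹)
          ≈⟨ law-∙ 𝟙 (gaugeWord g ∙ gen a) (gaugeWord h ⁻¹) ⟨
        value 𝟙 (gaugeWord g ∙ gen a ∙ gaugeWord h ⁻¹)
          ≈⟨ e ⟩
        0# ∎))
        where
        h : G
        h = g · gen a
        to : ∀ g → 𝟙 · gaugeWord g ≡ g
        to g = ≡.trans (𝟙· (gaugeWord g)) (coset-gaugeWord g)
        there : 𝟙 · (gaugeWord g ∙ gen a) ≡ h
        there = ≡.trans (·-∙ 𝟙 (gaugeWord g) (gen a)) (cong (_· gen a) (to g))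
        home : h · gaugeWord h ⁻¹ ≡ 𝟙
        home = ≡.trans (cong (_· gaugeWord h ⁻¹) (≡.sym (to h))) (·-inverseʳ 𝟙 (gaugeWord h))
        inKer : Ker (gaugeWord g ∙ gen a ∙ gaugeWord h ⁻¹)
        inKer = ≡.trans (≡.sym (𝟙· _)) (≡.trans (·-∙ 𝟙 _ _) (≡.trans (cong (_· gaugeWord h ⁻¹) there) home))
        back : value h (gaugeWord h ⁻¹) ≋ 0#
        back = begin
          value h (gaugeWord h ⁻¹)                                            ≈⟨ law-⁻¹ h (gaugeWord h) ⟩
          - (scale h (gaugeWord h ⁻¹) * value (h · gaugeWord h ⁻¹) (gaugeWord h)) ≈⟨ -‿cong (*-cong ≋-refl (≋-trans (move _ home) (gauge h))) ⟩
          - (scale h (gaugeWord h ⁻¹) * 0#)                                   ≈⟨ ring 1 (λ s → :- (s :* con 0ℤ) := con 0ℤ) ≋-refl _ ⟩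
          0#                                                                  ∎

      -- The value of the commutator of n₀ and w is (scale 𝟙 n₀ - 1) times that
      -- of w, because the value of n₀ is zero.
      commutator-value : ∀ w → Ker w → value 𝟙 (n₀ ∙ w ∙ n₀ ⁻¹ ∙ w ⁻¹) ≋ 0# → value 𝟙 w ≋ 0#
      commutator-value w k e = exp-regular (proj₂ (proj₂ nontrivial)) (value 𝟙 w) (begin
        (scale 𝟙 n₀ - exp P.0#) * value 𝟙 w
          ≈⟨ *-cong (+-cong ≋-refl (-‿cong exp-0)) ≋-refl ⟩
        (scale 𝟙 n₀ - 1#) * value 𝟙 w
          ≈⟨ ring 2 (λ s a → (s :- con 1ℤ) :* a := (con 0ℤ :+ s :* a) :- a) ≋-refl _ _ ⟩
        0# + scale 𝟙 n₀ * value 𝟙 w - value 𝟙 w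
          ≈⟨ +-cong (+-cong zero-n₀ ≋-refl) ≋-refl ⟨
        value 𝟙 n₀ + scale 𝟙 n₀ * value 𝟙 w - value 𝟙 w
          ≈⟨ +-cong (value-Ker-∙ 𝟙 w n₀∈Ker) ≋-refl ⟨
        value 𝟙 (n₀ ∙ w) - value 𝟙 w
          ≈⟨ +-cong (value-resp 𝟙 (solve (lookup (n₀ ∷ w ∷ [])) (gen 0F ∙ gen 1F)
               (gen 0F ∙ gen 1F ∙ gen 0F ⁻¹ ∙ gen 1F ⁻¹ ∙ (gen 1F ∙ gen 0F)) ≡.refl)) ≋-refl ⟩
        value 𝟙 (n₀ ∙ w ∙ n₀ ⁻¹ ∙ w ⁻¹ ∙ (w ∙ n₀)) - value 𝟙 w
          ≈⟨ +-cong (value-Translation-∙ 𝟙 (w ∙ n₀)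
               (Translation-commutator n₀∈Ker k)) ≋-refl ⟩
        value 𝟙 (n₀ ∙ w ∙ n₀ ⁻¹ ∙ w ⁻¹) + value 𝟙 (w ∙ n₀) - value 𝟙 w
          ≈⟨ +-cong (+-cong e (value-Ker-∙ 𝟙 n₀ k)) ≋-refl ⟩
        0# + (value 𝟙 w + scale 𝟙 w * value 𝟙 n₀) - value 𝟙 w
          ≈⟨ +-cong (+-cong ≋-refl (+-cong ≋-refl (*-cong ≋-refl zero-n₀))) ≋-refl ⟩
        0# + (value 𝟙 w + scale 𝟙 w * 0#) - value 𝟙 w
          ≈⟨ ring 2 (λ a s → con 0ℤ :+ (a :+ s :* con 0ℤ) :- a := con 0ℤ) ≋-refl _ _ ⟩
        0# ∎)
        where
        zero-n₀ : value 𝟙 n₀ ≋ 0#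
        zero-n₀ = ≋-trans (≋-reflexive (cong (value 𝟙) (≡.sym gaugeWord-𝟙))) (gauge 𝟙)

      record Chiral-candidate {k} (point : Fin k → G) : Set where
        field
          word      : Word Rotation
          moves     : Translation word
          moves′    : Translation (mirror word)
          survives  : value 𝟙 (mirror word) ≋̸ 0#
          vanishes  : ∀ i → value (point i) word ≋ 0#

      candidate : ∀ k (point : Fin k → G) → Chiral-candidate point
      candidate zero point with loop
      ... | w , k , ne = record
        { word     = mirror v
        ; moves    = Translation-commutator (mirror-Ker n₀∈Ker) (mirror-Ker k)
        ; moves′   = Translation-resp (sym (mirror-involutive v))
                       (Translation-commutator n₀∈Ker k)
        ; survives = λ e → ne (commutator-value w k (≋-trans (value-resp 𝟙 (sym (mirror-involutive v))) e))
        ; vanishes = λ ()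
        }
        where
        v : Word Rotation
        v = n₀ ∙ w ∙ n₀ ⁻¹ ∙ w ⁻¹
      candidate (suc k) point with candidate k (point ∘ suc) | κ-distinguishes (point zero)
      ... | C | v , v∈ , ne = record
        { word     = eliminate v c C.word
        ; moves    = Translation-eliminate c v∈ C.moves
        ; moves′   = subst Translation (≡.sym (mirror-eliminate v c C.word))
                       (Translation-eliminate c (mirror-Ker v∈) C.moves′)
        ; survives = λ e → C.survives (exp-regular (λ e′ → ne (P.≋-sym e′)) (value 𝟙 (mirror C.word)) (begin
            (scale 𝟙 (mirror v) - scale (point zero) v) * value 𝟙 (mirror C.word)
              ≈⟨ *-cong (+-cong ≋-refl (-‿cong (ι-residue _))) ≋-refl ⟩
            (scale 𝟙 (mirror v) - ι (+ c)) * value 𝟙 (mirror C.word)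
              ≈⟨ value-eliminate 𝟙 c (mirror-Ker v∈) C.moves′ ⟨
            value 𝟙 (eliminate (mirror v) c (mirror C.word))
              ≡⟨ cong (value 𝟙) (mirror-eliminate v c C.word) ⟨
            value 𝟙 (mirror (eliminate v c C.word))
              ≈⟨ e ⟩
            0# ∎))
        ; vanishes = vanishes
        }
        where
        module C = Chiral-candidate C
        c : ℕ
        c = toℕ (residue (scale (point zero) v))
        vanishes : ∀ i → value (point i) (eliminate v c C.word) ≋ 0#
        vanishes zero = begin
          value (point zero) (eliminate v c C.word)
            ≈⟨ value-eliminate (point zero) c v∈ C.moves ⟩
          (scale (point zero) v - ι (+ c)) * value (point zero) C.word
            ≈⟨ *-cong (minus≋0 (ι-residue _)) ≋-refl ⟩
          0# * value (point zero) C.word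
            ≈⟨ zeroˡ _ ⟩
          0# ∎
        vanishes (suc i) = begin
          value (point (suc i)) (eliminate v c C.word)
            ≈⟨ value-eliminate (point (suc i)) c v∈ C.moves ⟩
          (scale (point (suc i)) v - ι (+ c)) * value (point (suc i)) C.word
            ≈⟨ *-cong ≋-refl (C.vanishes i) ⟩
          (scale (point (suc i)) v - ι (+ c)) * 0#
            ≈⟨ zeroʳ _ ⟩
          0# ∎

      chiral-quotient : ∃ λ (K : FiniteQuotient l m n) → (∀ {w} → FiniteQuotient.Ker K w → Ker w) ×
        ∃ λ w → FiniteQuotient.Ker K w × ¬ FiniteQuotient.Ker K (mirror w)
      chiral-quotient = K
        , (λ {w} k → proj₁ (to (⇔ {w} {ε}) k))
        , word
        , from (⇔ {word} {ε}) (inKer , (λ g → ≋-trans (unit g) (≋-sym (scale-ε g)))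
                                     , (λ g → ≋-trans (vanishes g) (≋-sym (law-ε g))))
        , λ k → survives (≋-trans (proj₂ (proj₂ (to (⇔ {mirror word} {ε}) k)) 𝟙) (law-ε 𝟙))
        where
        open Equivalence
        open Chiral-candidate (candidate size (λ g → g))
        open Translation moves
        K : FiniteQuotient l m n
        K = cocycleQuotient
        ⇔ : ∀ {v w} → FiniteQuotient.coset K v ≡ FiniteQuotient.coset K w ⇔ v ≃ w
        ⇔ {v} {w} = cocycleQuotient⇔ {v} {w}

module PrimeModuli where

  open import Data.Empty using (⊥-elim)
  open import Data.Integer.Base using (+_; 0ℤ; 1ℤ)
  open import Data.List.Base using ([]; _∷_)
  open import Data.List.Relation.Unary.All using (_∷_)
  open import Data.Nat.Base as ℕ using (ℕ; zero; suc; _<_; _≤_; _∸_; _!; NonZero; >-nonZero; nonTrivial⇒n>1; s≤s; z≤n)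
  open import Data.Nat.Coprimality using (Coprime; coprime-Bézout; prime⇒coprime)
  open import Data.Nat.Divisibility using (_∣_; ∣-trans; m≤n⇒m!∣n!; m∣m*n; ∣m+n∣m⇒∣n; ∣⇒≤)
  open import Data.Nat.GCD using (module Bézout)
  open import Data.Nat.Primality using (Prime; prime⇒nonTrivial; prime⇒nonZero)
  open import Data.Nat.Primality.Factorisation using (factorise)
  open import Data.Product.Base using (∃; _×_; _,_; proj₁; proj₂)
  open import Relation.Binary.Definitions using (tri<; tri≈; tri>)
  open import Relation.Binary.PropositionalEquality as ≡ using (_≡_; _≢_; cong; subst)
  open import Relation.Nullary using (¬_)
  import Data.Nat.Properties as ℕₚ
  import Relation.Binary.Reasoning.Setoid as SetoidReasoning

  open TriangleGroups using (mirror)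
  open FiniteQuotients using (FiniteQuotient)
  open Residues
  open Antisymmetric using (RegularQuotient)
  open Separation using (Hyperbolic)
  open Exponents using (Distinguishes; distinguish-all)
  open ChiralCovers using (pow; pow-+; chiral-quotient)

  prime-divisor : ∀ k → 1 < k → ∃ λ p → Prime p × p ∣ k
  prime-divisor k 1<k with factorise k {{>-nonZero (ℕₚ.<-trans ℕₚ.0<1+n 1<k)}}
  ... | record { factors = [] ; isFactorisation = e } = ⊥-elim (ℕₚ.<-irrefl (≡.sym e) 1<k)
  ... | record { factors = p ∷ ps ; isFactorisation = e ; factorsPrime = prime-p ∷ _ } =
    p , prime-p , subst (p ∣_) (≡.sym e) (m∣m*n _)

  prime-above : ∀ b → ∃ λ p → Prime p × b < p
  prime-above b with prime-divisor (suc (b !)) (s≤s (ℕₚ.1≤n! b))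
  ... | p , prime-p , p∣ = p , prime-p , ℕₚ.≰⇒> λ p≤b →
    ℕₚ.<⇒≱ (nonTrivial⇒n>1 p {{prime⇒nonTrivial prime-p}})
      (∣⇒≤ (∣m+n∣m⇒∣n (subst (p ∣_) (ℕₚ.+-comm 1 (b !)) p∣) (∣-trans (p∣p! p {{prime⇒nonZero prime-p}}) (m≤n⇒m!∣n! p≤b))))
    where
    p∣p! : ∀ p .{{_ : NonZero p}} → p ∣ p !
    p∣p! (suc p) = m∣m*n (p !)

  module _ {q : ℕ} (R : ModularRing q) where
    open ModularRing R
    open RingSolver using (_:=_; _:+_; _:*_; _:-_; :-_; con) renaming (solve to ring)
    open SetoidReasoning setoid

    ι-ℕ-* : ∀ i j → ι (+ (i ℕ.* j)) ≋ ι (+ i) * ι (+ j)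
    ι-ℕ-* i j = ≋-trans (≋-reflexive (cong ι (pos-* i j))) (ι-* (+ i) (+ j))
      where open import Data.Integer.Properties using (pos-*)

    coprime-regular : ∀ {k} → Coprime q k → ∀ t → ι (+ k) * t ≋ 0# → t ≋ 0#
    coprime-regular {k} c t e with coprime-Bézout c
    ... | Bézout.+- a b eq = begin
      t                              ≈⟨ ring 2 (λ t b → t := con 1ℤ :* t :+ b :* con 0ℤ) ≋-refl t (ι (+ b)) ⟩
      1# * t + ι (+ b) * 0#          ≈⟨ +-cong ≋-refl (*-cong ≋-refl e) ⟨
      1# * t + ι (+ b) * (ι (+ k) * t) ≈⟨ ring 3 (λ t b k → con 1ℤ :* t :+ b :* (k :* t) := (con 1ℤ :+ b :* k) :* t) ≋-refl t (ι (+ b)) (ι (+ k)) ⟩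
      (1# + ι (+ b) * ι (+ k)) * t   ≈⟨ *-cong (≋-trans (+-cong ≋-refl (≋-sym (ι-ℕ-* b k))) (≋-sym (ι-+ (+ 1) (+ (b ℕ.* k))))) ≋-refl ⟩
      ι (+ (1 ℕ.+ b ℕ.* k)) * t      ≡⟨ cong (λ i → ι (+ i) * t) eq ⟩
      ι (+ (a ℕ.* q)) * t            ≈⟨ *-cong (≋-trans (ι-ℕ-* a q) (*-cong ≋-refl ι-q)) ≋-refl ⟩
      ι (+ a) * 0# * t               ≈⟨ ring 2 (λ a t → a :* con 0ℤ :* t := con 0ℤ) ≋-refl (ι (+ a)) t ⟩
      0#                             ∎
    ... | Bézout.-+ a b eq = begin
      t                              ≈⟨ ring 2 (λ t a → t := (con 1ℤ :+ a :* con 0ℤ) :* t) ≋-refl t (ι (+ a)) ⟩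
      (1# + ι (+ a) * 0#) * t        ≈⟨ *-cong (+-cong ≋-refl (*-cong ≋-refl ι-q)) ≋-refl ⟨
      (1# + ι (+ a) * ι (+ q)) * t   ≈⟨ *-cong (≋-trans (+-cong ≋-refl (≋-sym (ι-ℕ-* a q))) (≋-sym (ι-+ (+ 1) (+ (a ℕ.* q))))) ≋-refl ⟩
      ι (+ (1 ℕ.+ a ℕ.* q)) * t      ≡⟨ cong (λ i → ι (+ i) * t) eq ⟩
      ι (+ (b ℕ.* k)) * t            ≈⟨ *-cong (ι-ℕ-* b k) ≋-refl ⟩
      ι (+ b) * ι (+ k) * t          ≈⟨ *-assoc _ _ _ ⟩
      ι (+ b) * (ι (+ k) * t)        ≈⟨ *-cong ≋-refl e ⟩
      ι (+ b) * 0#                   ≈⟨ zeroʳ _ ⟩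
      0#                             ∎

    pow-fixes : ∀ {a t} k → a * t ≋ t → pow R a k * t ≋ t
    pow-fixes zero    e = *-identityˡ _
    pow-fixes {a} {t} (suc k) e = begin
      a * pow R a k * t   ≈⟨ *-assoc _ _ _ ⟩
      a * (pow R a k * t) ≈⟨ *-cong ≋-refl (pow-fixes k e) ⟩
      a * t               ≈⟨ e ⟩
      t                   ∎

    pow-* : ∀ a i j → pow R a (i ℕ.* j) ≋ pow R (pow R a j) i
    pow-* a zero    j = ≋-refl
    pow-* a (suc i) j = ≋-trans (pow-+ R a j (i ℕ.* j)) (*-cong ≋-refl (pow-* a i j))

    -- By Bézout, aʳ t = t implies a t = t whenever 0 < r < p.
    module _ {p : ℕ} (prime-p : Prime p) (a : Carrier) (aᵖ : pow R a p ≋ 1#)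
             (a-1-regular : ∀ t → (a - 1#) * t ≋ 0# → t ≋ 0#) where

      private
        aᵖ-fixes : ∀ t → pow R a p * t ≋ t
        aᵖ-fixes t = ≋-trans (*-cong aᵖ ≋-refl) (*-identityˡ t)

        root-fixes : ∀ {r t} → 0 < r → r < p → pow R a r * t ≋ t → a * t ≋ t
        root-fixes {r} {t} 0<r r<p e with coprime-Bézout (prime⇒coprime prime-p {{>-nonZero 0<r}} r<p)
        ... | Bézout.+- c d eq = begin
          a * t                                ≈⟨ *-cong ≋-refl (pow-fixes d e) ⟨
          a * (pow R (pow R a r) d * t)        ≈⟨ *-cong ≋-refl (*-cong (pow-* a d r) ≋-refl) ⟨
          a * (pow R a (d ℕ.* r) * t)          ≈⟨ *-assoc _ _ _ ⟨
          pow R a (1 ℕ.+ d ℕ.* r) * t          ≡⟨ cong (λ i → pow R a i * t) eq ⟩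
          pow R a (c ℕ.* p) * t                ≈⟨ *-cong (pow-* a c p) ≋-refl ⟩
          pow R (pow R a p) c * t              ≈⟨ pow-fixes c (aᵖ-fixes t) ⟩
          t                                    ∎
        ... | Bézout.-+ c d eq = begin
          a * t                                ≈⟨ *-cong ≋-refl (pow-fixes c (aᵖ-fixes t)) ⟨
          a * (pow R (pow R a p) c * t)        ≈⟨ *-cong ≋-refl (*-cong (pow-* a c p) ≋-refl) ⟨
          a * (pow R a (c ℕ.* p) * t)          ≈⟨ *-assoc _ _ _ ⟨
          pow R a (1 ℕ.+ c ℕ.* p) * t          ≡⟨ cong (λ i → pow R a i * t) eq ⟩
          pow R a (d ℕ.* r) * t                ≈⟨ *-cong (pow-* a d r) ≋-refl ⟩
          pow R (pow R a r) d * t              ≈⟨ pow-fixes d e ⟩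
          t                                    ∎

        difference-regular : ∀ {i j} → i < j → j < p → ∀ t → pow R a i * t ≋ pow R a j * t → t ≋ 0#
        difference-regular {i} {j} i<j j<p t e = a-1-regular t (begin
          (a - 1#) * t     ≈⟨ ring 2 (λ a t → (a :- con 1ℤ) :* t := a :* t :- t) ≋-refl a t ⟩
          a * t - t        ≈⟨ minus≋0 (root-fixes (ℕₚ.m<n⇒0<n∸m i<j) (ℕₚ.≤-<-trans (ℕₚ.m∸n≤m j i) j<p) aʳt≋t) ⟩
          0#               ∎)
          where
          s r : ℕ
          s = p ∸ i
          r = j ∸ i
          i≤p : i ≤ p
          i≤p = ℕₚ.<⇒≤ (ℕₚ.<-trans i<j j<p)
          around : ∀ t → pow R a s * (pow R a i * t) ≋ t
          around t = begin
            pow R a s * (pow R a i * t)  ≈⟨ *-assoc _ _ _ ⟨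
            pow R a s * pow R a i * t    ≈⟨ *-cong (pow-+ R a s i) ≋-refl ⟨
            pow R a (s ℕ.+ i) * t        ≡⟨ cong (λ k → pow R a k * t) (ℕₚ.m∸n+n≡m i≤p) ⟩
            pow R a p * t                ≈⟨ aᵖ-fixes t ⟩
            t                            ∎
          aʳt≋t : pow R a r * t ≋ t
          aʳt≋t = begin
            pow R a r * t                            ≈⟨ around _ ⟨
            pow R a s * (pow R a i * (pow R a r * t)) ≈⟨ *-cong ≋-refl (*-assoc _ _ _) ⟨
            pow R a s * (pow R a i * pow R a r * t)  ≈⟨ *-cong ≋-refl (*-cong (pow-+ R a i r) ≋-refl) ⟨
            pow R a s * (pow R a (i ℕ.+ r) * t)      ≡⟨ cong (λ k → pow R a s * (pow R a k * t)) (ℕₚ.m+[n∸m]≡n (ℕₚ.<⇒≤ i<j)) ⟩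
            pow R a s * (pow R a j * t)              ≈⟨ *-cong ≋-refl e ⟨
            pow R a s * (pow R a i * t)              ≈⟨ around t ⟩
            t                                        ∎

      powers-regular : ∀ {i j} → i < p → j < p → i ≢ j → ∀ t → (pow R a i - pow R a j) * t ≋ 0# → t ≋ 0#
      powers-regular {i} {j} i<p j<p i≢j t e with ℕₚ.<-cmp i j
      ... | tri< i<j _ _ = difference-regular i<j j<p t equal
        where
        equal : pow R a i * t ≋ pow R a j * t
        equal = minus≋0⁻¹ (≋-trans (ring 3 (λ a b t → a :* t :- b :* t := (a :- b) :* t) ≋-refl _ _ t) e)
      ... | tri≈ _ i≡j _ = ⊥-elim (i≢j i≡j)
      ... | tri> _ _ j<i = difference-regular j<i i<p t (≋-sym equal)
        where
        equal : pow R a i * t ≋ pow R a j * t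
        equal = minus≋0⁻¹ (≋-trans (ring 3 (λ a b t → a :* t :- b :* t := (a :- b) :* t) ≋-refl _ _ t) e)

    module _ (prime-q : Prime q) where

      private
        ordered-regular : ∀ {i j} → i < j → j < q → ∀ t → (ι (+ j) - ι (+ i)) * t ≋ 0# → t ≋ 0#
        ordered-regular {i} {j} i<j j<q t e = coprime-regular
          (prime⇒coprime prime-q {{>-nonZero (ℕₚ.m<n⇒0<n∸m i<j)}} (ℕₚ.≤-<-trans (ℕₚ.m∸n≤m j i) j<q)) t (begin
            ι (+ (j ∸ i)) * t                        ≈⟨ ring 3 (λ a r t → r :* t := (a :+ r :- a) :* t) ≋-refl (ι (+ i)) _ t ⟩
            (ι (+ i) + ι (+ (j ∸ i)) - ι (+ i)) * t  ≈⟨ *-cong (+-cong (ι-+ (+ i) (+ (j ∸ i))) ≋-refl) ≋-refl ⟨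
            (ι (+ (i ℕ.+ (j ∸ i))) - ι (+ i)) * t    ≡⟨ cong (λ k → (ι (+ k) - ι (+ i)) * t) (ℕₚ.m+[n∸m]≡n (ℕₚ.<⇒≤ i<j)) ⟩
            (ι (+ j) - ι (+ i)) * t                  ≈⟨ e ⟩
            0#                                       ∎)

      integers-regular : ∀ {i j} → i < q → j < q → i ≢ j → ∀ t → (ι (+ i) - ι (+ j)) * t ≋ 0# → t ≋ 0#
      integers-regular {i} {j} i<q j<q i≢j t e with ℕₚ.<-cmp i j
      ... | tri> _ _ j<i = ordered-regular j<i i<q t e
      ... | tri≈ _ i≡j _ = ⊥-elim (i≢j i≡j)
      ... | tri< i<j _ _ = ordered-regular i<j j<q t (≋-trans
        (ring 3 (λ a b t → (b :- a) :* t := :- ((a :- b) :* t)) ≋-refl (ι (+ i)) (ι (+ j)) t)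
        (≋-trans (-‿cong e) (ring 0 (:- con 0ℤ := con 0ℤ) ≋-refl)))

  module _ {l m n : ℕ} (RQ : RegularQuotient l m n) where
    open RegularQuotient RQ

    HasChiralCover : Set
    HasChiralCover = ∃ λ (K : FiniteQuotient l m n) → (∀ {w} → FiniteQuotient.Ker K w → Ker w) ×
      ∃ λ w → FiniteQuotient.Ker K w × ¬ FiniteQuotient.Ker K (mirror w)

    -- The prime p exceeds the number of cosets of odd elements, and 2 has order p
    -- modulo 2ᵖ - 1.
    hyperbolic⇒chiralCover : Hyperbolic l m n → HasChiralCover
    hyperbolic⇒chiralCover hyp with prime-above (size ℕ.+ 2)
    ... | p , prime-p , bound = chiral-quotient RQ hyp P R ω ωᵖ (powers-regular R prime-p ω ωᵖ ω-1-regular)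
        κ (λ g → let v , v∈ , ne = proj₂ distinguishing g in v , v∈ , λ e → ne (P.minus≋0 e))
      where
      size<p : size < p
      size<p = ℕₚ.≤-<-trans (ℕₚ.m≤m+n size 2) bound

      2<p : 2 < p
      2<p = ℕₚ.≤-<-trans (ℕₚ.m≤n+m 2 size) bound

      P : ModularRing p
      P = ℤ/_ p (ℕₚ.<-trans (ℕₚ.n<1+n 1) 2<p)

      module P = ModularRing P

      two-regular : ∀ t → t P.+ t P.≋ P.0# → t P.≋ P.0#
      two-regular t e = integers-regular P prime-p {2} {0} 2<p (ℕₚ.<-trans ℕₚ.0<1+n 2<p) (λ ()) t
        (P.≋-trans (P.RingSolver.solve 1 (λ t → (con′ (+ 2) :-′ con′ (+ 0)) :*′ t :=′ t :+′ t) P.≋-refl t) e)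
        where open P.RingSolver using () renaming (con to con′; _:-_ to _:-′_; _:*_ to _:*′_; _:+_ to _:+′_; _:=_ to _:=′_)

      distinguishing : ∃ λ K → ∀ g → Distinguishes RQ hyp P two-regular K g
      distinguishing = distinguish-all RQ hyp P two-regular (integers-regular P prime-p) size size<p (λ g → g)

      κ : Modular.Cocycle P (Modular.unscaled P)
      κ = proj₁ distinguishing

      q : ℕ
      q = 2 ℕ.^ p ∸ 1

      1+q : 1 ℕ.+ q ≡ 2 ℕ.^ p
      1+q = ℕₚ.m+[n∸m]≡n (ℕₚ.m^n>0 2 p)

      1<q : 1 < q
      1<q = ℕₚ.<-≤-trans (s≤s (s≤s z≤n)) (ℕₚ.∸-monoˡ-≤ 1 (ℕₚ.^-monoʳ-≤ 2 (ℕₚ.<⇒≤ 2<p)))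

      R : ModularRing q
      R = ℤ/_ q 1<q

      open ModularRing R
      open RingSolver using (_:=_; _:+_; _:*_; _:-_; con) renaming (solve to ring)

      ω : Carrier
      ω = ι (+ 2)

      pow-ω : ∀ k → pow R ω k ≋ ι (+ (2 ℕ.^ k))
      pow-ω zero    = ≋-refl
      pow-ω (suc k) = ≋-trans (*-cong (≋-refl {x = ω}) (pow-ω k)) (≋-sym (ι-ℕ-* R 2 (2 ℕ.^ k)))

      ωᵖ : pow R ω p ≋ 1#
      ωᵖ = ≋-trans (pow-ω p) (≋-trans (≋-reflexive (cong (λ k → ι (+ k)) (≡.sym 1+q)))
        (≋-trans (ι-+ (+ 1) (+ q)) (≋-trans (+-cong (≋-refl {x = 1#}) ι-q) (+-identityʳ 1#))))

      ω-1-regular : ∀ t → (ω - 1#) * t ≋ 0# → t ≋ 0#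
      ω-1-regular t e = ≋-trans (ring 1 (λ t → t := (con (+ 2) :- con (+ 1)) :* t) ≋-refl t) e

module EuclideanCovers where

  open import Data.Fin.Base using (zero; suc; toℕ)
  open import Data.Fin.Patterns using (0F; 1F)
  open import Data.Integer.Base using (+_; 0ℤ; 1ℤ)
  open import Data.Nat.Base as ℕ using (ℕ; zero; suc; _<_; s≤s)
  open import Data.Product.Base using (∃; _×_; _,_; proj₁; proj₂)
  open import Data.Vec.Base using (lookup; []; _∷_)
  open import Function.Bundles using (_⇔_; Equivalence)
  open import Relation.Binary.PropositionalEquality as ≡ using (_≡_; cong; cong₂; subst)
  import Data.Nat.Properties as ℕₚ
  import Relation.Binary.Reasoning.Setoid as SetoidReasoning

  open import Defs
  open PresentedGroups
  open TriangleGroups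
  open FiniteQuotients
  open Residues
  open Cocycles
  open Antisymmetric using (RegularQuotient)
  open Exponents using (finite-order)
  open ChiralCovers
  open PrimeModuli using (ι-ℕ-*; HasChiralCover)

  Euclidean : ℕ → ℕ → ℕ → Set
  Euclidean l m n = m ℕ.* n ℕ.+ l ℕ.* n ℕ.+ l ℕ.* m ≡ l ℕ.* m ℕ.* n

  record RootOfUnity (t D : ℕ) : Set₁ where
    field
      {q}       : ℕ
      R         : ModularRing q
    open ModularRing R
    field
      ω         : Carrier
      ωᵗ        : pow R ω t ≋ 1#
      ω-regular : ∀ i → 0 < i → i < t → ∀ a → pow R ω i * a ≋ a → a ≋ 0#
      D-regular : ∀ a → ι (+ D) * a ≋ 0# → a ≋ 0#

  module _ {q : ℕ} (R : ModularRing q) where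
    open ModularRing R
    open SetoidReasoning setoid

    pow-complement : ∀ {ω} i j → pow R ω (j ℕ.+ i) ≋ 1# → ∀ a → pow R ω i * a ≋ a → pow R ω j * a ≋ a
    pow-complement {ω} i j ωᵗ a e = begin
      pow R ω j * a                   ≈⟨ *-cong ≋-refl e ⟨
      pow R ω j * (pow R ω i * a)     ≈⟨ *-assoc _ _ _ ⟨
      pow R ω j * pow R ω i * a       ≈⟨ *-cong (pow-+ R ω j i) ≋-refl ⟨
      pow R ω (j ℕ.+ i) * a           ≈⟨ *-cong ωᵗ ≋-refl ⟩
      1# * a                          ≈⟨ *-identityˡ a ⟩
      a                               ∎

    factor-regular : ∀ i j → (∀ a → ι (+ (i ℕ.* j)) * a ≋ 0# → a ≋ 0#) → ∀ a → ι (+ j) * a ≋ 0# → a ≋ 0#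
    factor-regular i j regular a e = regular a (begin
      ι (+ (i ℕ.* j)) * a        ≈⟨ *-cong (ι-ℕ-* R i j) ≋-refl ⟩
      ι (+ i) * ι (+ j) * a      ≈⟨ *-assoc _ _ _ ⟩
      ι (+ i) * (ι (+ j) * a)    ≈⟨ *-cong ≋-refl e ⟩
      ι (+ i) * 0#               ≈⟨ zeroʳ _ ⟩
      0#                         ∎)

  -- ω = 1 + M is a root of X² - X + 1 modulo M² + M + 1, and M is a unit.
  sixthRoot : ∀ D → 0 < D → RootOfUnity 6 D
  sixthRoot D 0<D = record { R = R ; ω = ω ; ωᵗ = ω⁶ ; ω-regular = ω-regular ; D-regular = factor-regular R 6 D M-regular }
    where
    M q : ℕ
    M = 6 ℕ.* D
    q = M ℕ.* M ℕ.+ M ℕ.+ 1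

    R : ModularRing q
    R = ℤ/_ q (ℕₚ.+-monoˡ-< 1 (ℕₚ.<-≤-trans (ℕₚ.*-monoʳ-< 6 0<D) (ℕₚ.m≤n+m M (M ℕ.* M))))

    open ModularRing R
    open RingSolver using (_:=_; _:+_; _:*_; _:-_; :-_; con) renaming (solve to ring)
    open SetoidReasoning setoid

    μ ω : Carrier
    μ = ι (+ M)
    ω = 1# + μ

    modulus : μ * μ + μ + 1# ≋ 0#
    modulus = begin
      μ * μ + μ + 1#                     ≈⟨ +-cong (+-cong (ι-ℕ-* R M M) (≋-refl {x = μ})) (≋-refl {x = 1#}) ⟨
      ι (+ (M ℕ.* M)) + μ + 1#           ≈⟨ +-cong (ι-+ (+ (M ℕ.* M)) (+ M)) (≋-refl {x = 1#}) ⟨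
      ι (+ (M ℕ.* M ℕ.+ M)) + 1#         ≈⟨ ι-+ (+ (M ℕ.* M ℕ.+ M)) (+ 1) ⟨
      ι (+ q)                            ≈⟨ ι-q ⟩
      0#                                 ∎

    ω² : ω * ω ≋ ω - 1#
    ω² = begin
      ω * ω                              ≈⟨ ring 1 (λ μ → (con 1ℤ :+ μ) :* (con 1ℤ :+ μ) := μ :* μ :+ μ :+ con 1ℤ :+ μ) ≋-refl μ ⟩
      μ * μ + μ + 1# + μ                 ≈⟨ +-cong modulus (≋-refl {x = μ}) ⟩
      0# + μ                             ≈⟨ ring 1 (λ μ → con 0ℤ :+ μ := con 1ℤ :+ μ :- con 1ℤ) ≋-refl μ ⟩
      ω - 1#                             ∎

    ω³ : pow R ω 3 ≋ - 1#
    ω³ = begin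
      ω * (ω * (ω * 1#))    ≈⟨ ring 1 (λ w → w :* (w :* (w :* con 1ℤ)) := w :* (w :* w)) ≋-refl ω ⟩
      ω * (ω * ω)           ≈⟨ *-cong (≋-refl {x = ω}) ω² ⟩
      ω * (ω - 1#)          ≈⟨ ring 1 (λ w → w :* (w :- con 1ℤ) := w :* w :- w) ≋-refl ω ⟩
      ω * ω - ω             ≈⟨ +-cong ω² (≋-refl {x = - ω}) ⟩
      ω - 1# - ω            ≈⟨ ring 1 (λ w → w :- con 1ℤ :- w := :- con 1ℤ) ≋-refl ω ⟩
      - 1#                  ∎

    ω⁶ : pow R ω 6 ≋ 1#
    ω⁶ = ≋-trans (pow-+ R ω 3 3) (≋-trans (*-cong ω³ ω³) (ring 0 (:- con 1ℤ :* :- con 1ℤ := con 1ℤ) ≋-refl))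

    M-regular : ∀ a → μ * a ≋ 0# → a ≋ 0#
    M-regular a e = begin
      a                                     ≈⟨ ring 2 (λ a m → a := (m :* m :+ m :+ con 1ℤ) :* a :- (m :* (m :* a) :+ m :* a)) ≋-refl a μ ⟩
      (μ * μ + μ + 1#) * a - (μ * (μ * a) + μ * a)  ≈⟨ +-cong (*-cong modulus (≋-refl {x = a})) (-‿cong (+-cong (*-cong (≋-refl {x = μ}) e) e)) ⟩
      0# * a - (μ * 0# + 0#)                ≈⟨ ring 2 (λ a m → con 0ℤ :* a :- (m :* con 0ℤ :+ con 0ℤ) := con 0ℤ) ≋-refl a μ ⟩
      0#                                    ∎

    six-regular : ∀ a → ι (+ 6) * a ≋ 0# → a ≋ 0#
    six-regular = factor-regular R D 6 λ a e → M-regular a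
      (≋-trans (*-cong (≋-reflexive (cong (λ k → ι (+ k)) (ℕₚ.*-comm 6 D))) (≋-refl {x = a})) e)

    fixed₁ : ∀ a → ω * a ≋ a → a ≋ 0#
    fixed₁ a e = begin
      a               ≈⟨ ≋-trans (*-cong (≋-refl {x = ω}) e) e ⟨
      ω * (ω * a)     ≈⟨ *-assoc ω ω a ⟨
      ω * ω * a       ≈⟨ *-cong ω² (≋-refl {x = a}) ⟩
      (ω - 1#) * a    ≈⟨ ring 2 (λ w a → (w :- con 1ℤ) :* a := w :* a :- a) ≋-refl ω a ⟩
      ω * a - a       ≈⟨ minus≋0 e ⟩
      0#              ∎

    fixed₂ : ∀ a → ω * ω * a ≋ a → a ≋ 0#
    fixed₂ a e = six-regular a (begin
      ι (+ 6) * a             ≈⟨ ring 1 (λ a → con (+ 6) :* a := (a :+ a) :+ (a :+ a) :- a :+ ((a :+ a) :+ (a :+ a) :- a)) ≋-refl a ⟩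
      a + a + (a + a) - a + (a + a + (a + a) - a)  ≈⟨ +-cong three three ⟩
      0# + 0#                 ≈⟨ +-identityˡ 0# ⟩
      0#                      ∎)
      where
      double : ω * a ≋ a + a
      double = begin
        ω * a                ≈⟨ ring 2 (λ w a → w :* a := (w :- con 1ℤ) :* a :+ a) ≋-refl ω a ⟩
        (ω - 1#) * a + a     ≈⟨ +-cong (*-cong ω² (≋-refl {x = a})) (≋-refl {x = a}) ⟨
        ω * ω * a + a        ≈⟨ +-cong e (≋-refl {x = a}) ⟩
        a + a                ∎
      three : a + a + (a + a) - a ≋ 0#
      three = minus≋0 (begin
        a + a + (a + a)      ≈⟨ +-cong double double ⟨
        ω * a + ω * a        ≈⟨ ring 2 (λ w a → w :* a :+ w :* a := w :* (a :+ a)) ≋-refl ω a ⟩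
        ω * (a + a)          ≈⟨ *-cong (≋-refl {x = ω}) double ⟨
        ω * (ω * a)          ≈⟨ *-assoc ω ω a ⟨
        ω * ω * a            ≈⟨ e ⟩
        a                    ∎)

    fixed₃ : ∀ a → pow R ω 3 * a ≋ a → a ≋ 0#
    fixed₃ a e = six-regular a (begin
      ι (+ 6) * a                            ≈⟨ ring 1 (λ a → con (+ 6) :* a := con (+ 3) :* (a :- (:- con 1ℤ) :* a)) ≋-refl a ⟩
      ι (+ 3) * (a - (- 1#) * a)             ≈⟨ *-cong (≋-refl {x = ι (+ 3)}) (minus≋0 (≋-trans (≋-sym e) (*-cong ω³ (≋-refl {x = a})))) ⟩
      ι (+ 3) * 0#                           ≈⟨ zeroʳ (ι (+ 3)) ⟩
      0#                                     ∎)

    pow₁ : ∀ a → pow R ω 1 * a ≋ a → ω * a ≋ a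
    pow₁ a e = ≋-trans (*-cong (≋-sym (*-identityʳ ω)) (≋-refl {x = a})) e

    pow₂ : ∀ a → pow R ω 2 * a ≋ a → ω * ω * a ≋ a
    pow₂ a e = ≋-trans (*-cong (*-cong (≋-refl {x = ω}) (≋-sym (*-identityʳ ω))) (≋-refl {x = a})) e

    ω-regular : ∀ i → 0 < i → i < 6 → ∀ a → pow R ω i * a ≋ a → a ≋ 0#
    ω-regular 1 _ _ a e = fixed₁ a (pow₁ a e)
    ω-regular 2 _ _ a e = fixed₂ a (pow₂ a e)
    ω-regular 3 _ _ a e = fixed₃ a e
    ω-regular 4 _ _ a e = fixed₂ a (pow₂ a (pow-complement R {ω} 4 2 ω⁶ a e))
    ω-regular 5 _ _ a e = fixed₁ a (pow₁ a (pow-complement R {ω} 5 1 ω⁶ a e))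
    ω-regular (suc (suc (suc (suc (suc (suc _)))))) _ (s≤s (s≤s (s≤s (s≤s (s≤s (s≤s ())))))) a e

  fourthRoot : ∀ D → 0 < D → RootOfUnity 4 D
  fourthRoot D 0<D = record { R = R ; ω = ω ; ωᵗ = ω⁴ ; ω-regular = ω-regular ; D-regular = factor-regular R 2 D ω-cancel }
    where
    M q : ℕ
    M = 2 ℕ.* D
    q = M ℕ.* M ℕ.+ 1

    0<M : 0 < M
    0<M = ℕₚ.*-monoʳ-< 2 0<D

    R : ModularRing q
    R = ℤ/_ q (ℕₚ.+-monoˡ-< 1 (ℕₚ.*-mono-< {0} {M} {0} {M} 0<M 0<M))

    open ModularRing R
    open RingSolver using (_:=_; _:+_; _:*_; _:-_; :-_; con) renaming (solve to ring)
    open SetoidReasoning setoid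

    ω : Carrier
    ω = ι (+ M)

    ω² : ω * ω ≋ - 1#
    ω² = begin
      ω * ω                    ≈⟨ ring 1 (λ w → w :* w := w :* w :+ con 1ℤ :- con 1ℤ) ≋-refl ω ⟩
      ω * ω + 1# - 1#          ≈⟨ +-cong (+-cong (ι-ℕ-* R M M) (≋-refl {x = 1#})) (≋-refl {x = - 1#}) ⟨
      ι (+ (M ℕ.* M)) + 1# - 1# ≈⟨ +-cong (ι-+ (+ (M ℕ.* M)) (+ 1)) (≋-refl {x = - 1#}) ⟨
      ι (+ q) - 1#             ≈⟨ +-cong ι-q (≋-refl {x = - 1#}) ⟩
      0# - 1#                  ≈⟨ +-identityˡ _ ⟩
      - 1#                     ∎

    pow² : pow R ω 2 ≋ - 1#
    pow² = ≋-trans (*-cong (≋-refl {x = ω}) (*-identityʳ ω)) ω²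

    ω⁴ : pow R ω 4 ≋ 1#
    ω⁴ = ≋-trans (pow-+ R ω 2 2) (≋-trans (*-cong pow² pow²) (ring 0 (:- con 1ℤ :* :- con 1ℤ := con 1ℤ) ≋-refl))

    ω-cancel : ∀ a → ω * a ≋ 0# → a ≋ 0#
    ω-cancel a e = begin
      a                        ≈⟨ ring 1 (λ a → a := :- ((:- con 1ℤ) :* a)) ≋-refl a ⟩
      - ((- 1#) * a)           ≈⟨ -‿cong (*-cong ω² (≋-refl {x = a})) ⟨
      - (ω * ω * a)            ≈⟨ -‿cong (≋-trans (*-assoc ω ω a) (*-cong (≋-refl {x = ω}) e)) ⟩
      - (ω * 0#)               ≈⟨ ring 1 (λ w → :- (w :* con 0ℤ) := con 0ℤ) ≋-refl ω ⟩
      0#                       ∎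

    two-regular : ∀ a → ι (+ 2) * a ≋ 0# → a ≋ 0#
    two-regular = factor-regular R D 2 λ a e → ω-cancel a
      (≋-trans (*-cong (≋-reflexive (cong (λ k → ι (+ k)) (ℕₚ.*-comm 2 D))) (≋-refl {x = a})) e)

    fixed₂ : ∀ a → pow R ω 2 * a ≋ a → a ≋ 0#
    fixed₂ a e = two-regular a (begin
      ι (+ 2) * a              ≈⟨ ring 1 (λ a → con (+ 2) :* a := a :- (:- con 1ℤ) :* a) ≋-refl a ⟩
      a - (- 1#) * a           ≈⟨ minus≋0 (≋-trans (≋-sym e) (*-cong pow² (≋-refl {x = a}))) ⟩
      0#                       ∎)

    fixed₁ : ∀ a → pow R ω 1 * a ≋ a → a ≋ 0#
    fixed₁ a e = fixed₂ a (begin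
      pow R ω 2 * a                    ≈⟨ *-cong (pow-+ R ω 1 1) (≋-refl {x = a}) ⟩
      pow R ω 1 * pow R ω 1 * a        ≈⟨ *-assoc (pow R ω 1) (pow R ω 1) a ⟩
      pow R ω 1 * (pow R ω 1 * a)      ≈⟨ *-cong (≋-refl {x = pow R ω 1}) e ⟩
      pow R ω 1 * a                    ≈⟨ e ⟩
      a                                ∎)

    ω-regular : ∀ i → 0 < i → i < 4 → ∀ a → pow R ω i * a ≋ a → a ≋ 0#
    ω-regular 1 _ _ a e = fixed₁ a e
    ω-regular 2 _ _ a e = fixed₂ a e
    ω-regular 3 _ _ a e = fixed₁ a (pow-complement R {ω} 3 1 ω⁴ a e)
    ω-regular (suc (suc (suc (suc _)))) _ (s≤s (s≤s (s≤s (s≤s ())))) a e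

  -- The orders divide t, and the angles of the triangle are exponent ξ,
  -- exponent η and exponent ζ times π / t.
  record Angles (l m n t : ℕ) : Set where
    field
      exponent : Rotation → ℕ
      angle    : ∀ a → exponent a ℕ.* order l m n a ≡ t
      flat     : exponent ξ ℕ.+ exponent η ℕ.+ exponent ζ ≡ t
      1<t      : 1 < t
      proper   : ∀ a → 0 < exponent a × exponent a < t
      acute    : ∃ λ a → exponent a ℕ.+ exponent a < t

  module _ {l m n : ℕ} where

    point : FiniteQuotient l m n
    point = record { size = 1 ; coset = λ _ → 0F ; resp = λ _ → ≡.refl ; ∙-resp = λ _ _ → ≡.refl }

    point-section : Section l m n point
    point-section = record { rep = λ _ → ε ; coset-rep = λ { 0F → ≡.refl } }

  -- The rotation parts of the elements of Δ give a character with values in the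
  -- powers of ω, through which Δ acts on R by affine maps; mirror inverts it.
  module _ {l m n : ℕ} (RQ : RegularQuotient l m n) {t : ℕ} (angles : Angles l m n t)
           (root : ∀ D → 0 < D → RootOfUnity t D) where

    private
      module RQ = RegularQuotient RQ

    open Angles angles
    open Action {l} {m} {n} point point-section

    private
      Rₜ : ModularRing t
      Rₜ = ℤ/_ t 1<t
      module T where
        open ModularRing Rₜ public
        open Modular Rₜ public

      angleAt : Rotation → G → T.Carrier
      angleAt a _ = T.ι (+ exponent a)

      κ-values : G → Word Rotation → T.Carrier
      κ-values = T.extend T.unscaled angleAt

      module _ where
        open T
        open RingSolver using (_:=_; _:+_; _:*_; _:-_; :-_; con) renaming (solve to ring)
        open SetoidReasoning setoid

        κ-product : ∀ g → κ-values g (x ∙ y ∙ z) ≋ 0#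
        κ-product g = begin
          ι (+ exponent ξ) + 1# * ι (+ exponent η) + 1# * ι (+ exponent ζ)
            ≈⟨ ring 3 (λ a b c → a :+ con 1ℤ :* b :+ con 1ℤ :* c := a :+ b :+ c) ≋-refl
                 (ι (+ exponent ξ)) (ι (+ exponent η)) (ι (+ exponent ζ)) ⟩
          ι (+ exponent ξ) + ι (+ exponent η) + ι (+ exponent ζ)
            ≈⟨ +-cong (ι-+ (+ exponent ξ) (+ exponent η)) (≋-refl {x = ι (+ exponent ζ)}) ⟨
          ι (+ (exponent ξ ℕ.+ exponent η)) + ι (+ exponent ζ)
            ≈⟨ ι-+ (+ (exponent ξ ℕ.+ exponent η)) (+ exponent ζ) ⟨
          ι (+ (exponent ξ ℕ.+ exponent η ℕ.+ exponent ζ))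
            ≡⟨ cong (λ k → ι (+ k)) flat ⟩
          ι (+ t)
            ≈⟨ ι-q ⟩
          0# ∎

        κ-power : ∀ a k g → κ-values g (gen a ^ k) ≋ ι (+ k) * ι (+ exponent a)
        κ-power a zero    g = ≋-sym (zeroˡ (ι (+ exponent a)))
        κ-power a (suc k) g = begin
          ι (+ exponent a) + 1# * κ-values (g · gen a) (gen a ^ k)
            ≈⟨ +-cong (≋-refl {x = ι (+ exponent a)}) (*-cong (≋-refl {x = 1#}) (κ-power a k (g · gen a))) ⟩
          ι (+ exponent a) + 1# * (ι (+ k) * ι (+ exponent a))
            ≈⟨ ring 2 (λ e k → e :+ con 1ℤ :* (k :* e) := (con 1ℤ :+ k) :* e) ≋-refl (ι (+ exponent a)) (ι (+ k)) ⟩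
          (1# + ι (+ k)) * ι (+ exponent a)
            ≈⟨ *-cong (ι-+ (+ 1) (+ k)) (≋-refl {x = ι (+ exponent a)}) ⟨
          ι (+ suc k) * ι (+ exponent a) ∎

        κ-kill : ∀ a g → κ-values g (gen a ^ order l m n a) ≋ 0#
        κ-kill a g = begin
          κ-values g (gen a ^ order l m n a)           ≈⟨ κ-power a (order l m n a) g ⟩
          ι (+ order l m n a) * ι (+ exponent a)       ≈⟨ *-comm (ι (+ order l m n a)) (ι (+ exponent a)) ⟩
          ι (+ exponent a) * ι (+ order l m n a)       ≈⟨ ι-ℕ-* Rₜ (exponent a) (order l m n a) ⟨
          ι (+ (exponent a ℕ.* order l m n a))         ≡⟨ cong (λ k → ι (+ k)) (angle a) ⟩
          ι (+ t)                                      ≈⟨ ι-q ⟩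
          0#                                           ∎

        κ : Cocycle unscaled
        κ = cocycle unscaled (extend-crossed unscaled angleAt) κ-product κ-kill

      v₁ : Word Rotation
      v₁ = y ∙ z ∙ y ⁻¹ ∙ z ⁻¹

      D : ℕ
      D = proj₁ (finite-order RQ v₁)

      0<D : 0 < D
      0<D = proj₁ (proj₂ (finite-order RQ v₁))

      v₁ᴰ∈Ker : RQ.Ker (v₁ ^ D)
      v₁ᴰ∈Ker = proj₂ (proj₂ (finite-order RQ v₁))

      open RootOfUnity (root D 0<D)
      open ModularRing R
      open RingSolver using (_:=_; _:+_; _:*_; _:-_; :-_; con) renaming (solve to ring)
      open Modular R
      open SetoidReasoning setoid
      open Exponential R ω Rₜ ωᵗ using (pow-cong)

      M : Multiplier
      M = exponential point point-section R ω Rₜ ωᵗ κ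
      open Multiplier M

      scale-generator : ∀ a g → scale g (gen a) ≋ pow R ω (exponent a)
      scale-generator a g = pow-cong _ (exponent a) (T.≋-sym (T.ι-residue (T.ι (+ exponent a))))

      scale-regular : ∀ a g b → scale g (gen a) * b ≋ b → b ≋ 0#
      scale-regular a g b e = ω-regular (exponent a) (proj₁ (proper a)) (proj₂ (proper a)) b
        (≋-trans (*-cong (≋-sym (scale-generator a g)) ≋-refl) e)

      u : G → Word Rotation → Carrier
      u = extend M (generators M (λ _ → 1#) (λ _ → 0#))

      u-crossed : Crossed M u
      u-crossed = extend-crossed M _

      u-product : ∀ g → u g (x ∙ y ∙ z) ≋ 0#
      u-product = extend-product M (λ _ → 1#) (λ _ → 0#)

      only : ∀ (g h : G) → g ≡ h
      only 0F 0F = ≡.refl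

      -- 1 + s + … + sᵏ⁻¹ = 0, because sᵏ = 1 and s - 1 is regular.
      u-kill : ∀ a g → u g (gen a ^ order l m n a) ≋ 0#
      u-kill a g = scale-regular a g (u g aᵏ) (+-cancelˡ (u g (gen a)) (begin
        u g (gen a) + scale g (gen a) * u g aᵏ   ≈⟨ law g (gen a) aᵏ ⟨
        u g (gen a ∙ aᵏ)                         ≈⟨ product-resp M u-crossed u-product g (^-sucʳ (gen a) (order l m n a)) ⟩
        u g (aᵏ ∙ gen a)                         ≈⟨ law g aᵏ (gen a) ⟩
        u g aᵏ + scale g aᵏ * u g (gen a)        ≈⟨ +-cong ≋-refl (*-cong (scale-trivial g (power-relator l m n a)) ≋-refl) ⟩
        u g aᵏ + 1# * u g (gen a)                ≈⟨ ring 2 (λ a b → a :+ con 1ℤ :* b := b :+ a) ≋-refl _ _ ⟩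
        u g (gen a) + u g aᵏ                     ∎))
        where
        aᵏ : Word Rotation
        aᵏ = gen a ^ order l m n a
        law : ∀ g v w → u g (v ∙ w) ≋ u g v + scale g v * u g w
        law g v w = ≋-trans (Crossed.law-∙ u-crossed g v w)
          (+-cong ≋-refl (*-cong ≋-refl (≋-reflexive (cong (λ h → u h w) (only _ g)))))

      U : Cocycle M
      U = cocycle M u-crossed u-product u-kill
      open Cocycle U using (value; value-resp; law-ε)
      open Affine point point-section R M U

      v₁-T : Translation v₁
      v₁-T = Translation-commutator ≡.refl ≡.refl

      v₁-value : value 𝟙 v₁ ≋̸ 0#
      v₁-value e = 1≋̸0 (scale-regular ζ 𝟙 1# (begin
        scale 𝟙 z * 1#                  ≈⟨ +-identityˡ _ ⟨
        0# + scale 𝟙 z * 1#             ≈⟨ value-Ker-∙ 𝟙 {z} y ≡.refl ⟨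
        value 𝟙 (z ∙ y)                 ≈⟨ +-identityˡ _ ⟨
        0# + value 𝟙 (z ∙ y)            ≈⟨ +-cong e ≋-refl ⟨
        value 𝟙 v₁ + value 𝟙 (z ∙ y)    ≈⟨ value-Translation-∙ 𝟙 (z ∙ y) v₁-T ⟨
        value 𝟙 (v₁ ∙ (z ∙ y))          ≈⟨ value-resp 𝟙 (solve (lookup (y ∷ z ∷ []))
                                             (gen 0F ∙ gen 1F ∙ gen 0F ⁻¹ ∙ gen 1F ⁻¹ ∙ (gen 1F ∙ gen 0F)) (gen 0F ∙ gen 1F) ≡.refl) ⟩
        value 𝟙 (y ∙ z)                 ≈⟨ value-Ker-∙ 𝟙 {y} z ≡.refl ⟩
        1# + scale 𝟙 y * 0#             ≈⟨ ring 1 (λ s → con 1ℤ :+ s :* con 0ℤ := con 1ℤ) ≋-refl _ ⟩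
        1#                              ∎))
        where
        1≋̸0 : 1# ≋̸ 0#
        1≋̸0 e with () ← ι-injective {1} {0} 1<q (ℕₚ.<-trans ℕₚ.0<1+n 1<q) e

      v₀ : Word Rotation
      v₀ = mirror (v₁ ^ D)

      v₀-T : Translation v₀
      v₀-T = subst Translation (≡.sym (substitute-^ _ v₁ D)) (Translation-^ D
        (Translation-commutator ≡.refl ≡.refl))

      mirror-v₀-T : Translation (mirror v₀)
      mirror-v₀-T = Translation-resp (sym (mirror-involutive (v₁ ^ D)))
        (Translation-^ D v₁-T)

      mirror-v₀-value : value 𝟙 (mirror v₀) ≋̸ 0#
      mirror-v₀-value e = v₁-value (D-regular _ (begin
        ι (+ D) * value 𝟙 v₁     ≈⟨ value-Translation-^ 𝟙 D v₁-T ⟨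
        value 𝟙 (v₁ ^ D)         ≈⟨ value-resp 𝟙 (sym (mirror-involutive (v₁ ^ D))) ⟩
        value 𝟙 (mirror v₀)      ≈⟨ e ⟩
        0#                       ∎))

      a : Rotation
      a = proj₁ acute

      c : ℕ
      c = toℕ (residue (scale 𝟙 (gen a)))

      w : Word Rotation
      w = eliminate (gen a) c v₀

      w∈Ker : RQ.Ker w
      w∈Ker = RQ.Ker-∙ (RQ.Ker-conj (gen a) v₀∈Ker) (RQ.Ker-⁻¹ (Ker-^ c))
        where
        v₀∈Ker : RQ.Ker v₀
        v₀∈Ker = RQ.mirror-Ker v₁ᴰ∈Ker
        Ker-^ : ∀ k → RQ.Ker (v₀ ^ k)
        Ker-^ zero    = RQ.Ker-ε
        Ker-^ (suc k) = RQ.Ker-∙ v₀∈Ker (Ker-^ k)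

      w-T : Translation w
      w-T = Translation-eliminate {gen a} c ≡.refl v₀-T

      w-value : ∀ g → value g w ≋ 0#
      w-value g = begin
        value g w                                    ≡⟨ cong (λ h → value h w) (only g 𝟙) ⟩
        value 𝟙 w                                    ≈⟨ value-eliminate 𝟙 {gen a} c ≡.refl v₀-T ⟩
        (scale 𝟙 (gen a) - ι (+ c)) * value 𝟙 v₀     ≈⟨ *-cong (minus≋0 (ι-residue _)) ≋-refl ⟩
        0# * value 𝟙 v₀                              ≈⟨ zeroˡ _ ⟩
        0#                                           ∎

      scale-mirror : scale 𝟙 (gen a) * scale 𝟙 (mirror (gen a)) ≋ 1#
      scale-mirror = begin
        s (gen a) * s (twist a ⁻¹ ∙ gen a ⁻¹ ∙ twist a)
          ≈⟨ *-cong ≋-refl (≋-trans (hom (twist a ⁻¹ ∙ gen a ⁻¹) (twist a)) (*-cong (hom (twist a ⁻¹) (gen a ⁻¹)) ≋-refl)) ⟩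
        s (gen a) * (s (twist a ⁻¹) * s (gen a ⁻¹) * s (twist a))
          ≈⟨ ring 4 (λ p q r o → p :* (q :* r :* o) := p :* r :* (o :* q)) ≋-refl _ _ _ _ ⟩
        s (gen a) * s (gen a ⁻¹) * (s (twist a) * s (twist a ⁻¹))
          ≈⟨ *-cong (scale-Ker-inverse 𝟙 {gen a} ≡.refl) (scale-Ker-inverse 𝟙 {twist a} ≡.refl) ⟩
        1# * 1#
          ≈⟨ *-identityˡ 1# ⟩
        1# ∎
        where
        s : Word Rotation → Carrier
        s = scale 𝟙
        hom : ∀ v w → s (v ∙ w) ≋ s v * s w
        hom v w = scale-Ker-∙ 𝟙 {v} w ≡.refl

      mirror-w-value : value 𝟙 (mirror w) ≋̸ 0#
      mirror-w-value e = mirror-v₀-value (ω-regular (exponent a ℕ.+ exponent a)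
        (ℕₚ.<-≤-trans (proj₁ (proper a)) (ℕₚ.m≤m+n _ _)) (proj₂ acute) b (begin
          pow R ω (exponent a ℕ.+ exponent a) * b   ≈⟨ *-cong (pow-+ R ω (exponent a) (exponent a)) ≋-refl ⟩
          pow R ω (exponent a) * pow R ω (exponent a) * b ≈⟨ *-cong (*-cong (scale-generator a 𝟙) (scale-generator a 𝟙)) ≋-refl ⟨
          s * s * b                                 ≈⟨ *-assoc s s b ⟩
          s * (s * b)                               ≈⟨ *-cong ≋-refl equal ⟨
          s * (s′ * b)                              ≈⟨ *-assoc s s′ b ⟨
          s * s′ * b                                ≈⟨ *-cong scale-mirror ≋-refl ⟩
          1# * b                                    ≈⟨ *-identityˡ b ⟩
          b                                         ∎))
        where
        b s s′ : Carrier
        b = value 𝟙 (mirror v₀)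
        s = scale 𝟙 (gen a)
        s′ = scale 𝟙 (mirror (gen a))
        equal : s′ * b ≋ s * b
        equal = minus≋0⁻¹ (begin
          s′ * b - s * b             ≈⟨ ring 3 (λ p q b → p :* b :- q :* b := (p :- q) :* b) ≋-refl s′ s b ⟩
          (s′ - s) * b               ≈⟨ *-cong (+-cong ≋-refl (-‿cong (ι-residue s))) ≋-refl ⟩
          (s′ - ι (+ c)) * b         ≈⟨ value-eliminate 𝟙 {mirror (gen a)} c ≡.refl mirror-v₀-T ⟨
          value 𝟙 (eliminate (mirror (gen a)) c (mirror v₀))
                                     ≡⟨ cong (value 𝟙) (mirror-eliminate (gen a) c v₀) ⟨
          value 𝟙 (mirror w)         ≈⟨ e ⟩
          0#                         ∎)

    euclidean⇒chiralCover : HasChiralCover RQ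
    euclidean⇒chiralCover = meet l m n RQ.quotient K
      , (λ k → proj₁ (meet-injective l m n RQ.quotient K k))
      , w
      , cong₂ combine w∈Ker (from (⇔ {w} {ε}) (≡.refl , (λ g → ≋-trans (Translation.unit w-T g) (≋-sym (scale-ε g)))
                                                      , (λ g → ≋-trans (w-value g) (≋-sym (law-ε g)))))
      , λ k → mirror-w-value (≋-trans
          (proj₂ (proj₂ (to (⇔ {mirror w} {ε}) (proj₂ (meet-injective l m n RQ.quotient K k)))) 𝟙) (law-ε 𝟙))
      where
      open Equivalence
      open import Data.Fin.Base using (combine)
      K : FiniteQuotient l m n
      K = cocycleQuotient
      ⇔ : ∀ {v w} → FiniteQuotient.coset K v ≡ FiniteQuotient.coset K w ⇔ v ≃ w
      ⇔ {v} {w} = cocycleQuotient⇔ {v} {w}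

module NonSpherical where

  open import Data.Empty using (⊥-elim)
  open import Data.Fin.Base using (Fin; toℕ)
  open import Data.Fin.Properties using (all?)
  open import Data.Integer.Base as ℤ using (+_)
  open import Data.Nat.Base using (ℕ; zero; suc; _+_; _*_; _<_; _≤_; NonZero; >-nonZero; s≤s; z≤n)
  open import Data.Nat.Divisibility using (_∣_; divides; _∣?_)
  open import Data.Nat.Tactic.RingSolver using (solve-∀)
  open import Data.Product.Base using (Σ; ∃; _×_; _,_; proj₁; proj₂)
  open import Data.Rational.Base as ℚ using (1ℚ; toℚᵘ)
  open import Data.Rational.Unnormalised.Base as ℚᵘ using (ℚᵘ; mkℚᵘ)
  open import Data.Sum.Base using (_⊎_; inj₁; inj₂)
  open import Function.Bundles using (Equivalence)
  open import Relation.Binary.Definitions using (tri<; tri≈; tri>)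
  open import Relation.Binary.PropositionalEquality as ≡ using (_≡_; _≢_; refl; cong; cong₂; subst)
  open import Relation.Nullary using (¬_; Dec; _×-dec_; _⊎-dec_; _→-dec_)
  open import Relation.Nullary.Decidable using (from-yes)
  import Data.Integer.Properties as ℤₚ
  import Data.Nat.Properties as ℕₚ
  import Data.Rational.Properties as ℚₚ
  import Data.Rational.Unnormalised.Properties as ℚᵘₚ

  open import Defs hiding (refl; sym; trans; _^_)
  open TriangleGroups
  open FiniteQuotients
  open Antisymmetric using (RegularQuotient)
  open PrimeModuli using (HasChiralCover; hyperbolic⇒chiralCover)
  open EuclideanCovers

  reciprocals⇒≤ : ∀ l m n .{{_ : NonZero l}} .{{_ : NonZero m}} .{{_ : NonZero n}} →
    (+ 1 ℚ./ l) ℚ.+ (+ 1 ℚ./ m) ℚ.+ (+ 1 ℚ./ n) ℚ.≤ 1ℚ →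
    m * n + l * n + l * m ≤ l * m * n
  reciprocals⇒≤ l@(suc l′) m@(suc m′) n@(suc n′) h = clear (ℚᵘₚ.≤-respˡ-≃ unnormalised (ℚₚ.toℚᵘ-mono-≤ h))
    where
    r : ℕ → ℚᵘ
    r k = mkℚᵘ (+ 1) k

    unnormalised : toℚᵘ ((+ 1 ℚ./ l) ℚ.+ (+ 1 ℚ./ m) ℚ.+ (+ 1 ℚ./ n)) ℚᵘ.≃ r l′ ℚᵘ.+ r m′ ℚᵘ.+ r n′
    unnormalised = ℚᵘₚ.≃-trans (ℚₚ.toℚᵘ-homo-+ ((+ 1 ℚ./ l) ℚ.+ (+ 1 ℚ./ m)) (+ 1 ℚ./ n))
      (ℚᵘₚ.+-cong (ℚᵘₚ.≃-trans (ℚₚ.toℚᵘ-homo-+ (+ 1 ℚ./ l) (+ 1 ℚ./ m))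
        (ℚᵘₚ.+-cong (ℚₚ.toℚᵘ-fromℚᵘ (r l′)) (ℚₚ.toℚᵘ-fromℚᵘ (r m′)))) (ℚₚ.toℚᵘ-fromℚᵘ (r n′)))

    clear : r l′ ℚᵘ.+ r m′ ℚᵘ.+ r n′ ℚᵘ.≤ ℚᵘ.1ℚᵘ → m * n + l * n + l * m ≤ l * m * n
    clear (ℚᵘ.*≤* le) = ℤₚ.drop‿+≤+ (ℤₚ.≤-trans (ℤₚ.≤-reflexive numerator) (ℤₚ.≤-trans le (ℤₚ.≤-reflexive denominator)))
      where
      numerator : + (m * n + l * n + l * m) ≡ ((+ 1 ℤ.* + m ℤ.+ + 1 ℤ.* + l) ℤ.* + n ℤ.+ + 1 ℤ.* + (l * m)) ℤ.* + 1
      numerator = ≡.sym (begin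
        ((+ 1 ℤ.* + m ℤ.+ + 1 ℤ.* + l) ℤ.* + n ℤ.+ + 1 ℤ.* + (l * m)) ℤ.* + 1
          ≡⟨ ℤₚ.*-identityʳ _ ⟩
        (+ 1 ℤ.* + m ℤ.+ + 1 ℤ.* + l) ℤ.* + n ℤ.+ + 1 ℤ.* + (l * m)
          ≡⟨ cong₂ ℤ._+_ (cong (ℤ._* + n) (cong₂ ℤ._+_ (ℤₚ.*-identityˡ (+ m)) (ℤₚ.*-identityˡ (+ l)))) (ℤₚ.*-identityˡ (+ (l * m))) ⟩
        + (m + l) ℤ.* + n ℤ.+ + (l * m)
          ≡⟨ cong (ℤ._+ + (l * m)) (ℤₚ.pos-* (m + l) n) ⟨
        + ((m + l) * n + l * m)
          ≡⟨ cong +_ (distribute l m n) ⟩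
        + (m * n + l * n + l * m) ∎)
        where
        open ≡.≡-Reasoning
        distribute : ∀ l m n → (m + l) * n + l * m ≡ m * n + l * n + l * m
        distribute = solve-∀
      denominator : + 1 ℤ.* + (l * m * n) ≡ + (l * m * n)
      denominator = ℤₚ.*-identityˡ _

  private
    exceeds : ∀ {lhs rhs} k → rhs ≡ suc k + lhs → lhs ≢ rhs
    exceeds {lhs} k e e′ = ℕₚ.<⇒≢ (s≤s (ℕₚ.m≤n+m lhs k)) (≡.trans e′ e)

    large-order : ∀ a {m n} → 0 < m → 0 < n → ¬ Euclidean (7 + a) m n
    large-order a {1} {n} _ 0<n e = exceeds (6 + a + n) (lemma a n) (≡.sym e)
      where
      lemma : ∀ a n → 1 * n + (7 + a) * n + (7 + a) * 1 ≡ suc (6 + a + n) + (7 + a) * 1 * n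
      lemma = solve-∀
    large-order a {suc (suc b)} {1} _ _ e = exceeds (8 + a + b) (lemma a b) (≡.sym e)
      where
      lemma : ∀ a b → (2 + b) * 1 + (7 + a) * 1 + (7 + a) * (2 + b) ≡ suc (8 + a + b) + (7 + a) * (2 + b) * 1
      lemma = solve-∀
    large-order a {2} {2} _ _ e = exceeds 3 (lemma a) (≡.sym e)
      where
      lemma : ∀ a → 2 * 2 + (7 + a) * 2 + (7 + a) * 2 ≡ 4 + (7 + a) * 2 * 2
      lemma = solve-∀
    large-order a {2} {suc (suc (suc c))} _ _ e = exceeds (5 * c + a + a * c) (lemma a c) e
      where
      lemma : ∀ a c → (7 + a) * 2 * (3 + c) ≡
        suc (5 * c + a + a * c) + (2 * (3 + c) + (7 + a) * (3 + c) + (7 + a) * 2)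
      lemma = solve-∀
    large-order a {suc (suc (suc b))} {2} _ _ e = exceeds (5 * b + a + a * b) (lemma a b) e
      where
      lemma : ∀ a b → (7 + a) * (3 + b) * 2 ≡
        suc (5 * b + a + a * b) + ((3 + b) * 2 + (7 + a) * 2 + (7 + a) * (3 + b))
      lemma = solve-∀
    large-order a {suc (suc (suc b))} {suc (suc (suc c))} _ _ e =
      exceeds (11 + 11 * b + 11 * c + 6 * (b * c) + 3 * a + 2 * (a * b) + 2 * (a * c) + a * b * c) (lemma a b c) e
      where
      lemma : ∀ a b c → (7 + a) * (3 + b) * (3 + c) ≡
        suc (11 + 11 * b + 11 * c + 6 * (b * c) + 3 * a + 2 * (a * b) + 2 * (a * c) + a * b * c) +
        ((3 + b) * (3 + c) + (7 + a) * (3 + c) + (7 + a) * (3 + b))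
      lemma = solve-∀

    Divides : ℕ → ℕ → ℕ → ℕ → Set
    Divides t l m n = l ∣ t × m ∣ t × n ∣ t

    divides? : ∀ t l m n → Dec (Divides t l m n)
    divides? t l m n = (l ∣? t) ×-dec (m ∣? t) ×-dec (n ∣? t)

    Classified : ℕ → ℕ → ℕ → Set
    Classified l m n = (Divides 6 l m n ⊎ Divides 4 l m n) ×
      (1 < l × 1 < m × 1 < n) × (2 < l ⊎ 2 < m ⊎ 2 < n)

    classification : ∀ (i j k : Fin 6) → Euclidean (suc (toℕ i)) (suc (toℕ j)) (suc (toℕ k)) →
      Classified (suc (toℕ i)) (suc (toℕ j)) (suc (toℕ k))
    classification = from-yes (all? λ (i : Fin 6) → all? λ (j : Fin 6) → all? λ (k : Fin 6) →
      let l = suc (toℕ i) ; m = suc (toℕ j) ; n = suc (toℕ k) in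
      (m * n + l * n + l * m ℕₚ.≟ l * m * n) →-dec
      ((divides? 6 l m n ⊎-dec divides? 4 l m n) ×-dec
       ((1 ℕₚ.<? l) ×-dec (1 ℕₚ.<? m) ×-dec (1 ℕₚ.<? n)) ×-dec
       ((2 ℕₚ.<? l) ⊎-dec (2 ℕₚ.<? m) ⊎-dec (2 ℕₚ.<? n))))

    small-order : ∀ l {m n} → 0 < l → 0 < m → 0 < n → Euclidean l m n → ∃ λ (i : Fin 6) → suc (toℕ i) ≡ l
    small-order (suc (suc (suc (suc (suc (suc (suc a))))))) _ 0<m 0<n e = ⊥-elim (large-order a 0<m 0<n e)
    small-order 1 _ _ _ _ = Fin.zero , refl
    small-order 2 _ _ _ _ = Fin.suc Fin.zero , refl
    small-order 3 _ _ _ _ = Fin.suc (Fin.suc Fin.zero) , refl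
    small-order 4 _ _ _ _ = Fin.suc (Fin.suc (Fin.suc Fin.zero)) , refl
    small-order 5 _ _ _ _ = Fin.suc (Fin.suc (Fin.suc (Fin.suc Fin.zero))) , refl
    small-order 6 _ _ _ _ = Fin.suc (Fin.suc (Fin.suc (Fin.suc (Fin.suc Fin.zero)))) , refl

    classify : ∀ {l m n} → 0 < l → 0 < m → 0 < n → Euclidean l m n → Classified l m n
    classify {l} {m} {n} 0<l 0<m 0<n e
      with small-order l 0<l 0<m 0<n e
         | small-order m 0<m 0<l 0<n (≡.trans (swap l m n) (≡.trans e (swap′ l m n)))
         | small-order n 0<n 0<m 0<l (≡.trans (rotate l m n) (≡.trans e (rotate′ l m n)))
      where
      swap : ∀ l m n → l * n + m * n + m * l ≡ m * n + l * n + l * m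
      swap = solve-∀
      swap′ : ∀ l m n → l * m * n ≡ m * l * n
      swap′ = solve-∀
      rotate : ∀ l m n → m * l + n * l + n * m ≡ m * n + l * n + l * m
      rotate = solve-∀
      rotate′ : ∀ l m n → l * m * n ≡ n * m * l
      rotate′ = solve-∀
    ... | i , refl | j , refl | k , refl = classification i j k e

    angles : ∀ {l m n t} → 1 < t → Euclidean l m n → Divides t l m n →
      1 < l × 1 < m × 1 < n → 2 < l ⊎ 2 < m ⊎ 2 < n → Angles l m n t
    angles {l} {m} {n} {t} 1<t e (divides i p , divides j q , divides k r) (1<l , 1<m , 1<n) some>2 = record
      { exponent = exponent
      ; angle    = λ { ξ → ≡.sym p ; η → ≡.sym q ; ζ → ≡.sym r }
      ; flat     = flat
      ; 1<t      = 1<t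
      ; proper   = λ { ξ → proper i p 1<l ; η → proper j q 1<m ; ζ → proper k r 1<n }
      ; acute    = acute some>2
      }
      where
      exponent : Rotation → ℕ
      exponent ξ = i
      exponent η = j
      exponent ζ = k

      positive : ∀ i {l} → t ≡ i * l → 0 < i
      positive zero    p = ⊥-elim (ℕₚ.<⇒≱ 1<t (ℕₚ.≤-trans (ℕₚ.≤-reflexive p) z≤n))
      positive (suc i) p = s≤s z≤n

      proper : ∀ i {l} → t ≡ i * l → 1 < l → 0 < i × i < t
      proper i {l} p 1<l = positive i p , subst (i <_) (≡.sym p)
        (ℕₚ.m<m*n i l {{>-nonZero (positive i p)}} 1<l)

      halved : ∀ i {l} → t ≡ i * l → 2 < l → i + i < t
      halved i {l} p 2<l = subst (i + i <_) (≡.sym p) (ℕₚ.<-≤-trans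
        (subst (i + i <_) (lemma i) (ℕₚ.m<m+n (i + i) (positive i p))) (ℕₚ.*-monoʳ-≤ i 2<l))
        where
        lemma : ∀ i → i + i + i ≡ i * 3
        lemma = solve-∀

      acute : 2 < l ⊎ 2 < m ⊎ 2 < n → ∃ λ a → exponent a + exponent a < t
      acute (inj₁ 2<l)        = ξ , halved i p 2<l
      acute (inj₂ (inj₁ 2<m)) = η , halved j q 2<m
      acute (inj₂ (inj₂ 2<n)) = ζ , halved k r 2<n

      0<lmn : 0 < l * m * n
      0<lmn = ℕₚ.*-mono-< {0} {l * m} {0} {n} (ℕₚ.*-mono-< {0} {l} {0} {m} (ℕₚ.<-trans ℕₚ.0<1+n 1<l) (ℕₚ.<-trans ℕₚ.0<1+n 1<m))
                (ℕₚ.<-trans ℕₚ.0<1+n 1<n)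

      flat : i + j + k ≡ t
      flat = ℕₚ.*-cancelʳ-≡ (i + j + k) t (l * m * n) {{>-nonZero 0<lmn}} (begin
        (i + j + k) * (l * m * n)                              ≡⟨ expand i j k l m n ⟩
        i * l * (m * n) + j * m * (l * n) + k * n * (l * m)    ≡⟨ cong₂ _+_ (cong₂ _+_ (cong (_* (m * n)) p) (cong (_* (l * n)) q)) (cong (_* (l * m)) r) ⟨
        t * (m * n) + t * (l * n) + t * (l * m)                ≡⟨ collect t l m n ⟩
        t * (m * n + l * n + l * m)                            ≡⟨ cong (t *_) e ⟩
        t * (l * m * n)                                        ∎)
        where
        open ≡.≡-Reasoning
        expand : ∀ i j k l m n → (i + j + k) * (l * m * n) ≡ i * l * (m * n) + j * m * (l * n) + k * n * (l * m)
        expand = solve-∀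
        collect : ∀ t l m n → t * (m * n) + t * (l * n) + t * (l * m) ≡ t * (m * n + l * n + l * m)
        collect = solve-∀

  module _ {l m n : ℕ} (nonSpherical : m * n + l * n + l * m ≤ l * m * n) where

    abstract
      chiralCover : (RQ : RegularQuotient l m n) → HasChiralCover RQ
      chiralCover RQ with ℕₚ.m≤n⇒m<n∨m≡n nonSpherical
      ... | inj₁ hyperbolic = hyperbolic⇒chiralCover RQ hyperbolic
      ... | inj₂ euclidean with classify (RegularQuotient.order-pos RQ ξ) (RegularQuotient.order-pos RQ η)
                                  (RegularQuotient.order-pos RQ ζ) euclidean
      ... | inj₁ d , large , some>2 =
        euclidean⇒chiralCover RQ (angles (s≤s (s≤s z≤n)) euclidean d large some>2) sixthRoot
      ... | inj₂ d , large , some>2 =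
        euclidean⇒chiralCover RQ (angles (s≤s (s≤s z≤n)) euclidean d large some>2) fourthRoot

    module _ (H : OrientablyRegularHypermap l m n) (finite : Finite H) where
      open OrientablyRegularHypermap H
      open Equivalence

      private
        Q Q∩ : FiniteQuotient l m n
        Q = finiteQuotient l m n H finite
        Q∩ = meet l m n Q (mirrorQuotient l m n Q)

        module Q = FiniteQuotient Q
        module R = FiniteQuotient (reindexed l m n Q∩)

        Ker⇒ : ∀ {w} → R.Ker w → Q.Ker w × Q.Ker (mirror w)
        Ker⇒ k = meet-injective l m n Q (mirrorQuotient l m n Q) (to (reindexed-coset⇔ l m n Q∩) k)

        Ker⇐ : ∀ {w} → Q.Ker w × Q.Ker (mirror w) → R.Ker w
        Ker⇐ (p , q) = from (reindexed-coset⇔ l m n Q∩) (cong₂ combine p q)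
          where open import Data.Fin.Base using (combine)

        Ker⊆N : ∀ {w} → R.Ker w → N w
        Ker⊆N k = to (finiteQuotient-Ker l m n H finite) (proj₁ (Ker⇒ k))

      regularQuotient : RegularQuotient l m n
      regularQuotient = record
        { quotient    = reindexed l m n Q∩
        ; section     = reindexed-section l m n Q∩
        ; mirror-Ker  = λ {w} k → Ker⇐ (proj₂ (Ker⇒ k) ,
            Q.Ker-resp (sym (mirror-involutive w)) (proj₁ (Ker⇒ k)))
        ; order-exact = λ a j 0<j j<k k → HasOrderModulo.least (order-modulo l m n H a) j 0<j j<k (Ker⊆N k)
        ; order-pos   = λ a → HasOrderModulo.positive (order-modulo l m n H a)
        }
        where open import Defs using (sym)

      record ProperChiralCover : Set₁ where
        field
          hypermap : OrientablyRegularHypermap l m n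
          isFinite : Finite hypermap
          isChiral : Chiral hypermap
          covers   : hypermap Covers H
          proper   : ∃ λ w → N w × ¬ OrientablyRegularHypermap.N hypermap w

      abstract
        properChiralCover : ProperChiralCover
        properChiralCover = let K , K⊆ , w , w∈K , mw∉K = chiralCover regularQuotient in record
          { hypermap = cover l m n H K (λ k → Ker⊆N (K⊆ k))
          ; isFinite = Ker-finiteIndex l m n K
          ; isChiral = mirror-witness⇒Chiral (cover l m n H K (λ k → Ker⊆N (K⊆ k))) w w∈K mw∉K
          ; covers   = λ k → Ker⊆N (K⊆ k)
          ; proper   = mirror w , Ker⊆N (RegularQuotient.mirror-Ker regularQuotient (K⊆ w∈K)) , mw∉K
          }

  module Tower {l m n : ℕ} (nonSpherical : m * n + l * n + l * m ≤ l * m * n)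
               (H : OrientablyRegularHypermap l m n) (finite : Finite H) where
    open OrientablyRegularHypermap using (N)

    tower : ℕ → Σ (OrientablyRegularHypermap l m n) Finite
    tower zero    = H , finite
    tower (suc i) = ProperChiralCover.hypermap C , ProperChiralCover.isFinite C
      where C = properChiralCover nonSpherical (proj₁ (tower i)) (proj₂ (tower i))

    level : ℕ → OrientablyRegularHypermap l m n
    level i = proj₁ (tower i)

    private
      step : ∀ i → ProperChiralCover nonSpherical (level i) (proj₂ (tower i))
      step i = properChiralCover nonSpherical (level i) (proj₂ (tower i))

    level-chiral : ∀ i → Chiral (level (suc i))
    level-chiral i = ProperChiralCover.isChiral (step i)

    level-covers : ∀ {i} j → i ≤ j → level j Covers level i
    level-covers {i} j i≤j with ℕₚ.m≤n⇒m<n∨m≡n i≤j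
    level-covers j       _ | inj₂ refl      = λ k → k
    level-covers (suc j) _ | inj₁ (s≤s i≤j) = λ k → level-covers j i≤j (ProperChiralCover.covers (step j) k)

    level-distinct-< : ∀ {i j} → i < j → ¬ (level i ≅ level j)
    level-distinct-< {i} {j} i<j (⊆ , _) =
      let w , w∈ , w∉ = ProperChiralCover.proper (step i) in w∉ (level-covers j i<j (⊆ w∈))

    level-distinct : ∀ {i j} → i ≢ j → ¬ (level i ≅ level j)
    level-distinct {i} {j} i≢j e with ℕₚ.<-cmp i j
    ... | tri< i<j _ _ = level-distinct-< i<j e
    ... | tri≈ _ i≡j _ = i≢j i≡j
    ... | tri> _ _ j<i = level-distinct-< j<i (proj₂ e , proj₁ e)

open import Defs
open import Data.Integer.Base using (+_)
open import Data.Nat.Base using (ℕ; NonZero; suc; z≤n)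
open import Data.Nat.Properties using (suc-injective)
open import Data.Product.Base using (Σ; _×_; _,_; proj₂)
open import Data.Rational.Base using (_/_; _+_; _≤_; 1ℚ)
open import Relation.Binary.PropositionalEquality using (_≢_)
open import Relation.Nullary using (¬_)

theorem2p1 : ∀ (l m n : ℕ) .{{_ : NonZero l}} .{{_ : NonZero m}} .{{_ : NonZero n}} →
    (+ 1 / l) + (+ 1 / m) + (+ 1 / n) ≤ 1ℚ →
    (H : OrientablyRegularHypermap l m n) → Finite H →
    Σ (ℕ → OrientablyRegularHypermap l m n) λ K →
    (∀ i → Finite (K i) × Chiral (K i) × K i Covers H) ×
    (∀ i j → i ≢ j → ¬ (K i ≅ K j))
theorem2p1 l m n nonSpherical H finite =
    (λ i → level (suc i))
  , (λ i → proj₂ (tower (suc i)) , level-chiral i , level-covers (suc i) z≤n)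
  , (λ i j i≢j → level-distinct (λ e → i≢j (suc-injective e)))
  where
  open NonSpherical using (module Tower; reciprocals⇒≤)
  open Tower (reciprocals⇒≤ l m n nonSpherical) H finite
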